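{- Let $\phi$ be a monotone 3-CNF formula (no negated variables, each clause has three distinct variables) and let $H_\phi$ be the trapezoid graph constructed from $\phi$ as described in the context. Then $\phi$ is NAE-satisfiable if and only if $H_\phi$ is a bounded tolerance graph.
   Context: A formula is NAE-satisfiable if there is a truth assignment such that every clause contains at least one true and at least one false variable. Tolerance / bounded tolerance graphs: $G$ on $v_1,\dots,v_n$ is a tolerance graph if there are closed intervals $I_i$ and positive reals $t_i$ with $v_iv_j\in E$ iff $|I_i\cap I_j|\ge\min\{t_i,t_j\}$; it is bounded tolerance if moreover $t_i\le |I_i|$ for all $i$. Representations: $L_1,L_2$ are two horizontal parallel lines. A permutation representation is a set of line segments ("lines") each joining a point of $L_1$ to a point of $L_2$, all endpoints distinct; its graph has the lines as vertices, adjacent iff they cross. $\theta(\ell)$ denotes the angle of line $\ell$ with $L_2$. A trapezoid with left line $p$ and right line $q$ (non-crossing, $p$ left of $q$) is the region between them; a trapezoid graph is the intersection graph of such trapezoids; a parallelogram is a trapezoid whose two lines are parallel. Construction of $R_P$ (and $P_\phi$): let $\phi=\alpha_1\wedge\cdots\wedge\alpha_k$ over variables $x_1,\ldots,x_n$, $\alpha_i=(x_{r_{i,1}}\vee x_{r_{i,2}}\vee x_{r_{i,3}})$ with $r_{i,1}<r_{i,2}<r_{i,3}$. For each occurrence $(i,j)$, $j\in\{1,2,3\}$, take a pair of crossing lines $\ell^1_{i,j},\ell^2_{i,j}$ with $\theta(\ell^1_{i,j})>\theta(\ell^2_{i,j})$; write $(a_i,c_i)=(\ell^1_{i,1},\ell^2_{i,1})$,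 $(e_i,b_i)=(\ell^1_{i,2},\ell^2_{i,2})$, $(d_i,f_i)=(\ell^1_{i,3},\ell^2_{i,3})$. Lines of different occurrences do not cross. Occurrences of variable $x_p$ lie completely to the left of occurrences of $x_{p'}$ whenever $p<p'$; occurrences of the same variable are in an arbitrary left-to-right order. For every two consecutive occurrences $(i,j)$ (left) and $(i',j')$ (right) of the same variable, add two parallel lines $u^{i',j'}_{i,j},v^{i',j'}_{i,j}$, each crossing both $\ell^1_{i,j}$ and $\ell^1_{i',j'}$ and no other line, with $\theta(\ell^1_{i,j})>\theta(u^{i',j'}_{i,j})=\theta(v^{i',j'}_{i,j})<\theta(\ell^1_{i',j'})$. This is $R_P$, with $2m$ lines, $m=6k-n$. Group the lines into $m$ pairs: $\{a_i,b_i\},\{c_i,d_i\},\{e_i,f_i\}$ for each clause, and $\{u^{i',j'}_{i,j},v^{i',j'}_{i,j}\}$ for each added pair; call them $\{u_t^1,u_t^2\}$, $t=1,\ldots,m$, with $u_t^1$ the left one of the two (non-crossing) lines. Construction of $G_\phi$ and $H_\phi$: replace in $R_P$ each pair $\{u_t^1,u_t^2\}$ by the trapezoid $T_{u_t}$ with left line $u_t^1$ and right line $u_t^2$; this gives a trapezoid representation $R_G$ of the trapezoid graph $G_\phi$ on $m$ vertices. Then for $t=1,\ldots,m$ in turn: let $\varepsilon$ be the smallest distance between two distinct endpoints on $L_1$ or on $L_2$ in the current representation, and add six parallelograms, each of whose lines is a horizontal translate of $u_t^1$ or $u_t^2$: $T_{u_{t,1}}$ has left and right lines at distance $\varepsilon/2$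 to the left and to the right of $u_t^1$; $T_{u_{t,2}}$ has right line at distance $\varepsilon/4$ and left line at distance $3\varepsilon/4$ to the left of $u_t^1$; $T_{u_{t,3}}$ has right line at distance $3\varepsilon/8$ and left line at distance $7\varepsilon/8$ to the left of $u_t^1$; $T_{u_{t,4}}$ has left and right lines at distance $\varepsilon/2$ to the left and to the right of $u_t^2$; $T_{u_{t,5}}$ has left line at distance $\varepsilon/4$ and right line at distance $3\varepsilon/4$ to the right of $u_t^2$; $T_{u_{t,6}}$ has left line at distance $3\varepsilon/8$ and right line at distance $7\varepsilon/8$ to the right of $u_t^2$. The resulting trapezoid graph on $7m$ vertices is $H_\phi$.
   Formalization: The endpoints of the lines in the representation R_P, and the intervals and tolerances of a bounded tolerance representation, are taken to be rational instead of real. -}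

module Defs where

open import Data.Nat as ℕ using (ℕ)
open import Data.Integer using (+_; -[1+_])
open import Data.Fin using (Fin; zero; suc) renaming (_<_ to _<ᶠ_)
open import Data.Bool using (Bool; true; false)
open import Data.Maybe using (Maybe; just; nothing)
open import Data.Product using (Σ; ∃; _×_; _,_; Σ-syntax)
open import Data.Sum using (_⊎_)
open import Data.List using (List; []; _∷_; _++_; map; concatMap; filter; foldl; foldr; length; lookup)
open import Data.List.Relation.Unary.Unique.Propositional using (Unique)
open import Data.Rational using (ℚ; _<_; _≤_; _-_; _+_; _*_; _⊓_; _⊔_; ∣_∣; 0ℚ; 1ℚ; _/_; _<?_)
open import Relation.Nullary using (¬_)
open import Relation.Binary.PropositionalEquality using (_≡_; _≢_)

-- A monotone 3-CNF formula with k clauses over variables x_0..x_{n-1}: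
-- clause i is (x_{cl i 0} ∨ x_{cl i 1} ∨ x_{cl i 2}).
Formula : ℕ → ℕ → Set
Formula n k = Fin k → Fin 3 → Fin n

-- r_{i,1} < r_{i,2} < r_{i,3}  (three distinct variables, listed increasingly)
Increasing : ∀ {n k} → Formula n k → Set
Increasing {k = k} cl = ∀ (i : Fin k) → (cl i zero <ᶠ cl i (suc zero)) × (cl i (suc zero) <ᶠ cl i (suc (suc zero)))

NAESat : ∀ {n k} → Formula n k → Set
NAESat {n} {k} cl = Σ (Fin n → Bool) λ σ → ∀ (i : Fin k) →
  (∃ λ j → σ (cl i j) ≡ true) × (∃ λ j → σ (cl i j) ≡ false)

overlapLen : ℚ → ℚ → ℚ → ℚ → ℚ
overlapLen l1 r1 l2 r2 = ((r1 ⊓ r2) - (l1 ⊔ l2)) ⊔ 0ℚ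

IsBoundedTolerance : (N : ℕ) → (Fin N → Fin N → Set) → Set
IsBoundedTolerance N E =
  Σ (Fin N → ℚ) λ l → Σ (Fin N → ℚ) λ r → Σ (Fin N → ℚ) λ t →
    (∀ i → l i ≤ r i) × (∀ i → 0ℚ < t i) × (∀ i → t i ≤ r i - l i) ×
    (∀ i j → i ≢ j →
       (E i j → (t i ⊓ t j) ≤ overlapLen (l i) (r i) (l j) (r j)) ×
       ((t i ⊓ t j) ≤ overlapLen (l i) (r i) (l j) (r j) → E i j))

-- Lines between L1 (y = 1, upper) and L2 (y = 0, lower)

record Line : Set where
  constructor line
  field
    top : ℚ   -- endpoint on L1
    bot : ℚ   -- endpoint on L2
open Line public

-- two lines cross iff their endpoints appear in opposite orders on L1 and L2
Cross : Line → Line → Set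
Cross ℓ ℓ' = (top ℓ - top ℓ') * (bot ℓ - bot ℓ') < 0ℚ

-- θ(ℓ) > θ(ℓ'), θ = angle with L2 measured from its positive direction;
-- direction of ℓ is (top - bot , 1), so θ is decreasing in top - bot.
AngleGt : Line → Line → Set
AngleGt ℓ ℓ' = (top ℓ - bot ℓ) < (top ℓ' - bot ℓ')

Parallel : Line → Line → Set
Parallel ℓ ℓ' = (top ℓ - bot ℓ) ≡ (top ℓ' - bot ℓ')

LeftOf : Line → Line → Set
LeftOf ℓ ℓ' = (top ℓ < top ℓ') × (bot ℓ < bot ℓ')

Occ : ℕ → Set
Occ k = Fin k × Fin 3

-- data of R_P: the two lines ℓ^1, ℓ^2 of every occurrence (index zero = ℓ^1),
-- and for every occurrence, the pair (u , v) of lines joining it to the next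
-- occurrence of the same variable (nothing if it is the last one).
record RP (k : ℕ) : Set where
  field
    occ : Occ k → Fin 2 → Line
    con : Occ k → Maybe (Line × Line)
open RP public

var : ∀ {n k} → Formula n k → Occ k → Fin n
var cl (i , j) = cl i j

ℓ¹ : ∀ {k} → RP k → Occ k → Line
ℓ¹ R o = occ R o zero

ℓ² : ∀ {k} → RP k → Occ k → Line
ℓ² R o = occ R o (suc zero)

OccLeft : ∀ {k} → RP k → Occ k → Occ k → Set
OccLeft R o o' = ∀ a b → LeftOf (occ R o a) (occ R o' b)

Succ : ∀ {n k} → Formula n k → RP k → Occ k → Occ k → Set
Succ cl R o o' = (var cl o ≡ var cl o') × OccLeft R o o' ×
  (∀ o'' → var cl o'' ≡ var cl o → ¬ (OccLeft R o o'' × OccLeft R o'' o'))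

allOcc : (k : ℕ) → List (Occ k)
allOcc k = concatMap (λ i → (i , zero) ∷ (i , suc zero) ∷ (i , suc (suc zero)) ∷ []) (Data.List.allFin k)
  where import Data.List

conLines : Maybe (Line × Line) → List Line
conLines nothing = []
conLines (just (u , v)) = u ∷ v ∷ []

allLines : ∀ {k} → RP k → List Line
allLines {k} R = concatMap (λ o → ℓ¹ R o ∷ ℓ² R o ∷ []) (allOcc k)
              ++ concatMap (λ o → conLines (con R o)) (allOcc k)

ConnOK : ∀ {k} → RP k → Occ k → Occ k → Line → Line → Set
ConnOK R o o' u v =
  Parallel u v × AngleGt (ℓ¹ R o) u × AngleGt (ℓ¹ R o') u ×
  Cross u (ℓ¹ R o) × Cross u (ℓ¹ R o') × Cross v (ℓ¹ R o) × Cross v (ℓ¹ R o') ×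
  (∀ w → w Data.List.Membership.Propositional.∈ allLines R →
     w ≢ ℓ¹ R o → w ≢ ℓ¹ R o' → ¬ Cross u w × ¬ Cross v w)
  where import Data.List.Membership.Propositional

record ValidRP {n k : ℕ} (cl : Formula n k) (R : RP k) : Set where
  field
    occCross   : ∀ o → Cross (ℓ¹ R o) (ℓ² R o)
    occAngle   : ∀ o → AngleGt (ℓ¹ R o) (ℓ² R o)
    occNoCross : ∀ o o' → o ≢ o' → ∀ a b → ¬ Cross (occ R o a) (occ R o' b)
    varOrder   : ∀ o o' → var cl o <ᶠ var cl o' → OccLeft R o o'
    conSucc    : ∀ o u v → con R o ≡ just (u , v) →
                   Σ[ o' ∈ Occ k ] (Succ cl R o o' × ConnOK R o o' u v)
    succCon    : ∀ o o' → Succ cl R o o' → ∃ λ p → con R o ≡ just p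
    distinctL1 : Unique (map top (allLines R))
    distinctL2 : Unique (map bot (allLines R))

-- a trapezoid given by (left line , right line)
Trap : Set
Trap = Line × Line

-- order a pair of non-crossing lines as (left , right)
orient : Line → Line → Trap
orient u v with top u <? top v
... | Relation.Nullary.yes _ = (u , v)
... | Relation.Nullary.no _ = (v , u)
  where import Relation.Nullary

conPair : Maybe (Line × Line) → List Trap
conPair nothing = []
conPair (just (u , v)) = orient u v ∷ []

clausePairs : ∀ {k} → RP k → Fin k → List Trap
clausePairs R i =
    orient (ℓ¹ R (i , zero)) (ℓ² R (i , suc zero))
  ∷ orient (ℓ² R (i , zero)) (ℓ¹ R (i , suc (suc zero)))
  ∷ orient (ℓ¹ R (i , suc zero)) (ℓ² R (i , suc (suc zero)))
  ∷ []

pairsOf : ∀ {k} → RP k → List Trap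
pairsOf {k} R = concatMap (clausePairs R) (Data.List.allFin k)
             ++ concatMap (λ o → conPair (con R o)) (allOcc k)
  where import Data.List

StrictLeft : Line → Line → Set
StrictLeft = LeftOf

Intersect : Trap → Trap → Set
Intersect (p , q) (p' , q') = ¬ (StrictLeft q p' ⊎ StrictLeft q' p)

TrapAdj : (S : List Trap) → Fin (length S) → Fin (length S) → Set
TrapAdj S i j = (i ≢ j) × Intersect (lookup S i) (lookup S j)

gaps : List ℚ → List ℚ
gaps xs = filter (λ d → 0ℚ <? d) (concatMap (λ x → map (λ y → ∣ x - y ∣) xs) xs)

minList : List ℚ → ℚ
minList [] = 1ℚ            -- never used (there are always two distinct endpoints)
minList (x ∷ xs) = foldr _⊓_ x xs

epsOf : List Trap → ℚ
epsOf S = minList (gaps (concatMap (λ { (p , q) → top p ∷ top q ∷ [] }) S)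
                ++ gaps (concatMap (λ { (p , q) → bot p ∷ bot q ∷ [] }) S))

shift : Line → ℚ → Line
shift ℓ δ = line (top ℓ + δ) (bot ℓ + δ)

frac8 : ℚ → Data.Integer.ℤ → ℚ
frac8 ε c = (c / 8) * ε
  where import Data.Integer

sixParallelograms : ℚ → Trap → List Trap
sixParallelograms ε (u1 , u2) =
    (shift u1 (frac8 ε -[1+ 3 ]) , shift u1 (frac8 ε (+ 4)))
  ∷ (shift u1 (frac8 ε -[1+ 5 ]) , shift u1 (frac8 ε -[1+ 1 ]))
  ∷ (shift u1 (frac8 ε -[1+ 6 ]) , shift u1 (frac8 ε -[1+ 2 ]))
  ∷ (shift u2 (frac8 ε -[1+ 3 ]) , shift u2 (frac8 ε (+ 4)))
  ∷ (shift u2 (frac8 ε (+ 2)) , shift u2 (frac8 ε (+ 6)))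
  ∷ (shift u2 (frac8 ε (+ 3)) , shift u2 (frac8 ε (+ 7)))
  ∷ []

step : List Trap → Trap → List Trap
step S u = S ++ sixParallelograms (epsOf S) u

-- H_φ: start from R_G (the trapezoids pairsOf R) and process the pairs
-- u_1, ..., u_m in the order given by the list `ord`
buildH : ∀ {k} → RP k → List Trap → List Trap
buildH R ord = foldl step (pairsOf R) ord

{-# OPTIONS --safe #-}
module Submission where

-- A bounded tolerance representation is a representation by parallelograms: the interval [l, r] with tolerance t
-- becomes the parallelogram with left line (l, l + t) and right line (r − t, r), all of whose lines have slope −t.
--
-- From a representation to an assignment.  A line ℓ of R_P bounding T_u is recorded in H_φ by T_u together with
-- its neighbour T_{u,2} or T_{u,5} just outside ℓ (the flag of ℓ).  If ℓ and ℓ' cross, the two trapezoids of ℓ meet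
-- the two of ℓ', and this forces the parallelograms of ℓ and ℓ' to have different slopes.  If ℓ ≪ ℓ' both cross w,
-- their flags are disjoint, and this forces the slopes of ℓ and ℓ' to lie on the same side of that of w.  Hence the
-- sign of slope(ℓ²) − slope(ℓ¹) is the same for all occurrences of a variable, and it serves as its truth value;
-- a clause with three equal values would give a cyclic chain of inequalities between its three slopes.
--
-- From an assignment to a representation.  The relative position of any two lines of R_P follows from a few
-- basic relations, so any family of lines satisfying these (a model) has the same intersections.  For an assignment,
-- occurrences are put into consecutive blocks of integers, the pairs of each clause get slopes ordered according to the
-- truth values, and connecting lines are squeezed between ℓ¹ and ℓ² of their two occurrences.  The translates
-- T_{u,1}, …, T_{u,6} are added as in H_φ.  One degenerate case needs care: if the two lines of the pair processed
-- first are at distance exactly ε, then T_{u,1} and T_{u,4} touch, and they are made to touch halfway.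

open import Defs
open import Data.Nat as ℕ using (ℕ; zero; suc; s≤s; z≤n)
open import Data.Product using (∃; _×_; _,_; proj₁; proj₂)
open import Data.List using (List; []; _∷_; _++_; map; concatMap; allFin; foldl; foldr; filter; length; lookup)
open import Data.List.Relation.Binary.Permutation.Propositional using (_↭_; ↭-sym; ↭⇒↭ₛ)
open import Data.Bool using (Bool; true; false)
open import Data.Empty using (⊥; ⊥-elim)
open import Data.Fin using (Fin; zero; suc) renaming (_<_ to _<ᶠ_)
open import Data.Fin.Patterns using (0F; 1F; 2F; 3F; 4F; 5F; 6F)
import Data.Fin.Properties as Finₚ
open import Data.List.Membership.Propositional using (_∈_; lose; find)
open import Data.List.Membership.Propositional.Properties
open import Data.Sum as Sum using (_⊎_; inj₁; inj₂)
open import Relation.Binary using (tri<; tri≈; tri>; DecidableEquality)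
open import Relation.Binary.PropositionalEquality
open import Relation.Nullary using (¬_; Dec; yes; no; does)
open import Relation.Nullary.Decidable using (from-yes; _×-dec_; _⊎-dec_; map′; dec-true; dec-false; ¬?; decidable-stable)

-- A trapezoid alone does not determine its lines in another representation: its parallelogram may,
-- for instance, appear mirrored. What survives is that anything meeting two disjoint trapezoids
-- meets the line of either one that faces the other. This is why a line is recorded by a body and a
-- flag.
--
-- The sizes of the shifts matter. If γ is the smallest gap of R_P, the first pair is processed with
-- ε equal to γ; its parallelograms leave a gap of γ/8, so every later ε is at most γ/8. Shifts are
-- at most 7/8 of ε, hence lines of different pairs approach each other by at most 7/8 · 9/8 · γ =
-- 63/64 · γ and keep their order. Within a pair, only the two shifts by ε/2 of T_{u,1} and T_{u,4}
-- can close the distance completely. No line of R_P lies between the lines of such a pair, so a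
-- common edge halfway between them disturbs no other intersection.
--
-- Adjacency depends only on whether a right edge is ≪ a left edge; it therefore suffices that all
-- such comparisons come out alike in H_φ and in the new representation.

module RationalGeometry where

  open import Data.Integer as ℤ using (ℤ; +_; -[1+_]; _⊖_)
  import Data.Integer.Properties as ℤₚ
  open import Data.List.Properties using (map-++; map-concatMap; concatMap-cong; ++-assoc; ++-identityʳ)
  import Data.List.Relation.Binary.Permutation.Setoid.Properties as Permutationₛ
  open import Data.List.Relation.Binary.Permutation.Propositional.Properties using (↭-map-inv; ∈-resp-↭)
  open import Data.List.Relation.Unary.All as All using (All; []; _∷_)
  import Data.List.Relation.Unary.All.Properties as Allₚ
  open import Data.List.Relation.Unary.AllPairs using (AllPairs; []; _∷_)
  import Data.List.Relation.Unary.AllPairs.Properties as AllPairsₚ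
  open import Data.List.Relation.Unary.Any as Any using (here; there)
  import Data.List.Relation.Unary.Any.Properties as Anyₚ
  open import Data.List.Relation.Unary.Unique.Propositional using (Unique)
  import Data.List.Relation.Unary.Unique.Propositional.Properties as Uniqueₚ
  open import Data.Maybe using (Maybe; just; nothing)
  import Data.Nat.Properties as ℕₚ
  open import Data.Product.Properties using (≡-dec)
  open import Data.Rational using (ℚ; _<_; _≤_; _-_; _+_; _*_; _⊓_; _⊔_; ∣_∣; 0ℚ; 1ℚ; _/_; _<?_; _≤?_; -_; positive; negative)
  open import Data.Rational.Properties
  open import Data.Rational.Solver using (module +-*-Solver)
  import Data.Rational.Unnormalised as ℚᵘ
  import Data.Rational.Unnormalised.Properties as ℚᵘₚ
  open import Function using (_∘_)
  open import Relation.Unary using (Decidable)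
  open +-*-Solver using (solve; _:+_; _:-_; _:*_; _:=_) renaming (con to constant)

  -- Rational inequalities via differences

  p<q⇒0<q-p : ∀ {p q} → p < q → 0ℚ < q - p
  p<q⇒0<q-p {p} {q} h = subst (_< q - p) (+-inverseʳ p) (+-monoˡ-< (- p) h)

  p≤q⇒0≤q-p : ∀ {p q} → p ≤ q → 0ℚ ≤ q - p
  p≤q⇒0≤q-p {p} {q} h = subst (_≤ q - p) (+-inverseʳ p) (+-monoˡ-≤ (- p) h)

  private
    cancel : ∀ p q → (q - p) + p ≡ q
    cancel = solve 2 (λ p q → (q :- p) :+ p := q) refl

  0<q-p⇒p<q : ∀ {p q} → 0ℚ < q - p → p < q
  0<q-p⇒p<q {p} {q} h = subst₂ _<_ (+-identityˡ p) (cancel p q) (+-monoˡ-< p h)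

  0≤q-p⇒p≤q : ∀ {p q} → 0ℚ ≤ q - p → p ≤ q
  0≤q-p⇒p≤q {p} {q} h = subst₂ _≤_ (+-identityˡ p) (cancel p q) (+-monoˡ-≤ p h)

  -- Lets the ring solver carry an inequality from one pair of terms to another: only the two
  -- differences have to be shown equal.
  <-by : ∀ {p q p' q'} → q - p ≡ q' - p' → p < q → p' < q'
  <-by e h = 0<q-p⇒p<q (subst (0ℚ <_) e (p<q⇒0<q-p h))

  ≤-by : ∀ {p q p' q'} → q - p ≡ q' - p' → p ≤ q → p' ≤ q'
  ≤-by e h = 0≤q-p⇒p≤q (subst (0ℚ ≤_) e (p≤q⇒0≤q-p h))

  <-<-by : ∀ {p q r s p' q'} → (q - p) + (s - r) ≡ q' - p' → p < q → r < s → p' < q'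
  <-<-by e h k = 0<q-p⇒p<q (subst (0ℚ <_) e (+-mono-< (p<q⇒0<q-p h) (p<q⇒0<q-p k)))

  <-≤-by : ∀ {p q r s p' q'} → (q - p) + (s - r) ≡ q' - p' → p < q → r ≤ s → p' < q'
  <-≤-by e h k = 0<q-p⇒p<q (subst (0ℚ <_) e (+-mono-<-≤ (p<q⇒0<q-p h) (p≤q⇒0≤q-p k)))

  -- Bounded tolerance and parallelograms

  parallelogram : ℚ → ℚ → ℚ → Trap
  parallelogram l r t = line l (l + t) , line (r - t) r

  <-⊓ : ∀ {p} x y → p < x → p < y → p < x ⊓ y
  <-⊓ {p} x y h k with ⊓-sel x y
  ... | inj₁ e = subst (p <_) (sym e) h
  ... | inj₂ e = subst (p <_) (sym e) k

  ⊔-< : ∀ {p} x y → x < p → y < p → x ⊔ y < p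
  ⊔-< {p} x y h k with ⊔-sel x y
  ... | inj₁ e = subst (_< p) (sym e) h
  ... | inj₂ e = subst (_< p) (sym e) k

  overlapLen-comm : ∀ l r l' r' → overlapLen l r l' r' ≡ overlapLen l' r' l r
  overlapLen-comm l r l' r' = cong₂ (λ a b → (a - b) ⊔ 0ℚ) (⊓-comm r r') (⊔-comm l l')

  -- The two coordinates of `LeftOf` amount to `r - l' < t` and `r - l' < t'`, and `r - l'` bounds
  -- the overlap.
  leftOf⇒intolerant : ∀ l r t l' r' t' → 0ℚ < t → 0ℚ < t' →
    LeftOf (proj₂ (parallelogram l r t)) (proj₁ (parallelogram l' r' t')) →
    overlapLen l r l' r' < t ⊓ t'
  leftOf⇒intolerant l r t l' r' t' 0<t 0<t' (a , b) =
    ⊔-< ((r ⊓ r') - (l ⊔ l')) 0ℚ ov< (<-⊓ t t' 0<t 0<t')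
    where
    ov≤ : (r ⊓ r') - (l ⊔ l') ≤ r - l'
    ov≤ = +-mono-≤ (p⊓q≤p r r') (neg-antimono-≤ (p≤q⊔p l l'))
    ov< : (r ⊓ r') - (l ⊔ l') < t ⊓ t'
    ov< = ≤-<-trans ov≤ (<-⊓ t t'
      (<-by (solve 3 (λ r t l' → l' :- (r :- t) := t :- (r :- l')) refl r t l') a)
      (<-by (solve 3 (λ r t' l' → (l' :+ t') :- r := t' :- (r :- l')) refl r t' l') b))

  tolerant⇒intersect : ∀ l r t l' r' t' → 0ℚ < t → 0ℚ < t' →
    t ⊓ t' ≤ overlapLen l r l' r' → Intersect (parallelogram l r t) (parallelogram l' r' t')
  tolerant⇒intersect l r t l' r' t' 0<t 0<t' le (inj₁ d) =
    <-irrefl refl (≤-<-trans le (leftOf⇒intolerant l r t l' r' t' 0<t 0<t' d))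
  tolerant⇒intersect l r t l' r' t' 0<t 0<t' le (inj₂ d) =
    <-irrefl refl (≤-<-trans (subst₂ _≤_ (⊓-comm t t') (overlapLen-comm l r l' r') le)
      (leftOf⇒intolerant l' r' t' l r t 0<t' 0<t d))

  -- If the overlap is below both tolerances, the intervals are not nested: otherwise the overlap
  -- would be a whole interval, at least as long as its tolerance. So it is `r - l'` or `r' - l`,
  -- and this makes the parallelograms disjoint.
  intersect⇒tolerant : ∀ l r t l' r' t' → t ≤ r - l → t' ≤ r' - l' →
    Intersect (parallelogram l r t) (parallelogram l' r' t') → t ⊓ t' ≤ overlapLen l r l' r'
  intersect⇒tolerant l r t l' r' t' t≤ t'≤ int with (t ⊓ t') ≤? overlapLen l r l' r'
  ... | yes p = p
  ... | no ¬p = ⊥-elim (absurd (≤-total r r') (≤-total l l'))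
    where
    small : (r ⊓ r') - (l ⊔ l') < t ⊓ t'
    small = ≤-<-trans (p≤p⊔q _ 0ℚ) (≰⇒> ¬p)
    smallₜ : (r ⊓ r') - (l ⊔ l') < t
    smallₜ = <-≤-trans small (p⊓q≤p t t')
    smallₜ' : (r ⊓ r') - (l ⊔ l') < t'
    smallₜ' = <-≤-trans small (p⊓q≤q t t')
    at : ∀ {a b c} → r ⊓ r' ≡ a → l ⊔ l' ≡ b → (r ⊓ r') - (l ⊔ l') < c → a - b < c
    at refl refl h = h
    absurd : r ≤ r' ⊎ r' ≤ r → l ≤ l' ⊎ l' ≤ l → ⊥
    absurd (inj₁ rr) (inj₁ ll) = int (inj₁
      ( <-by (solve 3 (λ r t l' → t :- (r :- l') := l' :- (r :- t)) refl r t l')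
          (at (p≤q⇒p⊓q≡p rr) (p≤q⇒p⊔q≡q ll) smallₜ)
      , <-by (solve 3 (λ r t' l' → t' :- (r :- l') := (l' :+ t') :- r) refl r t' l')
          (at (p≤q⇒p⊓q≡p rr) (p≤q⇒p⊔q≡q ll) smallₜ') ))
    absurd (inj₁ rr) (inj₂ ll) =
      <-irrefl refl (<-≤-trans (at (p≤q⇒p⊓q≡p rr) (p≥q⇒p⊔q≡p ll) smallₜ) t≤)
    absurd (inj₂ rr) (inj₁ ll) =
      <-irrefl refl (<-≤-trans (at (p≥q⇒p⊓q≡q rr) (p≤q⇒p⊔q≡q ll) smallₜ') t'≤)
    absurd (inj₂ rr) (inj₂ ll) = int (inj₂
      ( <-by (solve 3 (λ r' t' l → t' :- (r' :- l) := l :- (r' :- t')) refl r' t' l)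
          (at (p≥q⇒p⊓q≡q rr) (p≥q⇒p⊔q≡p ll) smallₜ')
      , <-by (solve 3 (λ r' t l → t :- (r' :- l) := (l :+ t) :- r') refl r' t l)
          (at (p≥q⇒p⊓q≡q rr) (p≥q⇒p⊔q≡p ll) smallₜ) ))

  -- Lines of trapezoids, facing lines and slopes

  infix 4 _≪_ _◁_

  _≪_ : Line → Line → Set
  _≪_ = LeftOf

  _≪?_ : ∀ p q → Dec (p ≪ q)
  p ≪? q = (top p <? top q) ×-dec (bot p <? bot q)

  ≪-trans : ∀ {p q r} → p ≪ q → q ≪ r → p ≪ r
  ≪-trans (a , b) (c , d) = <-trans a c , <-trans b d

  ≪-irrefl : ∀ {p} → ¬ (p ≪ p)
  ≪-irrefl (a , _) = <-irrefl refl a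

  _◁_ : Trap → Trap → Set
  T ◁ T' = proj₂ T ≪ proj₁ T'

  Disjoint : Trap → Trap → Set
  Disjoint T T' = (T ◁ T') ⊎ (T' ◁ T)

  disjoint? : ∀ T T' → Dec (Disjoint T T')
  disjoint? (p , q) (p' , q') = (q ≪? p') ⊎-dec (q' ≪? p)

  disjoint-sym : ∀ {T T'} → Disjoint T T' → Disjoint T' T
  disjoint-sym (inj₁ a) = inj₂ a
  disjoint-sym (inj₂ a) = inj₁ a

  WellFormed : Trap → Set
  WellFormed (p , q) = (top p ≤ top q) × (bot p ≤ bot q)

  slope : Line → ℚ
  slope ℓ = top ℓ - bot ℓ

  record Parallelogram (T : Trap) : Set where
    constructor par
    field
      wellFormed : WellFormed T
      parallel   : slope (proj₂ T) ≡ slope (proj₁ T)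
  open Parallelogram

  ≪-wf-trans : ∀ {p q T} → WellFormed T → p ≪ proj₁ T → proj₂ T ≪ q → p ≪ q
  ≪-wf-trans (wt , wb) (a , b) (c , d) =
    <-trans a (≤-<-trans wt c) , <-trans b (≤-<-trans wb d)

  -- Indexed by the line of `T` on the side of `h`, because nothing tells in advance on which side a
  -- given representation puts `h`.
  data Facing (T h : Trap) : Line → Set where
    leftFacing  : h ◁ T → Facing T h (proj₁ T)
    rightFacing : T ◁ h → Facing T h (proj₂ T)

  facing : ∀ {T h} → Disjoint h T → ∃ (Facing T h)
  facing (inj₁ a) = _ , leftFacing a
  facing (inj₂ a) = _ , rightFacing a

  facing-slope : ∀ {T h X} → Parallelogram T → Facing T h X → slope X ≡ slope (proj₁ T)
  facing-slope P (leftFacing _)  = refl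
  facing-slope P (rightFacing _) = parallel P

  module _ {T h : Trap} {X : Line} (wT : WellFormed T) where
    facing-top≤ : Facing T h X → top X ≤ top (proj₂ T)
    facing-top≤ (leftFacing _)  = proj₁ wT
    facing-top≤ (rightFacing _) = ≤-refl
    facing-bot≤ : Facing T h X → bot X ≤ bot (proj₂ T)
    facing-bot≤ (leftFacing _)  = proj₂ wT
    facing-bot≤ (rightFacing _) = ≤-refl
    facing-top≥ : Facing T h X → top (proj₁ T) ≤ top X
    facing-top≥ (leftFacing _)  = ≤-refl
    facing-top≥ (rightFacing _) = proj₁ wT
    facing-bot≥ : Facing T h X → bot (proj₁ T) ≤ bot X
    facing-bot≥ (leftFacing _)  = ≤-refl
    facing-bot≥ (rightFacing _) = proj₂ wT

  Meets : Line → Trap → Set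
  Meets X T = ¬ (proj₂ T ≪ X) × ¬ (X ≪ proj₁ T)

  -- Beyond `X` on the side of `h`, `U` would miss `T`; on the side of `T`, it would miss `h`.
  facing-meets : ∀ {T h X U} → WellFormed T → Facing T h X →
    Intersect U T → Intersect U h → Meets X U
  facing-meets wT (leftFacing (a , b)) iT ih =
    (λ u → iT (inj₁ u)) , (λ u → ih (inj₂ (≪-trans (a , b) u)))
  facing-meets wT (rightFacing d) iT ih =
    (λ u → ih (inj₁ (≪-trans u d))) , (λ u → iT (inj₂ u))

  facing-≪ : ∀ {T h X Z} → Facing T h X → Meets Z T → Meets Z h → ¬ (X ≪ Z)
  facing-≪ (leftFacing d)  mT mh xz = proj₁ mh (≪-trans d xz)
  facing-≪ (rightFacing d) mT mh xz = proj₁ mT xz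

  facing-≫ : ∀ {T h X Z} → Facing T h X → Meets Z T → Meets Z h → ¬ (Z ≪ X)
  facing-≫ (leftFacing d)  mT mh zx = proj₂ mT zx
  facing-≫ (rightFacing d) mT mh zx = proj₂ mh (≪-trans zx d)

  facing-≢ : ∀ {T h X Z} → Facing T h X → Meets Z h → X ≢ Z
  facing-≢ (leftFacing d)  mh refl = proj₁ mh d
  facing-≢ (rightFacing d) mh refl = proj₂ mh d

  -- Incomparable lines cross weakly, and the slopes tell in which direction.
  slope-< : ∀ {X Z} → ¬ (X ≪ Z) → ¬ (Z ≪ X) → slope X < slope Z →
    (top X ≤ top Z) × (bot Z ≤ bot X)
  slope-< {line t b} {line t' b'} n m s = ≮⇒≥ f , ≮⇒≥ g
    where
    f : ¬ (t' < t)
    f h with b' <? b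
    ... | yes k = m (h , k)
    ... | no k = <-irrefl refl (<-trans s (<-≤-by
            (solve 4 (λ t b t' b' → (t :- t') :+ (b' :- b) := (t :- b) :- (t' :- b')) refl t b t' b') h (≮⇒≥ k)))
    g : ¬ (b < b')
    g h with t <? t'
    ... | yes k = n (k , h)
    ... | no k = <-irrefl refl (<-trans s (<-≤-by
            (solve 4 (λ t b t' b' → (b' :- b) :+ (t :- t') := (t :- b) :- (t' :- b')) refl t b t' b') h (≮⇒≥ k)))

  parallel-shift : ∀ {u v} → Parallel u v → top v - top u ≡ bot v - bot u
  parallel-shift {line t b} {line t' b'} e = begin
    t' - t                             ≡⟨ solve 4 (λ t b t' b' → t' :- t := ((t' :- b') :- (t :- b)) :+ (b' :- b)) refl t b t' b' ⟩
    ((t' - b') - (t - b)) + (b' - b)   ≡⟨ cong (λ z → ((t' - b') - z) + (b' - b)) e ⟩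
    ((t' - b') - (t' - b')) + (b' - b) ≡⟨ solve 3 (λ b t' b' → ((t' :- b') :- (t' :- b')) :+ (b' :- b) := b' :- b) refl b t' b' ⟩
    b' - b                             ∎
    where open ≡-Reasoning

  slope-≡ : ∀ {X Z} → ¬ (X ≪ Z) → ¬ (Z ≪ X) → slope X ≡ slope Z → X ≡ Z
  slope-≡ {X} {Z} n m s with <-cmp (top X) (top Z)
  ... | tri< h _ _ = ⊥-elim (n (h , <-by (parallel-shift {X} {Z} s) h))
  ... | tri> _ _ h = ⊥-elim (m (h , <-by (parallel-shift {Z} {X} (sym s)) h))
  ... | tri≈ _ refl _ = cong (line (top X)) (begin
          bot X                   ≡⟨ solve 2 (λ t b → b := t :- (t :- b)) refl (top X) (bot X) ⟩
          top X - (top X - bot X) ≡⟨ cong (λ z → top X - z) s ⟩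
          top X - (top X - bot Z) ≡⟨ solve 2 (λ t b → t :- (t :- b) := b) refl (top X) (bot Z) ⟩
          bot Z                   ∎)
    where open ≡-Reasoning

  -- Stands for one of the two lines of body, namely the one facing flag.
  record Flagged : Set where
    constructor flagged
    field
      {body flag} : Trap
      bodyPar  : Parallelogram body
      flagWf   : WellFormed flag
      disjoint : Disjoint flag body

    bodyWf : WellFormed body
    bodyWf = wellFormed bodyPar

    slopeOf : ℚ
    slopeOf = slope (proj₁ body)
  open Flagged

  record Crossing (F G : Flagged) : Set where
    constructor crossing
    field
      bb : Intersect (body F) (body G)
      bf : Intersect (body F) (flag G)
      fb : Intersect (flag F) (body G)
      ff : Intersect (flag F) (flag G)
  open Crossing

  crossing-meets : ∀ {F G X} → Crossing F G → Facing (body G) (flag G) X →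
    Meets X (body F) × Meets X (flag F)
  crossing-meets {F} {G} c f =
      facing-meets (bodyWf G) f (bb c) (bf c)
    , facing-meets (bodyWf G) f (fb c) (ff c)

  -- With equal slopes the two facing lines, neither of which is ≪ the other, would coincide; but
  -- the line of `G` meets the flag of `F`, and the line of `F` does not.
  crossing-slope-≢ : ∀ {F G} → Crossing F G → slopeOf F ≢ slopeOf G
  crossing-slope-≢ {F} {G} c e with facing (disjoint F) | facing (disjoint G)
  ... | X , fX | Z , fZ = facing-≢ fX mf (slope-≡ (facing-≪ fX mb mf) (facing-≫ fX mb mf)
          (trans (facing-slope (bodyPar F) fX) (trans e (sym (facing-slope (bodyPar G) fZ)))))
    where
    mb = proj₁ (crossing-meets c fZ)
    mf = proj₂ (crossing-meets c fZ)

  -- If w crosses F and G with slopes on different sides of its own, the facing lines X of F and Y of G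
  -- form a crossing around the facing line Z of w, which no flag separating F from G can then meet.
  crossing-same-side : ∀ {F G W} → Disjoint (flag F) (flag G) → Crossing F W → Crossing G W →
    slopeOf F < slopeOf W → slopeOf W < slopeOf G → ⊥
  crossing-same-side {F} {G} {W} dFG cF cG s s' with facing (disjoint F) | facing (disjoint G) | facing (disjoint W)
  ... | X , fX | Y , fY | Z , fZ = main
    where
    P Q hP hQ : Trap
    P = body F
    Q = body G
    hP = flag F
    hQ = flag G
    mP = proj₁ (crossing-meets cF fZ)
    mhP = proj₂ (crossing-meets cF fZ)
    mQ = proj₁ (crossing-meets cG fZ)
    mhQ = proj₂ (crossing-meets cG fZ)

    XZ : (top X ≤ top Z) × (bot Z ≤ bot X)
    XZ = slope-< (facing-≪ fX mP mhP) (facing-≫ fX mP mhP)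
      (subst₂ _<_ (sym (facing-slope (bodyPar F) fX)) (sym (facing-slope (bodyPar W) fZ)) s)
    ZY : (top Z ≤ top Y) × (bot Y ≤ bot Z)
    ZY = slope-< (facing-≫ fY mQ mhQ) (facing-≪ fY mQ mhQ)
      (subst₂ _<_ (sym (facing-slope (bodyPar W) fZ)) (sym (facing-slope (bodyPar G) fY)) s')

    tXY = ≤-trans (proj₁ XZ) (proj₁ ZY)
    bYX = ≤-trans (proj₂ ZY) (proj₂ XZ)

    -- The bodies contain `X` and `Y`, which cross weakly, so they cannot be disjoint.
    ¬P◁Q : ¬ (P ◁ Q)
    ¬P◁Q (_ , b) = <-irrefl refl (≤-<-trans (facing-bot≤ (bodyWf F) fX)
      (<-≤-trans b (≤-trans (facing-bot≥ (bodyWf G) fY) bYX)))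
    ¬Q◁P : ¬ (Q ◁ P)
    ¬Q◁P (t , _) = <-irrefl refl (≤-<-trans (facing-top≤ (bodyWf G) fY)
      (<-≤-trans t (≤-trans (facing-top≥ (bodyWf F) fX) tXY)))

    -- Either the flag would miss `Z`, or it would lie between the two bodies and separate them.
    hP-Q : Facing P hP X → Disjoint hP Q → ⊥
    hP-Q (leftFacing (a , _)) (inj₁ (_ , b)) =
      proj₁ mhP (<-≤-trans a (proj₁ XZ) , <-≤-trans b (≤-trans (facing-bot≥ (bodyWf G) fY) (proj₂ ZY)))
    hP-Q (leftFacing d) (inj₂ d') = ¬Q◁P (≪-wf-trans (flagWf F) d' d)
    hP-Q (rightFacing d) (inj₁ d') = ¬P◁Q (≪-wf-trans (flagWf F) d d')
    hP-Q (rightFacing (_ , b)) (inj₂ (a , _)) =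
      proj₂ mhP (≤-<-trans (≤-trans (proj₁ ZY) (facing-top≤ (bodyWf G) fY)) a , ≤-<-trans (proj₂ XZ) b)

    hQ-P : Facing Q hQ Y → Disjoint hQ P → ⊥
    hQ-P (leftFacing (_ , b)) (inj₁ (a , _)) =
      proj₁ mhQ (<-≤-trans a (≤-trans (facing-top≥ (bodyWf F) fX) (proj₁ XZ)) , <-≤-trans b (proj₂ ZY))
    hQ-P (leftFacing d) (inj₂ d') = ¬P◁Q (≪-wf-trans (flagWf G) d' d)
    hQ-P (rightFacing d) (inj₁ d') = ¬Q◁P (≪-wf-trans (flagWf G) d d')
    hQ-P (rightFacing (a , _)) (inj₂ (_ , b)) =
      proj₂ mhQ (≤-<-trans (proj₁ ZY) a , ≤-<-trans (≤-trans (proj₂ XZ) (facing-bot≤ (bodyWf F) fX)) b)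

    opposite : Facing P hP X → Facing Q hQ Y → Disjoint hP hQ →
      Intersect hP Q → Intersect hQ P → ⊥
    opposite (leftFacing _) (leftFacing d) (inj₁ e) i _ = i (inj₁ (≪-wf-trans (flagWf G) e d))
    opposite (leftFacing d) (leftFacing _) (inj₂ e) _ i = i (inj₁ (≪-wf-trans (flagWf F) e d))
    opposite (rightFacing d) (rightFacing _) (inj₁ e) _ i = i (inj₂ (≪-wf-trans (flagWf F) d e))
    opposite (rightFacing _) (rightFacing d) (inj₂ e) i _ = i (inj₂ (≪-wf-trans (flagWf G) d e))
    -- This case and its mirror image do not follow by transitivity. Here both flags are past `Z` on
    -- L1, on different sides, so both must reach `Z` on L2 and cannot be strictly ordered there;
    -- the mirror image exchanges L1 and L2.
    opposite (leftFacing (a , _)) (rightFacing (a' , _)) (inj₁ (_ , e)) _ _ =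
      <-irrefl refl (<-≤-trans e (≤-trans
        (≮⇒≥ λ k → proj₂ mhQ (≤-<-trans (proj₁ ZY) a' , k))
        (≮⇒≥ λ k → proj₁ mhP (<-≤-trans a (proj₁ XZ) , k))))
    opposite (leftFacing d) (rightFacing d') (inj₂ e) _ _ =
      ¬Q◁P (≪-wf-trans (flagWf F) (≪-wf-trans (flagWf G) d' e) d)
    opposite (rightFacing d) (leftFacing d') (inj₁ e) _ _ =
      ¬P◁Q (≪-wf-trans (flagWf G) (≪-wf-trans (flagWf F) d e) d')
    opposite (rightFacing (_ , b)) (leftFacing (_ , b')) (inj₂ (e , _)) _ _ =
      <-irrefl refl (<-≤-trans e (≤-trans
        (≮⇒≥ λ k → proj₂ mhP (k , ≤-<-trans (proj₂ XZ) b))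
        (≮⇒≥ λ k → proj₁ mhQ (k , <-≤-trans b' (proj₂ ZY)))))

    main : ⊥
    main = opposite fX fY dFG (hP-Q fX) (hQ-P fY)

  -- Distinctness in concatenated lists

  AllPairs-++⁻ : ∀ {A : Set} {P : A → A → Set} xs {ys} → AllPairs P (xs ++ ys) →
    AllPairs P xs × AllPairs P ys × (∀ {x y} → x ∈ xs → y ∈ ys → P x y)
  AllPairs-++⁻ [] ps = [] , ps , λ ()
  AllPairs-++⁻ {P = P} (x ∷ xs) {ys} (p ∷ ps) with AllPairs-++⁻ xs ps
  ... | a , b , c = Allₚ.++⁻ˡ xs p ∷ a , b , across
    where
    across : ∀ {z y} → z ∈ x ∷ xs → y ∈ ys → P z y
    across (here refl) y∈ = All.lookup (Allₚ.++⁻ʳ xs p) y∈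
    across (there z∈)  y∈ = c z∈ y∈

  module _ {A B C : Set} (f : B → C) (h : A → List B) where

    private
      _≢f_ : B → B → Set
      y ≢f y' = f y ≢ f y'

    concatMap-within : ∀ xs → AllPairs _≢f_ (concatMap h xs) → ∀ {x} → x ∈ xs → AllPairs _≢f_ (h x)
    concatMap-within (x ∷ xs) ps (here refl) = proj₁ (AllPairs-++⁻ (h x) ps)
    concatMap-within (x ∷ xs) ps (there x∈)  = concatMap-within xs (proj₁ (proj₂ (AllPairs-++⁻ (h x) ps))) x∈

    concatMap-across : ∀ xs → AllPairs _≢f_ (concatMap h xs) →
      ∀ {x x' y y'} → x ∈ xs → x' ∈ xs → x ≢ x' → y ∈ h x → y' ∈ h x' → f y ≢ f y'
    concatMap-across (x ∷ xs) ps (here refl) (here refl) n _ _ = ⊥-elim (n refl)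
    concatMap-across (x ∷ xs) ps (here refl) (there q) n a b =
      proj₂ (proj₂ (AllPairs-++⁻ (h x) ps)) a (∈-concatMap⁺ h (lose q b))
    concatMap-across (x ∷ xs) ps (there p) (here refl) n a b =
      ≢-sym (proj₂ (proj₂ (AllPairs-++⁻ (h x) ps)) b (∈-concatMap⁺ h (lose p a)))
    concatMap-across (x ∷ xs) ps (there p) (there q) n a b =
      concatMap-across xs (proj₁ (proj₂ (AllPairs-++⁻ (h x) ps))) p q n a b

  ∈-allOcc : ∀ {k} (o : Occ k) → o ∈ allOcc k
  ∈-allOcc {k} (i , j) = ∈-concatMap⁺ (λ i → (i , zero) ∷ (i , suc zero) ∷ (i , suc (suc zero)) ∷ [])
    (lose (∈-allFin i) (at j))
    where
    at : ∀ j → (i , j) ∈ ((i , zero) ∷ (i , suc zero) ∷ (i , suc (suc zero)) ∷ [])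
    at zero = here refl
    at (suc zero) = there (here refl)
    at (suc (suc zero)) = there (there (here refl))

  _≟ᵒ_ : ∀ {k} → DecidableEquality (Occ k)
  _≟ᵒ_ = ≡-dec Finₚ._≟_ Finₚ._≟_

  -- Crossing lines

  Crossed : Line → Line → Set
  Crossed p q = (top p < top q × bot q < bot p) ⊎ (top q < top p × bot p < bot q)

  private
    neg⇒< : ∀ {p q} → p - q < 0ℚ → p < q
    neg⇒< {p} {q} = <-by (solve 2 (λ p q → constant 0ℚ :- (p :- q) := q :- p) refl p q)
    <⇒neg : ∀ {p q} → p < q → p - q < 0ℚ
    <⇒neg {p} {q} = <-by (solve 2 (λ p q → q :- p := constant 0ℚ :- (p :- q)) refl p q)

    pos*pos : ∀ a b → 0ℚ < a → 0ℚ < b → 0ℚ < a * b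
    pos*pos a b h k = positive⁻¹ (a * b) {{pos*pos⇒pos a {{positive h}} b {{positive k}}}}
    neg*neg : ∀ a b → a < 0ℚ → b < 0ℚ → 0ℚ < a * b
    neg*neg a b h k = positive⁻¹ (a * b) {{neg*neg⇒pos a {{negative h}} b {{negative k}}}}
    neg*pos : ∀ a b → a < 0ℚ → 0ℚ < b → a * b < 0ℚ
    neg*pos a b h k = negative⁻¹ (a * b) {{neg*pos⇒neg a {{negative h}} b {{positive k}}}}
    pos*neg : ∀ a b → 0ℚ < a → b < 0ℚ → a * b < 0ℚ
    pos*neg a b h k = negative⁻¹ (a * b) {{pos*neg⇒neg a {{positive h}} b {{negative k}}}}

    product-signs : ∀ a b → a * b < 0ℚ → (a < 0ℚ × 0ℚ < b) ⊎ (0ℚ < a × b < 0ℚ)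
    product-signs a b c with <-cmp a 0ℚ | <-cmp b 0ℚ
    ... | tri< h _ _ | tri> _ _ k = inj₁ (h , k)
    ... | tri> _ _ h | tri< k _ _ = inj₂ (h , k)
    ... | tri< h _ _ | tri< k _ _ = ⊥-elim (<-asym c (neg*neg a b h k))
    ... | tri> _ _ h | tri> _ _ k = ⊥-elim (<-asym c (pos*pos a b h k))
    ... | tri≈ _ refl _ | _       = ⊥-elim (<-irrefl (*-zeroˡ b) c)
    ... | tri< _ _ _ | tri≈ _ refl _ = ⊥-elim (<-irrefl (*-zeroʳ a) c)
    ... | tri> _ _ _ | tri≈ _ refl _ = ⊥-elim (<-irrefl (*-zeroʳ a) c)

  cross⇒crossed : ∀ {p q} → Cross p q → Crossed p q
  cross⇒crossed {p} {q} c with product-signs (top p - top q) (bot p - bot q) c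
  ... | inj₁ (a , b) = inj₁ (neg⇒< a , 0<q-p⇒p<q b)
  ... | inj₂ (a , b) = inj₂ (0<q-p⇒p<q a , neg⇒< b)

  crossed⇒cross : ∀ {p q} → Crossed p q → Cross p q
  crossed⇒cross (inj₁ (a , b)) = neg*pos _ _ (<⇒neg a) (p<q⇒0<q-p b)
  crossed⇒cross (inj₂ (a , b)) = pos*neg _ _ (p<q⇒0<q-p a) (<⇒neg b)

  steeper-crossing : ∀ {p q} → AngleGt p q → Crossed p q → top p < top q × bot q < bot p
  steeper-crossing s (inj₁ c) = c
  steeper-crossing {line t b} {line t' b'} s (inj₂ (h , k)) = ⊥-elim (<-asym s (<-<-by
    (solve 4 (λ t b t' b' → (t :- t') :+ (b' :- b) := (t :- b) :- (t' :- b')) refl t b t' b') h k))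

  non-crossing : ∀ {p q} → ¬ Cross p q → top p ≢ top q → bot p ≢ bot q → (p ≪ q) ⊎ (q ≪ p)
  non-crossing {p} {q} n a b with <-cmp (top p) (top q) | <-cmp (bot p) (bot q)
  ... | tri≈ _ e _ | _          = ⊥-elim (a e)
  ... | _          | tri≈ _ e _ = ⊥-elim (b e)
  ... | tri< s _ _ | tri< s' _ _ = inj₁ (s , s')
  ... | tri> _ _ s | tri> _ _ s' = inj₂ (s , s')
  ... | tri< s _ _ | tri> _ _ s' = ⊥-elim (n (crossed⇒cross {p} {q} (inj₁ (s , s'))))
  ... | tri> _ _ s | tri< s' _ _ = ⊥-elim (n (crossed⇒cross {p} {q} (inj₂ (s , s'))))

  crossed⇒¬≪ : ∀ {p q} → Crossed p q → ¬ (p ≪ q)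
  crossed⇒¬≪ (inj₁ (_ , b)) (_ , d) = <-asym b d
  crossed⇒¬≪ (inj₂ (a , _)) (c , _) = <-asym a c

  crossed-sym : ∀ {p q} → Crossed p q → Crossed q p
  crossed-sym (inj₁ c) = inj₂ c
  crossed-sym (inj₂ c) = inj₁ c

  orient-elim : ∀ (P : Line → Set) u v → P u → P v → P (proj₁ (orient u v)) × P (proj₂ (orient u v))
  orient-elim P u v a b with top u <? top v
  ... | yes _ = a , b
  ... | no _  = b , a

  orient-≪ : ∀ {u v} → u ≪ v → orient u v ≡ (u , v)
  orient-≪ {u} {v} (a , _) with top u <? top v
  ... | yes _ = refl
  ... | no n  = ⊥-elim (n a)

  orient-parallel : ∀ u v → Parallel u v → top u ≢ top v → proj₁ (orient u v) ≪ proj₂ (orient u v)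
  orient-parallel u v e n with top u <? top v | <-cmp (top u) (top v)
  ... | yes h | _          = h , <-by (parallel-shift {u} {v} e) h
  ... | no h  | tri< a _ _ = ⊥-elim (h a)
  ... | no h  | tri≈ _ a _ = ⊥-elim (n a)
  ... | no h  | tri> _ _ g = g , <-by (parallel-shift {v} {u} (sym e)) g

  -- Relative positions of the lines of R_P

  data Kind : Set where
    AB CD EF : Kind

  data Side : Set where
    left right : Side

  module Geometry {n k : ℕ} (φ : Formula n k) (R : RP k) (V : ValidRP φ R) where

    open ValidRP V

    infix 4 _≺_
    _≺_ : Occ k → Occ k → Set
    _≺_ = OccLeft R

    Connector : Occ k → Set
    Connector o = ∃ λ uv → con R o ≡ just uv

    -- Rests on uniqueness of identity proofs; a connector is thereby identified with the occurrence
    -- it starts from.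
    connector-unique : ∀ {o} (c c' : Connector o) → c ≡ c'
    connector-unique {o} (_ , e) (_ , e') = unique e e'
      where
      unique : ∀ {m : Maybe (Line × Line)} {p p'} (e : m ≡ just p) (e' : m ≡ just p') →
        _≡_ {A = ∃ λ uv → m ≡ just uv} (p , e) (p' , e')
      unique refl refl = refl

    next : ∀ {o} → Connector o → Occ k
    next {o} ((u , v) , e) = proj₁ (conSucc o u v e)

    next-succ : ∀ {o} (c : Connector o) → Succ φ R o (next c)
    next-succ {o} ((u , v) , e) = proj₁ (proj₂ (conSucc o u v e))

    ≺-next : ∀ {o} (c : Connector o) → o ≺ next c
    ≺-next c = proj₁ (proj₂ (next-succ c))

    data Ln : Set where
      occL : Occ k → Fin 2 → Ln
      conL : (o : Occ k) → Connector o → Side → Ln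

    side : Side → Trap → Line
    side left  = proj₁
    side right = proj₂

    lineOf : Ln → Line
    lineOf (occL o a) = occ R o a
    lineOf (conL o ((u , v) , _) s) = side s (orient u v)

    ≺-asym : ∀ {o o'} → o ≺ o' → ¬ (o' ≺ o)
    ≺-asym p q = <-asym (proj₁ (p 0F 0F)) (proj₁ (q 0F 0F))

    ≺-irrefl : ∀ {o} → ¬ (o ≺ o)
    ≺-irrefl p = ≺-asym p p

    ≺-trans : ∀ {o o' o''} → o ≺ o' → o' ≺ o'' → o ≺ o''
    ≺-trans p q a b = ≪-trans (p a 0F) (q 0F b)

    private
      occLines conLines' : Occ k → List Line
      occLines o = ℓ¹ R o ∷ ℓ² R o ∷ []
      conLines' o = conLines (con R o)

      ∈-occLines : ∀ o a → occ R o a ∈ occLines o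
      ∈-occLines o 0F = here refl
      ∈-occLines o 1F = there (here refl)

      occ∈ : ∀ o a → occ R o a ∈ concatMap occLines (allOcc k)
      occ∈ o a = ∈-concatMap⁺ occLines (lose (∈-allOcc o) (∈-occLines o a))

      con∈ : ∀ {o w} → w ∈ conLines (con R o) → w ∈ concatMap conLines' (allOcc k)
      con∈ {o} w∈ = ∈-concatMap⁺ conLines' (lose (∈-allOcc o) w∈)

      module Distinct (f : Line → ℚ) (uq : AllPairs (λ p q → f p ≢ f q) (allLines R)) where
        split = AllPairs-++⁻ (concatMap occLines (allOcc k)) uq

        occ-occ : ∀ {o o'} → o ≢ o' → ∀ a b → f (occ R o a) ≢ f (occ R o' b)
        occ-occ {o} {o'} n a b = concatMap-across f occLines (allOcc k) (proj₁ split)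
          (∈-allOcc o) (∈-allOcc o') n (∈-occLines o a) (∈-occLines o' b)

        occ-con : ∀ o a {o' w} → w ∈ conLines (con R o') → f (occ R o a) ≢ f w
        occ-con o a {o'} w∈ = proj₂ (proj₂ split) (occ∈ o a) (con∈ {o'} w∈)

        con-con : ∀ o → AllPairs (λ p q → f p ≢ f q) (conLines (con R o))
        con-con o = concatMap-within f conLines' (allOcc k) (proj₁ (proj₂ split)) (∈-allOcc o)

      module DT = Distinct top (AllPairsₚ.map⁻ distinctL1)
      module DB = Distinct bot (AllPairsₚ.map⁻ distinctL2)

    x<y : ∀ o → top (ℓ¹ R o) < top (ℓ² R o) × bot (ℓ² R o) < bot (ℓ¹ R o)
    x<y o = steeper-crossing {ℓ¹ R o} {ℓ² R o} (occAngle o) (cross⇒crossed {ℓ¹ R o} {ℓ² R o} (occCross o))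

    private
      occ-crossed : ∀ o {a b} → a ≢ b → Crossed (occ R o a) (occ R o b)
      occ-crossed o {0F} {0F} n = ⊥-elim (n refl)
      occ-crossed o {0F} {1F} n = inj₁ (x<y o)
      occ-crossed o {1F} {0F} n = inj₂ (x<y o)
      occ-crossed o {1F} {1F} n = ⊥-elim (n refl)

      comparable : ∀ {o o'} → o ≢ o' → ∀ a b → (occ R o a ≪ occ R o' b) ⊎ (occ R o' b ≪ occ R o a)
      comparable {o} {o'} n a b = non-crossing (occNoCross o o' n a b) (DT.occ-occ n a b) (DB.occ-occ n a b)

      -- One comparison settles all four: the lines of one occurrence cross, and reversing another
      -- comparison would, by transitivity, make two crossing lines comparable.
      spread : ∀ {o o'} → o ≢ o' → ∀ {a b} → occ R o a ≪ occ R o' b → o ≺ o'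
      spread {o} {o'} n {a} {b} h a' b' with a Finₚ.≟ a' | b Finₚ.≟ b'
      ... | yes refl | yes refl = h
      ... | yes refl | no nb = right-end a h
        where
        right-end : ∀ a → occ R o a ≪ occ R o' b → occ R o a ≪ occ R o' b'
        right-end a h with comparable n a b'
        ... | inj₁ g = g
        ... | inj₂ g = ⊥-elim (crossed⇒¬≪ (occ-crossed o' (≢-sym nb)) (≪-trans g h))
      ... | no na | yes refl with comparable n a' b
      ...   | inj₁ g = g
      ...   | inj₂ g = ⊥-elim (crossed⇒¬≪ (occ-crossed o na) (≪-trans h g))
      spread {o} {o'} n {a} {b} h a' b' | no na | no nb with comparable n a' b
      ... | inj₂ g = ⊥-elim (crossed⇒¬≪ (occ-crossed o na) (≪-trans h g))
      ... | inj₁ g with comparable n a' b'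
      ...   | inj₁ g' = g'
      ...   | inj₂ g' = ⊥-elim (crossed⇒¬≪ (occ-crossed o' (≢-sym nb)) (≪-trans g' g))

    ≺-total : ∀ {o o'} → o ≢ o' → o ≺ o' ⊎ o' ≺ o
    ≺-total n with comparable n 0F 0F
    ... | inj₁ h = inj₁ (spread n h)
    ... | inj₂ h = inj₂ (spread (≢-sym n) h)

    -- `Succ` excludes occurrences of the same variable in between, and the left-to-right order of
    -- the variables excludes all others.
    nothing-between : ∀ {o} (c : Connector o) {o'} → o ≺ o' → ¬ (o' ≺ next c)
    nothing-between {o} c {o'} p q with Finₚ.<-cmp (var φ o') (var φ o)
    ... | tri≈ _ e _ = proj₂ (proj₂ (next-succ c)) o' e (p , q)
    ... | tri< h _ _ = ≺-asym p (varOrder o' o h)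
    ... | tri> _ _ h = ≺-asym q (varOrder (next c) o' (subst (_<ᶠ var φ o') (proj₁ (next-succ c)) h))

    private
      record Connecting (o o' : Occ k) (w : Line) : Set where
        constructor connecting
        field
          at-x    : top (ℓ¹ R o) < top w × bot w < bot (ℓ¹ R o)
          at-x'   : top (ℓ¹ R o') < top w × bot w < bot (ℓ¹ R o')
          y-below : ℓ² R o ≪ w
          y-above : w ≪ ℓ² R o'

      ≢-top : ∀ {p q} → top p ≢ top q → p ≢ q
      ≢-top n refl = n refl

      -- The angles fix the direction of the crossings with the two ℓ¹. The two ℓ² are not crossed,
      -- and `w` on the wrong side of one of them would contradict these directions.
      connecting-line : ∀ {o} (c : Connector o) w → w ∈ conLines (con R o) →
        AngleGt (ℓ¹ R o) w → AngleGt (ℓ¹ R (next c)) w →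
        Cross w (ℓ¹ R o) → Cross w (ℓ¹ R (next c)) →
        (∀ z → z ∈ allLines R → z ≢ ℓ¹ R o → z ≢ ℓ¹ R (next c) → ¬ Cross w z) →
        Connecting o (next c) w
      connecting-line {o} c w w∈ an an' k k' only = connecting ax ax' (proj₁ ys) (proj₂ ys)
        where
        o' = next c
        ax  = steeper-crossing {ℓ¹ R o} {w} an (crossed-sym {w} {ℓ¹ R o} (cross⇒crossed {w} {ℓ¹ R o} k))
        ax' = steeper-crossing {ℓ¹ R o'} {w} an' (crossed-sym {w} {ℓ¹ R o'} (cross⇒crossed {w} {ℓ¹ R o'} k'))
        oo' = ≺-next c
        comp : ∀ q → top (ℓ² R q) ≢ top (ℓ¹ R o) → top (ℓ² R q) ≢ top (ℓ¹ R o') →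
          (w ≪ ℓ² R q) ⊎ (ℓ² R q ≪ w)
        comp q n n' = non-crossing
          (only (ℓ² R q) (∈-++⁺ˡ (occ∈ q 1F)) (≢-top {ℓ² R q} n) (≢-top {ℓ² R q} n'))
          (≢-sym (DT.occ-con q 1F {o} w∈)) (≢-sym (DB.occ-con q 1F {o} w∈))
        ys : (ℓ² R o ≪ w) × (w ≪ ℓ² R o')
        ys with comp o (≢-sym (<⇒≢ (proj₁ (x<y o)))) (<⇒≢ (proj₁ (oo' 1F 0F)))
              | comp o' (≢-sym (<⇒≢ (proj₁ (oo' 0F 1F)))) (≢-sym (<⇒≢ (proj₁ (x<y o'))))
        ... | inj₂ a | inj₁ b = a , b
        ... | inj₁ a | _ = ⊥-elim (<-asym (proj₁ a) (<-trans (proj₁ (oo' 1F 0F)) (proj₁ ax')))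
        ... | _ | inj₂ b = ⊥-elim (<-asym (proj₂ b) (<-trans (proj₂ ax) (proj₂ (oo' 0F 1F))))

      connector-lines : ∀ {o} (c : Connector o) →
        Connecting o (next c) (proj₁ (proj₁ c)) × Connecting o (next c) (proj₂ (proj₁ c))
      connector-lines {o} c@((u , v) , e) with proj₂ (proj₂ (conSucc o u v e))
      ... | pl , an , an' , cu , cu' , cv , cv' , only =
          connecting-line c u (subst (λ m → u ∈ conLines m) (sym e) (here refl)) an an' cu cu'
            (λ z z∈ n n' → proj₁ (only z z∈ n n'))
        , connecting-line c v (subst (λ m → v ∈ conLines m) (sym e) (there (here refl)))
            (subst (slope (ℓ¹ R o) <_) pl an) (subst (slope (ℓ¹ R (next c)) <_) pl an') cv cv'
            (λ z z∈ n n' → proj₂ (only z z∈ n n'))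

      connects : ∀ {o} (c : Connector o) s → Connecting o (next c) (lineOf (conL o c s))
      connects {o} c@((u , v) , e) left  = proj₁ (orient-elim (Connecting o (next c)) u v (proj₁ (connector-lines c)) (proj₂ (connector-lines c)))
      connects {o} c@((u , v) , e) right = proj₂ (orient-elim (Connecting o (next c)) u v (proj₁ (connector-lines c)) (proj₂ (connector-lines c)))

      top-u≢v : ∀ {o} (c : Connector o) → top (proj₁ (proj₁ c)) ≢ top (proj₂ (proj₁ c))
      top-u≢v {o} ((u , v) , e) with subst (λ m → AllPairs (λ p q → top p ≢ top q) (conLines m)) e (DT.con-con o)
      ... | (n ∷ []) ∷ _ = n

    connector-≪ : ∀ {o} (c : Connector o) → lineOf (conL o c left) ≪ lineOf (conL o c right)
    connector-≪ {o} c@((u , v) , e) = orient-parallel u v (proj₁ (proj₂ (proj₂ (conSucc o u v e)))) (top-u≢v c)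

    -- The relations shared by R_P and the representation built from an assignment; they determine the
    -- position of any two lines.
    record Model : Set₁ where
      infix 4 _<ᵐ_
      field
        Coord  : Set
        _<ᵐ_   : Coord → Coord → Set
        transᵐ : ∀ {a b c} → a <ᵐ b → b <ᵐ c → a <ᵐ c
        topᵐ botᵐ : Ln → Coord

      LeftOfᵐ : Ln → Ln → Set
      LeftOfᵐ p q = topᵐ p <ᵐ topᵐ q × botᵐ p <ᵐ botᵐ q

      -- A disjunction, since the direction of a crossing is what a truth value decides; only the
      -- fact of crossing is common to all models.
      Crossedᵐ : Ln → Ln → Set
      Crossedᵐ p q = (topᵐ p <ᵐ topᵐ q × botᵐ q <ᵐ botᵐ p) ⊎ (topᵐ q <ᵐ topᵐ p × botᵐ p <ᵐ botᵐ q)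

      field
        occ≪occ  : ∀ {o o'} → o ≺ o' → ∀ a b → LeftOfᵐ (occL o a) (occL o' b)
        y≪con    : ∀ {o} (c : Connector o) s → LeftOfᵐ (occL o 1F) (conL o c s)
        con≪y    : ∀ {o} (c : Connector o) s → LeftOfᵐ (conL o c s) (occL (next c) 1F)
        con≪con  : ∀ {o} (c : Connector o) → LeftOfᵐ (conL o c left) (conL o c right)
        x×y      : ∀ o → Crossedᵐ (occL o 0F) (occL o 1F)
        x×con    : ∀ {o} (c : Connector o) s → Crossedᵐ (occL o 0F) (conL o c s)
        x'×con   : ∀ {o} (c : Connector o) s → Crossedᵐ (occL (next c) 0F) (conL o c s)

      ≪ᵐ-trans : ∀ {p q r} → LeftOfᵐ p q → LeftOfᵐ q r → LeftOfᵐ p r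
      ≪ᵐ-trans (a , b) (c , d) = transᵐ a c , transᵐ b d

      Crossedᵐ-sym : ∀ {p q} → Crossedᵐ p q → Crossedᵐ q p
      Crossedᵐ-sym (inj₁ c) = inj₂ c
      Crossedᵐ-sym (inj₂ c) = inj₁ c

    open Model

    givenModel : Model
    givenModel = record
      { Coord = ℚ ; _<ᵐ_ = _<_ ; transᵐ = <-trans
      ; topᵐ = λ p → top (lineOf p) ; botᵐ = λ p → bot (lineOf p)
      ; occ≪occ = λ p a b → p a b
      ; y≪con = λ c s → Connecting.y-below (connects c s)
      ; con≪y = λ c s → Connecting.y-above (connects c s)
      ; con≪con = connector-≪
      ; x×y = λ o → inj₁ (x<y o)
      ; x×con = λ c s → inj₁ (Connecting.at-x (connects c s))
      ; x'×con = λ c s → inj₁ (Connecting.at-x' (connects c s))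
      }

    -- Quantified over all models, so that a single case analysis yields the position in R_P and in
    -- the new representation at once.
    data Position (p q : Ln) : Set₁ where
      before : (∀ M → LeftOfᵐ M p q) → Position p q
      after : (∀ M → LeftOfᵐ M q p) → Position p q
      across : (∀ M → Crossedᵐ M p q) → Position p q

    position-sym : ∀ {p q} → Position p q → Position q p
    position-sym (before f) = after f
    position-sym (after f) = before f
    position-sym (across f) = across (λ M → Crossedᵐ-sym M (f M))

    -- The position of a line relative to a connecting line does not depend on the side of the latter.
    data ConPosition (p : Ln) {o} (c : Connector o) : Set₁ where
      before : (∀ M s → LeftOfᵐ M p (conL o c s)) → ConPosition p c
      after : (∀ M s → LeftOfᵐ M (conL o c s) p) → ConPosition p c
      across : (∀ M s → Crossedᵐ M p (conL o c s)) → ConPosition p c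

    -- By `nothing-between`, `o` is at or left of `o'`, or at or right of `next c`; the basic
    -- relations and transitivity decide each case.
    occ-con-position : ∀ o a {o'} (c : Connector o') → ConPosition (occL o a) c
    occ-con-position o a {o'} c with o ≟ᵒ o'
    occ-con-position o 0F c | yes refl = across λ M → x×con M c
    occ-con-position o 1F c | yes refl = before λ M → y≪con M c
    occ-con-position o a {o'} c | no n with ≺-total n
    ... | inj₁ h = before λ M s → ≪ᵐ-trans M (occ≪occ M h a 1F) (y≪con M c s)
    ... | inj₂ h with o ≟ᵒ next c
    occ-con-position o a {o'} c | no n | inj₂ h | no n' with ≺-total n'
    ... | inj₁ g = ⊥-elim (nothing-between c h g)
    ... | inj₂ g = after λ M s → ≪ᵐ-trans M (con≪y M c s) (occ≪occ M g 1F a)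
    occ-con-position o 0F c | no n | inj₂ h | yes refl = across λ M → x'×con M c
    occ-con-position o 1F c | no n | inj₂ h | yes refl = after λ M → con≪y M c

    con-before-con : ∀ {o o'} (c : Connector o) (c' : Connector o') → o ≺ o' →
      ∀ M s s' → LeftOfᵐ M (conL o c s) (conL o' c' s')
    con-before-con {o} {o'} c c' h M s s' with o' ≟ᵒ next c
    ... | yes refl = ≪ᵐ-trans M (con≪y M c s) (y≪con M c' s')
    ... | no n with ≺-total n
    ...   | inj₁ g = ⊥-elim (nothing-between c h g)
    ...   | inj₂ g = ≪ᵐ-trans M (con≪y M c s) (≪ᵐ-trans M (occ≪occ M g 1F 1F) (y≪con M c' s'))

    con-con-position : ∀ {o o'} (c : Connector o) (c' : Connector o') → o ≢ o' → ∀ s → ConPosition (conL o c s) c'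
    con-con-position c c' n s with ≺-total n
    ... | inj₁ h = before λ M s' → con-before-con c c' h M s s'
    ... | inj₂ h = after λ M s' → con-before-con c' c h M s' s

    at-side : ∀ {p o} {c : Connector o} → ConPosition p c → ∀ s → Position p (conL o c s)
    at-side (before f) s = before λ M → f M s
    at-side (after f) s = after λ M → f M s
    at-side (across f) s = across λ M → f M s

    position : ∀ p q → p ≢ q → Position p q
    position (occL o a) (occL o' b) n with o ≟ᵒ o'
    ... | no m with ≺-total m
    ...   | inj₁ h = before λ M → occ≪occ M h a b
    ...   | inj₂ h = after λ M → occ≪occ M h b a
    position (occL o 0F) (occL o 0F) n | yes refl = ⊥-elim (n refl)
    position (occL o 0F) (occL o 1F) n | yes refl = across λ M → x×y M o
    position (occL o 1F) (occL o 0F) n | yes refl = across λ M → Crossedᵐ-sym M (x×y M o)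
    position (occL o 1F) (occL o 1F) n | yes refl = ⊥-elim (n refl)
    position (occL o a) (conL o' c s) n = at-side (occ-con-position o a c) s
    position (conL o c s) (occL o' a) n = position-sym (at-side (occ-con-position o' a c) s)
    position (conL o c s) (conL o' c' s') n with o ≟ᵒ o'
    ... | no m = at-side (con-con-position c c' m s) s'
    ... | yes refl with connector-unique c c'
    position (conL o c left) (conL o c left) n | yes refl | refl = ⊥-elim (n refl)
    position (conL o c left) (conL o c right) n | yes refl | refl = before λ M → con≪con M c
    position (conL o c right) (conL o c left) n | yes refl | refl = after λ M → con≪con M c
    position (conL o c right) (conL o c right) n | yes refl | refl = ⊥-elim (n refl)

  unique-concatMap : ∀ {A B : Set} (h : A → List B) → (∀ x → Unique (h x)) →
    (∀ {x x' y} → y ∈ h x → y ∈ h x' → x ≡ x') → ∀ {xs} → Unique xs → Unique (concatMap h xs)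
  unique-concatMap h u inj {[]} _ = []
  unique-concatMap h u inj {x ∷ xs} (x∉ ∷ us) = Uniqueₚ.++⁺ (u x) (unique-concatMap h u inj us) disj
    where
    disj : ∀ {y} → ¬ (y ∈ h x × y ∈ concatMap h xs)
    disj (a , b) with find (∈-concatMap⁻ h {xs} b)
    ... | x' , x'∈ , b' = All.lookup x∉ x'∈ (inj a b')

  concatMap-cong-∈ : ∀ {A B : Set} {f g : A → List B} xs → (∀ {x} → x ∈ xs → f x ≡ g x) →
    concatMap f xs ≡ concatMap g xs
  concatMap-cong-∈ [] e = refl
  concatMap-cong-∈ (x ∷ xs) e = cong₂ _++_ (e (here refl)) (concatMap-cong-∈ xs λ i → e (there i))

  -- Shifts by multiples of ε/8

  /8-mono-≤ : ∀ {i j} → i ℤ.≤ j → i / 8 ≤ j / 8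
  /8-mono-≤ {i} {j} h = toℚᵘ-cancel-≤ (ℚᵘₚ.≤-respˡ-≃ (ℚᵘₚ.≃-sym (toℚᵘ-fromℚᵘ (ℚᵘ.mkℚᵘ i 7)))
    (ℚᵘₚ.≤-respʳ-≃ (ℚᵘₚ.≃-sym (toℚᵘ-fromℚᵘ (ℚᵘ.mkℚᵘ j 7))) (ℚᵘ.*≤* (ℤₚ.*-monoʳ-≤-nonNeg (+ 8) h))))

  /8-mono-< : ∀ {i j} → i ℤ.< j → i / 8 < j / 8
  /8-mono-< {i} {j} h = toℚᵘ-cancel-< (ℚᵘₚ.<-respˡ-≃ (ℚᵘₚ.≃-sym (toℚᵘ-fromℚᵘ (ℚᵘ.mkℚᵘ i 7)))
    (ℚᵘₚ.<-respʳ-≃ (ℚᵘₚ.≃-sym (toℚᵘ-fromℚᵘ (ℚᵘ.mkℚᵘ j 7))) (ℚᵘ.*<* (ℤₚ.*-monoʳ-<-pos (+ 8) h))))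

  -- The shifts of the construction, ((e − 8)/8)·ε for 1 ≤ e ≤ 15.
  offset : ℚ → ℕ → ℚ
  offset ε e = frac8 ε (e ⊖ 8)

  offset-mono-≤ : ∀ {ε e e'} → 0ℚ < ε → e ℕ.≤ e' → offset ε e ≤ offset ε e'
  offset-mono-≤ {ε} 0<ε h = *-monoʳ-≤-nonNeg ε {{pos⇒nonNeg ε {{positive 0<ε}}}} (/8-mono-≤ (ℤₚ.⊖-monoˡ-≤ 8 h))

  offset-mono-< : ∀ {ε e e'} → 0ℚ < ε → e ℕ.< e' → offset ε e < offset ε e'
  offset-mono-< {ε} 0<ε h = *-monoˡ-<-pos ε {{positive 0<ε}} (/8-mono-< (ℤₚ.⊖-monoˡ-< 8 h))

  shift-0 : ∀ ℓ ε → shift ℓ (offset ε 8) ≡ ℓ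
  shift-0 (line t b) ε = cong₂ line (lemma t) (lemma b)
    where
    lemma : ∀ x → x + offset ε 8 ≡ x
    lemma x = trans (cong (λ z → x + z) (*-zeroˡ ε)) (+-identityʳ x)

  shift-mono-≪ : ∀ ℓ {ε e e'} → 0ℚ < ε → e ℕ.< e' → shift ℓ (offset ε e) ≪ shift ℓ (offset ε e')
  shift-mono-≪ ℓ 0<ε h = +-monoʳ-< (top ℓ) (offset-mono-< 0<ε h) , +-monoʳ-< (bot ℓ) (offset-mono-< 0<ε h)

  shift-¬≪ : ∀ ℓ {ε e e'} → 0ℚ < ε → e' ℕ.≤ e → ¬ (shift ℓ (offset ε e) ≪ shift ℓ (offset ε e'))
  shift-¬≪ ℓ 0<ε h (a , _) = <-irrefl refl (<-≤-trans a (+-monoʳ-≤ (top ℓ) (offset-mono-≤ 0<ε h)))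

  -- The worst case is `e = 15` and `e' = 1`; the margin `1/64 · γ` is what remains of γ after
  -- subtracting `7/8 · 9/8 · γ`.
  offsets-separate : ∀ {γ ε ε' x y e e'} → 0ℚ < γ → 0ℚ < ε → 0ℚ < ε' → ε + ε' ≤ γ + (+ 1 / 8) * γ →
    e ℕ.≤ 15 → 1 ℕ.≤ e' → γ ≤ y - x → x + offset ε e < y + offset ε' e'
  offsets-separate {γ} {ε} {ε'} {x} {y} {e} {e'} 0<γ 0<ε 0<ε' sum h h' g =
    <-≤-trans (≤-<-trans (+-monoʳ-≤ x (offset-mono-≤ 0<ε h)) middle) (+-monoʳ-≤ y (offset-mono-≤ 0<ε' h'))
    where
    c = + 7 / 8
    scaled : c * (ε + ε') ≤ c * (γ + (+ 1 / 8) * γ)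
    scaled = *-monoˡ-≤-nonNeg c sum
    small : c * (γ + (+ 1 / 8) * γ) < γ
    small = <-by (solve 1 (λ γ → constant (+ 1 / 64) :* γ :- constant 0ℚ := γ :- constant c :* (γ :+ constant (+ 1 / 8) :* γ)) refl γ)
      (subst (_< (+ 1 / 64) * γ) (*-zeroʳ (+ 1 / 64)) (*-monoʳ-<-pos (+ 1 / 64) 0<γ))
    middle : x + offset ε 15 < y + offset ε' 1
    middle = <-≤-by (solve 5 (λ x y γ ε ε' →
        (γ :- constant c :* (ε :+ ε')) :+ ((y :- x) :- γ)
          := (y :+ constant (-[1+ 6 ] / 8) :* ε') :- (x :+ constant c :* ε)) refl x y γ ε ε')
      (≤-<-trans scaled small) g

  -- The distance is at least ε, and the shifts use at most 3/8 + 4/8 or 4/8 + 3/8 of ε. Offsets 12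
  -- and 4 would use all of it; they need one of the stronger hypotheses of the next two lemmas.
  offsets-separate-own : ∀ {γ ε x y e e'} → 0ℚ < ε → ε ≤ γ →
    (e ℕ.≤ 11 × 4 ℕ.≤ e') ⊎ (e ℕ.≤ 12 × 5 ℕ.≤ e') → γ ≤ y - x → x + offset ε e < y + offset ε e'
  offsets-separate-own {γ} {ε} {x} {y} {e} {e'} 0<ε ε≤γ cases g = go cases
    where
    1/8ε : (+ 1 / 8) * 0ℚ < (+ 1 / 8) * ε
    1/8ε = *-monoʳ-<-pos (+ 1 / 8) 0<ε
    ε≤ : ε ≤ y - x
    ε≤ = ≤-trans ε≤γ g
    go : (e ℕ.≤ 11 × 4 ℕ.≤ e') ⊎ (e ℕ.≤ 12 × 5 ℕ.≤ e') → x + offset ε e < y + offset ε e'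
    go (inj₁ (h , h')) = <-≤-trans (≤-<-trans (+-monoʳ-≤ x (offset-mono-≤ 0<ε h))
      (<-≤-by (solve 3 (λ x y ε → (constant (+ 1 / 8) :* ε :- constant (+ 1 / 8) :* constant 0ℚ) :+ ((y :- x) :- ε)
        := (y :+ constant (-[1+ 3 ] / 8) :* ε) :- (x :+ constant (+ 3 / 8) :* ε)) refl x y ε) 1/8ε ε≤))
      (+-monoʳ-≤ y (offset-mono-≤ 0<ε h'))
    go (inj₂ (h , h')) = <-≤-trans (≤-<-trans (+-monoʳ-≤ x (offset-mono-≤ 0<ε h))
      (<-≤-by (solve 3 (λ x y ε → (constant (+ 1 / 8) :* ε :- constant (+ 1 / 8) :* constant 0ℚ) :+ ((y :- x) :- ε)
        := (y :+ constant (-[1+ 2 ] / 8) :* ε) :- (x :+ constant (+ 4 / 8) :* ε)) refl x y ε) 1/8ε ε≤))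
      (+-monoʳ-≤ y (offset-mono-≤ 0<ε h'))

  -- The point `z` in between doubles the available distance, so that two shifts by ε/2 fit.
  offsets-separate-far : ∀ {γ ε x y z} → 0ℚ < ε → ε ≤ γ → γ ≤ z - x → γ ≤ y - z →
    x + offset ε 12 < y + offset ε 4
  offsets-separate-far {γ} {ε} {x} {y} {z} 0<ε h g g' =
    <-≤-by (solve 4 (λ x y z ε → (ε :- constant 0ℚ) :+ ((y :- z) :+ (z :- x) :- (ε :+ ε))
        := (y :+ constant (-[1+ 3 ] / 8) :* ε) :- (x :+ constant (+ 4 / 8) :* ε)) refl x y z ε)
      0<ε (+-mono-≤ (≤-trans h g') (≤-trans h g))

  offsets-separate-< : ∀ {γ ε x y} → ε < γ → γ ≤ y - x → x + offset ε 12 < y + offset ε 4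
  offsets-separate-< {γ} {ε} {x} {y} h g =
    <-≤-by (solve 4 (λ x y γ ε → (γ :- ε) :+ ((y :- x) :- γ)
        := (y :+ constant (-[1+ 3 ] / 8) :* ε) :- (x :+ constant (+ 4 / 8) :* ε)) refl x y γ ε) h g

  -- As 2γ exceeds 9/8 · γ, at most one pair can have an ε as large as γ.
  1/8-excess : ∀ {γ ε ε'} → 0ℚ < γ → γ ≤ ε → γ ≤ ε' → ¬ (ε + ε' ≤ γ + (+ 1 / 8) * γ)
  1/8-excess {γ} 0<γ h h' k = <-irrefl refl (<-≤-trans
    (+-monoʳ-< γ (subst ((+ 1 / 8) * γ <_) (*-identityˡ γ) (*-monoˡ-<-pos γ {{positive 0<γ}} (from-yes ((+ 1 / 8) <? 1ℚ)))))
    (≤-trans (+-mono-≤ h h') k))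

  -- The minimal gap

  minList-≤ : ∀ {x} xs → x ∈ xs → minList xs ≤ x
  minList-≤ (x ∷ xs) x∈ = go x xs x∈
    where
    go : ∀ {z} x xs → z ∈ x ∷ xs → foldr _⊓_ x xs ≤ z
    go x [] (here refl) = ≤-refl
    go x (y ∷ ys) (here refl) = ≤-trans (p⊓q≤q y _) (go x ys (here refl))
    go x (y ∷ ys) (there (here refl)) = p⊓q≤p y _
    go x (y ∷ ys) (there (there z∈)) = ≤-trans (p⊓q≤q y _) (go x ys (there z∈))

  minList-pos : ∀ xs → All (0ℚ <_) xs → 0ℚ < minList xs
  minList-pos [] _ = positive⁻¹ 1ℚ
  minList-pos (x ∷ xs) (p ∷ ps) = go xs ps
    where
    go : ∀ xs → All (0ℚ <_) xs → 0ℚ < foldr _⊓_ x xs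
    go [] _ = p
    go (y ∷ ys) (q ∷ qs) = <-⊓ y _ q (go ys qs)

  gap∈gaps : ∀ {x y} xs → x ∈ xs → y ∈ xs → y < x → x - y ∈ gaps xs
  gap∈gaps {x} {y} xs x∈ y∈ h = ∈-filter⁺ (λ d → 0ℚ <? d)
    (∈-concatMap⁺ _ (lose x∈ (subst (λ z → z ∈ map (λ y → ∣ x - y ∣) xs)
      (0≤p⇒∣p∣≡p (<⇒≤ (p<q⇒0<q-p h))) (∈-map⁺ (λ y → ∣ x - y ∣) y∈))))
    (p<q⇒0<q-p h)

  endpoints : (Line → ℚ) → List Trap → List ℚ
  endpoints f = concatMap (λ T → f (proj₁ T) ∷ f (proj₂ T) ∷ [])

  endpoint : ∀ {S T f} → T ∈ S → f (proj₁ T) ∈ endpoints f S × f (proj₂ T) ∈ endpoints f S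
  endpoint T∈ = ∈-concatMap⁺ _ (lose T∈ (here refl)) , ∈-concatMap⁺ _ (lose T∈ (there (here refl)))

  epsOf-pos : ∀ S → 0ℚ < epsOf S
  epsOf-pos S = minList-pos (gaps (endpoints top S) ++ gaps (endpoints bot S))
    (Allₚ.++⁺ (gaps-pos (endpoints top S)) (gaps-pos (endpoints bot S)))
    where
    gaps-pos : ∀ xs → All (0ℚ <_) (gaps xs)
    gaps-pos xs = Allₚ.all-filter (λ d → 0ℚ <? d) (concatMap (λ x → map (λ y → ∣ x - y ∣) xs) xs)

  epsOf-top-≤ : ∀ S {x y} → x ∈ endpoints top S → y ∈ endpoints top S → y < x → epsOf S ≤ x - y
  epsOf-top-≤ S x∈ y∈ h = minList-≤ (gaps (endpoints top S) ++ gaps (endpoints bot S))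
    (∈-++⁺ˡ (gap∈gaps (endpoints top S) x∈ y∈ h))

  epsOf-bot-≤ : ∀ S {x y} → x ∈ endpoints bot S → y ∈ endpoints bot S → y < x → epsOf S ≤ x - y
  epsOf-bot-≤ S x∈ y∈ h = minList-≤ (gaps (endpoints top S) ++ gaps (endpoints bot S))
    (∈-++⁺ʳ (gaps (endpoints top S)) (gap∈gaps (endpoints bot S) x∈ y∈ h))

  _≟ᵏ_ : DecidableEquality Kind
  AB ≟ᵏ AB = yes refl
  AB ≟ᵏ CD = no λ ()
  AB ≟ᵏ EF = no λ ()
  CD ≟ᵏ AB = no λ ()
  CD ≟ᵏ CD = yes refl
  CD ≟ᵏ EF = no λ ()
  EF ≟ᵏ AB = no λ ()
  EF ≟ᵏ CD = no λ ()
  EF ≟ᵏ EF = yes refl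

  -- The vertices of H_φ belonging to one pair: 0F is the trapezoid itself and jF is T_{u,j}.  Each is
  -- bounded by translates of the left or right line of the pair, given by the side and the offset.
  leftEdge rightEdge : Fin 7 → Side × ℕ
  leftEdge 0F = left , 8
  leftEdge 1F = left , 4
  leftEdge 2F = left , 2
  leftEdge 3F = left , 1
  leftEdge 4F = right , 4
  leftEdge 5F = right , 10
  leftEdge 6F = right , 11
  rightEdge 0F = right , 8
  rightEdge 1F = left , 12
  rightEdge 2F = left , 6
  rightEdge 3F = left , 5
  rightEdge 4F = right , 12
  rightEdge 5F = right , 14
  rightEdge 6F = right , 15

  -- The construction of H_φ and bounds on its gaps

  module Construction {n k : ℕ} (φ : Formula n k) (inc : Increasing φ) (R : RP k) (V : ValidRP φ R) where

    open ValidRP V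
    open Geometry φ R V
    open Model

    -- Pairs are named by identifiers rather than by their trapezoids, so that equality is decidable
    -- and ε can be a function of the pair.
    data TrapId : Set where
      clauseT : Fin k → Kind → TrapId
      conT    : (o : Occ k) → Connector o → TrapId

    _≟ᵗ_ : DecidableEquality TrapId
    clauseT i κ ≟ᵗ clauseT i' κ' with i Finₚ.≟ i' | κ ≟ᵏ κ'
    ... | yes refl | yes refl = yes refl
    ... | no m     | _        = no λ { refl → m refl }
    ... | _        | no m     = no λ { refl → m refl }
    clauseT _ _ ≟ᵗ conT _ _ = no λ ()
    conT _ _ ≟ᵗ clauseT _ _ = no λ ()
    conT o c ≟ᵗ conT o' c' with o ≟ᵒ o'
    ... | yes refl = yes (cong (conT o) (connector-unique c c'))
    ... | no m     = no λ { refl → m refl }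

    boundary : TrapId → Side → Ln
    boundary (clauseT i AB) left  = occL (i , 0F) 0F
    boundary (clauseT i AB) right = occL (i , 1F) 1F
    boundary (clauseT i CD) left  = occL (i , 0F) 1F
    boundary (clauseT i CD) right = occL (i , 2F) 0F
    boundary (clauseT i EF) left  = occL (i , 1F) 0F
    boundary (clauseT i EF) right = occL (i , 2F) 1F
    boundary (conT o c) s = conL o c s

    home : Ln → TrapId × Side
    home (occL (i , 0F) 0F) = clauseT i AB , left
    home (occL (i , 1F) 1F) = clauseT i AB , right
    home (occL (i , 0F) 1F) = clauseT i CD , left
    home (occL (i , 2F) 0F) = clauseT i CD , right
    home (occL (i , 1F) 0F) = clauseT i EF , left
    home (occL (i , 2F) 1F) = clauseT i EF , right
    home (conL o c s) = conT o c , s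

    boundary-home : ∀ p → boundary (proj₁ (home p)) (proj₂ (home p)) ≡ p
    boundary-home (occL (i , 0F) 0F) = refl
    boundary-home (occL (i , 1F) 1F) = refl
    boundary-home (occL (i , 0F) 1F) = refl
    boundary-home (occL (i , 2F) 0F) = refl
    boundary-home (occL (i , 1F) 0F) = refl
    boundary-home (occL (i , 2F) 1F) = refl
    boundary-home (conL o c s) = refl

    home-boundary : ∀ t s → home (boundary t s) ≡ (t , s)
    home-boundary (clauseT i AB) left  = refl
    home-boundary (clauseT i AB) right = refl
    home-boundary (clauseT i CD) left  = refl
    home-boundary (clauseT i CD) right = refl
    home-boundary (clauseT i EF) left  = refl
    home-boundary (clauseT i EF) right = refl
    home-boundary (conT o c) s = refl

    boundary-≢ : ∀ {t t'} → t ≢ t' → ∀ s s' → boundary t s ≢ boundary t' s'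
    boundary-≢ {t} {t'} n s s' e =
      n (cong proj₁ (trans (sym (home-boundary t s)) (trans (cong home e) (home-boundary t' s'))))

    boundary-≪ : ∀ t M → LeftOfᵐ M (boundary t left) (boundary t right)
    boundary-≪ (clauseT i AB) M = occ≪occ M (varOrder _ _ (proj₁ (inc i))) 0F 1F
    boundary-≪ (clauseT i CD) M =
      occ≪occ M (varOrder _ _ (Finₚ.<-trans (proj₁ (inc i)) (proj₂ (inc i)))) 1F 0F
    boundary-≪ (clauseT i EF) M = occ≪occ M (varOrder _ _ (proj₂ (inc i))) 0F 1F
    boundary-≪ (conT o c) M = con≪con M c

    bline : TrapId → Side → Line
    bline t s = lineOf (boundary t s)

    trapOf : TrapId → Trap
    trapOf t = bline t left , bline t right

    clauseIds : Fin k → List TrapId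
    clauseIds i = clauseT i AB ∷ clauseT i CD ∷ clauseT i EF ∷ []

    -- The value of `con R o` is abstracted together with its equation, which the connector has to
    -- contain.
    conIdsAt : ∀ o m → con R o ≡ m → List TrapId
    conIdsAt o nothing  _ = []
    conIdsAt o (just p) e = conT o (p , e) ∷ []

    conIds : Occ k → List TrapId
    conIds o = conIdsAt o (con R o) refl

    allIds : List TrapId
    allIds = concatMap clauseIds (allFin k) ++ concatMap conIds (allOcc k)

    -- `orient` leaves the pairs of a clause as they are: the variables of the clause increase,
    -- hence its occurrences run from left to right.
    map-trapOf-allIds : map trapOf allIds ≡ pairsOf R
    map-trapOf-allIds = trans (map-++ trapOf (concatMap clauseIds (allFin k)) _) (cong₂ _++_
      (trans (map-concatMap trapOf clauseIds (allFin k)) (concatMap-cong clause-pairs (allFin k)))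
      (trans (map-concatMap trapOf conIds (allOcc k)) (concatMap-cong (λ o → con-pair o (con R o) refl) (allOcc k))))
      where
      clause-pairs : ∀ i → map trapOf (clauseIds i) ≡ clausePairs R i
      clause-pairs i = cong₂ _∷_ (sym (orient-≪ (boundary-≪ (clauseT i AB) givenModel)))
        (cong₂ _∷_ (sym (orient-≪ (boundary-≪ (clauseT i CD) givenModel)))
        (cong₂ _∷_ (sym (orient-≪ (boundary-≪ (clauseT i EF) givenModel))) refl))
      con-pair : ∀ o m (e : con R o ≡ m) → map trapOf (conIdsAt o m e) ≡ conPair m
      con-pair o nothing e = refl
      con-pair o (just _) e = refl

    unique-allIds : Unique allIds
    unique-allIds = Uniqueₚ.++⁺
      (unique-concatMap clauseIds clauseIds! clause-key (Uniqueₚ.allFin⁺ k))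
      (unique-concatMap conIds (λ o → conIds! o (con R o) refl) (λ {o} {o'} → con-key o o')
        (unique-concatMap _ occs! occ-key (Uniqueₚ.allFin⁺ k)))
      λ { (a , b) → separate (find (∈-concatMap⁻ clauseIds {allFin k} a)) (find (∈-concatMap⁻ conIds {allOcc k} b)) }
      where
      clauseIds! : ∀ i → Unique (clauseIds i)
      clauseIds! i = ((λ ()) ∷ (λ ()) ∷ []) ∷ ((λ ()) ∷ []) ∷ [] ∷ []
      clause-form : ∀ {i t} → t ∈ clauseIds i → ∃ λ κ → t ≡ clauseT i κ
      clause-form (here e) = _ , e
      clause-form (there (here e)) = _ , e
      clause-form (there (there (here e))) = _ , e
      clause-key : ∀ {i i' t} → t ∈ clauseIds i → t ∈ clauseIds i' → i ≡ i'
      clause-key a b with clause-form a | clause-form b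
      ... | _ , refl | _ , refl = refl
      conIds! : ∀ o m e → Unique (conIdsAt o m e)
      conIds! o nothing e = []
      conIds! o (just _) e = [] ∷ []
      con-form : ∀ {t} o m e → t ∈ conIdsAt o m e → ∃ λ c → t ≡ conT o c
      con-form o (just _) e (here refl) = _ , refl
      con-key : ∀ o o' {t} → t ∈ conIds o → t ∈ conIds o' → o ≡ o'
      con-key o o' a b with con-form o _ refl a | con-form o' _ refl b
      ... | _ , refl | _ , refl = refl
      occs! : ∀ (i : Fin k) → Unique ((i , 0F) ∷ (i , 1F) ∷ (i , 2F) ∷ [])
      occs! i = ((λ ()) ∷ (λ ()) ∷ []) ∷ ((λ ()) ∷ []) ∷ [] ∷ []
      occ-form : ∀ {i : Fin k} {o} → o ∈ (i , 0F) ∷ (i , 1F) ∷ (i , 2F) ∷ [] → proj₁ o ≡ i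
      occ-form (here refl) = refl
      occ-form (there (here refl)) = refl
      occ-form (there (there (here refl))) = refl
      occ-key : ∀ {i i' : Fin k} {o : Occ k} → o ∈ (i , 0F) ∷ (i , 1F) ∷ (i , 2F) ∷ [] →
        o ∈ (i' , 0F) ∷ (i' , 1F) ∷ (i' , 2F) ∷ [] → i ≡ i'
      occ-key a b = trans (sym (occ-form a)) (occ-form b)
      separate : ∀ {t} → (∃ λ i → i ∈ allFin k × t ∈ clauseIds i) → (∃ λ o → o ∈ allOcc k × t ∈ conIds o) → ⊥
      separate (_ , _ , a) (o , _ , b) with clause-form a | con-form o _ refl b
      ... | _ , refl | _ , ()

    ∈-allIds : ∀ t → t ∈ allIds
    ∈-allIds (clauseT i κ) = ∈-++⁺ˡ (∈-concatMap⁺ clauseIds (lose (∈-allFin i) (at κ)))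
      where
      at : ∀ κ → clauseT i κ ∈ clauseIds i
      at AB = here refl
      at CD = there (here refl)
      at EF = there (there (here refl))
    ∈-allIds (conT o c) = ∈-++⁺ʳ (concatMap clauseIds (allFin k))
      (∈-concatMap⁺ conIds (lose (∈-allOcc o) (at (con R o) refl c)))
      where
      at : ∀ m (e : con R o ≡ m) (c : Connector o) → conT o c ∈ conIdsAt o m e
      at nothing e (p , e') with trans (sym e') e
      ... | ()
      at (just p) e c = here (cong (conT o) (connector-unique c (p , e)))

    module Decorated (ε : TrapId → ℚ) where

      translate : TrapId → Side × ℕ → Line
      translate t (s , e) = shift (bline t s) (offset (ε t) e)

      vertex : TrapId → Fin 7 → Trap
      vertex t v = translate t (leftEdge v) , translate t (rightEdge v)

      six : TrapId → List Trap
      six t = sixParallelograms (ε t) (trapOf t)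

      vertex-0 : ∀ t → vertex t 0F ≡ trapOf t
      vertex-0 t = cong₂ _,_ (shift-0 (bline t left) (ε t)) (shift-0 (bline t right) (ε t))

    -- A witness that keeps every later ε at most `β`: processing only appends trapezoids, so the
    -- two endpoints remain.
    HasGap : ℚ → List Trap → Set
    HasGap β S = ∃ λ x → ∃ λ y → x ∈ endpoints top S × y ∈ endpoints top S × y < x × x - y ≡ β

    hasGap-++ : ∀ {β} S S' → HasGap β S → HasGap β (S ++ S')
    hasGap-++ S S' (x , y , x∈ , y∈ , r) = x , y , grow x∈ , grow y∈ , r
      where
      grow : ∀ {x} → x ∈ endpoints top S → x ∈ endpoints top (S ++ S')
      grow x∈ with find (∈-concatMap⁻ _ {S} x∈)
      ... | T , T∈ , x∈' = ∈-concatMap⁺ _ (lose (∈-++⁺ˡ T∈) x∈')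

    override : TrapId → ℚ → (TrapId → ℚ) → TrapId → ℚ
    override t x ε t' with t ≟ᵗ t'
    ... | yes _ = x
    ... | no  _ = ε t'

    override-new : ∀ t {x ε} → override t x ε t ≡ x
    override-new t with t ≟ᵗ t
    ... | yes _ = refl
    ... | no m  = ⊥-elim (m refl)

    override-old : ∀ {t t' x ε} → t ≢ t' → override t x ε t' ≡ ε t'
    override-old {t} {t'} m with t ≟ᵗ t'
    ... | yes e = ⊥-elim (m e)
    ... | no _  = refl

    override-all : ∀ (P : ℚ → Set) t {x ε} → P x → (∀ t → P (ε t)) → ∀ t' → P (override t x ε t')
    override-all P t a b t' with t ≟ᵗ t'
    ... | yes _ = a
    ... | no _  = b t'

    override-six : ∀ t ts {x ε} → Unique (t ∷ ts) →
      sixParallelograms x (trapOf t) ++ concatMap (Decorated.six ε) ts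
        ≡ concatMap (Decorated.six (override t x ε)) (t ∷ ts)
    override-six t ts {x} {ε} (t∉ ∷ _) = cong₂ _++_
      (cong (λ z → sixParallelograms z (trapOf t)) (sym (override-new t)))
      (concatMap-cong-∈ ts λ {t'} t'∈ →
        cong (λ z → sixParallelograms z (trapOf t')) (sym (override-old (All.lookup t∉ t'∈))))

    epsOf-hasGap : ∀ {β} S → HasGap β S → epsOf S ≤ β
    epsOf-hasGap S (x , y , x∈ , y∈ , y<x , refl) = epsOf-top-≤ S x∈ y∈ y<x

    -- The effect of processing the pairs ts on S, with all gaps at most β.
    Expansion : ℚ → List Trap → List TrapId → List Trap → Set
    Expansion β S ts H = ∃ λ (ε : TrapId → ℚ) → (∀ t → 0ℚ < ε t × ε t ≤ β) ×
      H ≡ S ++ concatMap (Decorated.six ε) ts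

    expansion-∷ : ∀ {β H} S t ts x → Unique (t ∷ ts) → 0ℚ < x → x ≤ β →
      Expansion β (S ++ sixParallelograms x (trapOf t)) ts H → Expansion β S (t ∷ ts) H
    expansion-∷ {β} S t ts x u 0<x x≤β (ε , bound , eq) = override t x ε
      , override-all (λ z → 0ℚ < z × z ≤ β) t (0<x , x≤β) bound
      , trans eq (trans (++-assoc S _ _) (cong (S ++_) (override-six t ts u)))

    foldl-step : ∀ {β} S ts → Unique ts → 0ℚ < β → HasGap β S →
      Expansion β S ts (foldl step S (map trapOf ts))
    foldl-step {β} S [] _ 0<β _ = (λ _ → β) , (λ _ → 0<β , ≤-refl) , sym (++-identityʳ S)
    foldl-step {β} S (t ∷ ts) u@(_ ∷ uts) 0<β g =
      expansion-∷ S t ts (epsOf S) u (epsOf-pos S) (epsOf-hasGap S g)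
        (foldl-step (step S (trapOf t)) ts uts 0<β (hasGap-++ S (sixParallelograms (epsOf S) (trapOf t)) g))

    -- All that is kept of the construction. `γ` bounds the gaps of R_P from below; `ε-sum` is one
    -- bound covering both the pair processed first against a later one and two later ones.
    record Gaps (H : List Trap) : Set where
      field
        γ       : ℚ
        ε       : TrapId → ℚ
        γ-pos   : 0ℚ < γ
        ε-pos   : ∀ t → 0ℚ < ε t
        ε≤γ     : ∀ t → ε t ≤ γ
        ε-sum   : ∀ {t t'} → t ≢ t' → ε t + ε t' ≤ γ + (+ 1 / 8) * γ
        top-gap : ∀ p q → top (lineOf p) < top (lineOf q) → γ ≤ top (lineOf q) - top (lineOf p)
        bot-gap : ∀ p q → bot (lineOf p) < bot (lineOf q) → γ ≤ bot (lineOf q) - bot (lineOf p)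
        ids     : List TrapId
        ids-all : ∀ t → t ∈ ids
        form    : H ≡ map trapOf allIds ++ concatMap (Decorated.six ε) ids

    pairsOf-endpoint : ∀ f p → f (lineOf p) ∈ endpoints f (pairsOf R)
    pairsOf-endpoint f p with home p | boundary-home p
    ... | t , left  | refl = proj₁ (endpoint {f = f} (subst (trapOf t ∈_) map-trapOf-allIds (∈-map⁺ trapOf (∈-allIds t))))
    ... | t , right | refl = proj₂ (endpoint {f = f} (subst (trapOf t ∈_) map-trapOf-allIds (∈-map⁺ trapOf (∈-allIds t))))

    -- The left lines of T_{u,2} and T_{u,3} are at distance ε/8.
    six-gap : ∀ {ε} S t → 0ℚ < ε → HasGap ((+ 1 / 8) * ε) (S ++ sixParallelograms ε (trapOf t))
    six-gap {ε} S t 0<ε = x + offset ε 2 , x + offset ε 1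
        , proj₁ (endpoint {f = top} (∈-++⁺ʳ S (there (here refl)))) , proj₁ (endpoint {f = top} (∈-++⁺ʳ S (there (there (here refl)))))
        , +-monoʳ-< x (offset-mono-< {e = 1} {e' = 2} 0<ε (s≤s (s≤s z≤n)))
        , solve 2 (λ x ε → (x :+ constant (-[1+ 5 ] / 8) :* ε) :- (x :+ constant (-[1+ 6 ] / 8) :* ε) := constant (+ 1 / 8) :* ε) refl x ε
        where x = top (bline t left)

    pos/8 : ∀ {γ} → 0ℚ < γ → 0ℚ < (+ 1 / 8) * γ
    pos/8 {γ} h = subst (_< (+ 1 / 8) * γ) (*-zeroʳ (+ 1 / 8)) (*-monoʳ-<-pos (+ 1 / 8) h)

    /8-≤ : ∀ {γ} → 0ℚ < γ → (+ 1 / 8) * γ ≤ γ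
    /8-≤ {γ} h = subst ((+ 1 / 8) * γ ≤_) (*-identityˡ γ)
      (*-monoʳ-≤-nonNeg γ {{pos⇒nonNeg γ {{positive h}}}} (from-yes ((+ 1 / 8) ≤? 1ℚ)))

    override-sum : ∀ t₀ {γ ε} → 0ℚ < γ → (∀ t → ε t ≤ (+ 1 / 8) * γ) → ∀ {t t'} → t ≢ t' →
      override t₀ γ ε t + override t₀ γ ε t' ≤ γ + (+ 1 / 8) * γ
    override-sum t₀ {γ} {ε} 0<γ bound {t} {t'} m with t₀ ≟ᵗ t | t₀ ≟ᵗ t'
    ... | yes refl | yes refl = ⊥-elim (m refl)
    ... | yes _    | no _  = +-mono-≤ (≤-refl {γ}) (bound t')
    ... | no _     | no _  = +-mono-≤ (≤-trans (bound t) (/8-≤ 0<γ)) (bound t')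
    ... | no _     | yes _ = subst (_≤ γ + (+ 1 / 8) * γ) (+-comm γ (ε t)) (+-mono-≤ (≤-refl {γ}) (bound t))

    gaps-∷ : ∀ {H} t ts γ → Unique (t ∷ ts) → (∀ t' → t' ∈ t ∷ ts) → 0ℚ < γ →
      (∀ p q → top (lineOf p) < top (lineOf q) → γ ≤ top (lineOf q) - top (lineOf p)) →
      (∀ p q → bot (lineOf p) < bot (lineOf q) → γ ≤ bot (lineOf q) - bot (lineOf p)) →
      Expansion ((+ 1 / 8) * γ) (pairsOf R ++ sixParallelograms γ (trapOf t)) ts H → Gaps H
    gaps-∷ t ts γ u all 0<γ top-gap bot-gap (ε , bound , eq) = record
      { γ = γ ; ε = override t γ ε ; γ-pos = 0<γ
      ; ε-pos = override-all (0ℚ <_) t 0<γ (λ t → proj₁ (bound t))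
      ; ε≤γ = override-all (_≤ γ) t ≤-refl (λ t → ≤-trans (proj₂ (bound t)) (/8-≤ 0<γ))
      ; ε-sum = override-sum t 0<γ (λ t → proj₂ (bound t))
      ; top-gap = top-gap ; bot-gap = bot-gap
      ; ids = t ∷ ts ; ids-all = all
      ; form = trans eq (trans (++-assoc (pairsOf R) _ _) (cong₂ _++_ (sym map-trapOf-allIds) (override-six t ts u))) }

    gaps-of : ∀ ts → Unique ts → (∀ t → t ∈ ts) → Gaps (foldl step (pairsOf R) (map trapOf ts))
    -- There is no pair and hence no line; 1 stands for any positive number.
    gaps-of [] _ all = record
      { γ = 1ℚ ; ε = λ _ → 1ℚ ; γ-pos = positive⁻¹ 1ℚ ; ε-pos = λ _ → positive⁻¹ 1ℚ ; ε≤γ = λ _ → ≤-refl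
      ; ε-sum = λ {t} _ → absurd t ; top-gap = λ p _ _ → absurd (proj₁ (home p)) ; bot-gap = λ p _ _ → absurd (proj₁ (home p))
      ; ids = [] ; ids-all = all
      ; form = trans (sym map-trapOf-allIds) (sym (++-identityʳ _)) }
      where
      absurd : ∀ {A : Set} → TrapId → A
      absurd t with all t
      ... | ()
    -- The first pair is processed with the smallest gap of R_P itself; its own parallelograms then
    -- bound the ε of all others.
    gaps-of (t ∷ ts) u@(_ ∷ uts) all = gaps-∷ t ts (epsOf S) u all (epsOf-pos S)
      (λ p q → epsOf-top-≤ S (pairsOf-endpoint top q) (pairsOf-endpoint top p))
      (λ p q → epsOf-bot-≤ S (pairsOf-endpoint bot q) (pairsOf-endpoint bot p))
      (foldl-step (step S (trapOf t)) ts uts (pos/8 (epsOf-pos S)) (six-gap S t (epsOf-pos S)))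
      where
      S = pairsOf R

    gapsOf : ∀ {ord} → ord ↭ pairsOf R → Gaps (buildH R ord)
    gapsOf {ord} ord↭ with ↭-map-inv trapOf (subst (λ z → z ↭ ord) (sym map-trapOf-allIds) (↭-sym ord↭))
    ... | ts , refl , ρ = gaps-of ts
      (Permutationₛ.Unique-resp-↭ (setoid TrapId) (↭⇒↭ₛ ρ) unique-allIds) (λ t → ∈-resp-↭ ρ (∈-allIds t))

  -- Counting, and assignments from a predicate on occurrences

  module _ {A : Set} {P Q : A → Set} (P? : Decidable P) (Q? : Decidable Q) (P⇒Q : ∀ {x} → P x → Q x) where

    length-filter-≤ : ∀ xs → length (filter P? xs) ℕ.≤ length (filter Q? xs)
    length-filter-≤ [] = z≤n
    length-filter-≤ (x ∷ xs) with P? x | Q? x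
    ... | yes _ | yes _ = s≤s (length-filter-≤ xs)
    ... | yes p | no ¬q = ⊥-elim (¬q (P⇒Q p))
    ... | no _  | yes _ = ℕₚ.m≤n⇒m≤1+n (length-filter-≤ xs)
    ... | no _  | no _  = length-filter-≤ xs

    length-filter-< : ∀ {x} xs → x ∈ xs → ¬ P x → Q x → length (filter P? xs) ℕ.< length (filter Q? xs)
    length-filter-< (x ∷ xs) (here refl) ¬p q with P? x | Q? x
    ... | yes p | _     = ⊥-elim (¬p p)
    ... | no _  | yes _ = s≤s (length-filter-≤ xs)
    ... | no _  | no ¬q = ⊥-elim (¬q q)
    length-filter-< (y ∷ xs) (there x∈) ¬p q with P? y | Q? y
    ... | yes _ | yes _  = s≤s (length-filter-< xs x∈ ¬p q)
    ... | yes p' | no ¬q = ⊥-elim (¬q (P⇒Q p'))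
    ... | no _  | yes _  = ℕₚ.m≤n⇒m≤1+n (length-filter-< xs x∈ ¬p q)
    ... | no _  | no _   = length-filter-< xs x∈ ¬p q

  anyOcc? : ∀ {k} {P : Occ k → Set} → Decidable P → Dec (∃ P)
  anyOcc? P? = map′ (λ { (i , j , p) → (i , j) , p }) (λ { ((i , j) , p) → i , j , p })
    (Finₚ.any? λ i → Finₚ.any? λ j → P? (i , j))

  <-cycle : ∀ (a b c : ℚ) → a < b → b < c → ¬ (c < a)
  <-cycle a b c h h' h″ = <-irrefl refl (<-trans h (<-trans h' h″))

  ≮∧≢⇒> : ∀ (a b : ℚ) → ¬ (a < b) → a ≢ b → b < a
  ≮∧≢⇒> a b n m with <-cmp a b
  ... | tri< h _ _ = ⊥-elim (n h)
  ... | tri≈ _ e _ = ⊥-elim (m e)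
  ... | tri> _ _ h = h

  -- By `same`, `P` depends only on the variable, so "some occurrence satisfies `P`" is its value at
  -- every occurrence.
  assignment : ∀ {n k} (φ : Formula n k) (P : Occ k → Set) → Decidable P →
    (∀ {o o'} → var φ o ≡ var φ o' → P o → P o') →
    (∀ i → ¬ ((∀ j → P (i , j)) ⊎ (∀ j → ¬ P (i , j)))) → NAESat φ
  assignment φ P P? same nae = (λ p → does (true? p)) , λ i → some-true i , some-false i
    where
    true? : ∀ p → Dec (∃ λ o → var φ o ≡ p × P o)
    true? p = anyOcc? λ o → (var φ o Finₚ.≟ p) ×-dec P? o
    some-true : ∀ i → ∃ λ j → does (true? (φ i j)) ≡ true
    some-true i with Finₚ.any? (λ j → P? (i , j))
    ... | yes (j , h) = j , dec-true (true? (φ i j)) ((i , j) , refl , h)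
    ... | no n = ⊥-elim (nae i (inj₂ λ j h → n (j , h)))
    some-false : ∀ i → ∃ λ j → does (true? (φ i j)) ≡ false
    some-false i with Finₚ.all? (λ j → P? (i , j))
    ... | yes f = ⊥-elim (nae i (inj₁ f))
    ... | no n with Finₚ.¬∀⟶∃¬ 3 _ (λ j → P? (i , j)) n
    ...   | j , h = j , dec-false (true? (φ i j)) λ { (o , e , p) → h (same e p) }

  InRange : ℕ → Set
  InRange e = (1 ℕ.≤ e) × (e ℕ.≤ 15)

  flagOf : Side → Fin 7
  flagOf left  = 2F
  flagOf right = 5F

  -- Chains of occurrences and intersections in H_φ

  module Relations {n k : ℕ} (φ : Formula n k) (inc : Increasing φ) (R : RP k) (V : ValidRP φ R) where

    open ValidRP V
    open Geometry φ R V
    open Model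
    open Construction φ inc R V

    _≺?_ : ∀ o o' → Dec (o ≺ o')
    o ≺? o' = Finₚ.all? λ a → Finₚ.all? λ b → occ R o a ≪? occ R o' b

    -- Linearises the order of the occurrences; it bounds the induction along a variable and later
    -- numbers the blocks.
    rank : Occ k → ℕ
    rank o = length (filter (_≺? o) (allOcc k))

    rank-mono : ∀ {o o'} → o ≺ o' → rank o ℕ.< rank o'
    rank-mono {o} {o'} h = length-filter-< (_≺? o) (_≺? o') (λ p → ≺-trans p h) (allOcc k) (∈-allOcc o) ≺-irrefl h

    next-unique : ∀ {o o'} (c : Connector o) → Succ φ R o o' → o' ≡ next c
    next-unique {o} {o'} c (e , h , min) with o' ≟ᵒ next c
    ... | yes e' = e'
    ... | no m with ≺-total m
    ...   | inj₁ g = ⊥-elim (nothing-between c h g)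
    ...   | inj₂ g = ⊥-elim (min (next c) (sym (proj₁ (next-succ c))) (≺-next c , g))

    module Chain {Q : Occ k → Set} (up : ∀ {o} (c : Connector o) → Q o → Q (next c))
      (down : ∀ {o} (c : Connector o) → Q (next c) → Q o) where

      -- `d` bounds the difference of the ranks. If an occurrence of the same variable lies in
      -- between, both halves are shorter; otherwise the two are consecutive and `succCon` supplies
      -- the connector.
      along : ∀ d {o o'} → var φ o ≡ var φ o' → o ≺ o' → rank o' ℕ.≤ rank o ℕ.+ d → (Q o → Q o') × (Q o' → Q o)
      along ℕ.zero {o} {o'} e h d≤ = ⊥-elim (ℕₚ.<-irrefl refl
        (ℕₚ.<-≤-trans (rank-mono h) (subst (rank o' ℕ.≤_) (ℕₚ.+-identityʳ (rank o)) d≤)))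
      along (suc d) {o} {o'} e h d≤
        with anyOcc? (λ m → (var φ m Finₚ.≟ var φ o) ×-dec ((o ≺? m) ×-dec (m ≺? o')))
      ... | no none with succCon o o' (e , h , λ m e' b → none (m , e' , b))
      ...   | c with next-unique c (e , h , λ m e' b → none (m , e' , b))
      ...     | refl = up c , down c
      along (suc d) {o} {o'} e h d≤ | yes (m , e' , om , mo')
        with along d (sym e') om (ℕₚ.≤-pred (ℕₚ.≤-trans (rank-mono mo') d≤′))
           | along d (trans e' e) mo' (ℕₚ.≤-trans d≤′ (ℕₚ.+-monoˡ-≤ d (rank-mono om)))
        where
        d≤′ : rank o' ℕ.≤ suc (rank o ℕ.+ d)
        d≤′ = subst (rank o' ℕ.≤_) (ℕₚ.+-suc (rank o) d) d≤
      ... | f , g | f' , g' = (λ q → f' (f q)) , (λ q → g (g' q))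

      same-variable : ∀ {o o'} → var φ o ≡ var φ o' → Q o → Q o'
      same-variable {o} {o'} e q with o ≟ᵒ o'
      ... | yes refl = q
      ... | no m with ≺-total m
      ...   | inj₁ h = proj₁ (along (rank o') e h (ℕₚ.m≤n+m (rank o') (rank o))) q
      ...   | inj₂ h = proj₂ (along (rank o) (sym e) h (ℕₚ.m≤n+m (rank o) (rank o'))) q

    module WithGaps {H : List Trap} (G : Gaps H) where

      open Gaps G public
      open Decorated ε public

      translate-mono : ∀ t s e e' → e ℕ.≤ e' → WellFormed (translate t (s , e) , translate t (s , e'))
      translate-mono t s e e' h =
          +-monoʳ-≤ (top (bline t s)) (offset-mono-≤ {ε t} {e} {e'} (ε-pos t) h)
        , +-monoʳ-≤ (bot (bline t s)) (offset-mono-≤ {ε t} {e} {e'} (ε-pos t) h)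

      vertex-0-wf : ∀ t → WellFormed (trapOf t)
      vertex-0-wf t = <⇒≤ (proj₁ (boundary-≪ t givenModel)) , <⇒≤ (proj₂ (boundary-≪ t givenModel))

      vertex-wf : ∀ t v → WellFormed (vertex t v)
      vertex-wf t 0F = subst WellFormed (sym (vertex-0 t)) (vertex-0-wf t)
      vertex-wf t 1F = translate-mono t left 4 12 (from-yes (4 ℕ.≤? 12))
      vertex-wf t 2F = translate-mono t left 2 6 (from-yes (2 ℕ.≤? 6))
      vertex-wf t 3F = translate-mono t left 1 5 (from-yes (1 ℕ.≤? 5))
      vertex-wf t 4F = translate-mono t right 4 12 (from-yes (4 ℕ.≤? 12))
      vertex-wf t 5F = translate-mono t right 10 14 (from-yes (10 ℕ.≤? 14))
      vertex-wf t 6F = translate-mono t right 11 15 (from-yes (11 ℕ.≤? 15))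

      vertex∈ : ∀ t v → vertex t v ∈ H
      vertex∈ t v = subst (vertex t v ∈_) (sym form) (at v)
        where
        added : ∀ {T} → T ∈ six t → T ∈ map trapOf allIds ++ concatMap six ids
        added T∈ = ∈-++⁺ʳ (map trapOf allIds) (∈-concatMap⁺ six (lose (ids-all t) T∈))
        at : ∀ v → vertex t v ∈ map trapOf allIds ++ concatMap six ids
        at 0F = ∈-++⁺ˡ (subst (_∈ map trapOf allIds) (sym (vertex-0 t)) (∈-map⁺ trapOf (∈-allIds t)))
        at 1F = added (here refl)
        at 2F = added (there (here refl))
        at 3F = added (there (there (here refl)))
        at 4F = added (there (there (there (here refl))))
        at 5F = added (there (there (there (there (here refl)))))
        at 6F = added (there (there (there (there (there (here refl))))))

      ∈-vertex : ∀ {T} → T ∈ H → ∃ λ t → ∃ λ v → T ≡ vertex t v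
      ∈-vertex T∈ with ∈-++⁻ (map trapOf allIds) (subst (_ ∈_) form T∈)
      ... | inj₁ T∈' with ∈-map⁻ trapOf T∈'
      ...   | t , _ , refl = t , 0F , sym (vertex-0 t)
      ∈-vertex T∈ | inj₂ T∈' with find (∈-concatMap⁻ six {ids} T∈')
      ... | t , _ , T∈″ = t , at T∈″
        where
        at : ∀ {T} → T ∈ six t → ∃ λ v → T ≡ vertex t v
        at (here e) = 1F , e
        at (there (here e)) = 2F , e
        at (there (there (here e))) = 3F , e
        at (there (there (there (here e)))) = 4F , e
        at (there (there (there (there (here e))))) = 5F , e
        at (there (there (there (there (there (here e)))))) = 6F , e

      near-top : ∀ {t t'} s s' e e' → t ≢ t' → e ℕ.≤ 15 → 1 ℕ.≤ e' →
        top (bline t s) < top (bline t' s') → top (translate t (s , e)) < top (translate t' (s' , e'))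
      near-top {t} {t'} s s' e e' m h h' lt =
        offsets-separate {x = top (bline t s)} {y = top (bline t' s')} {e = e} {e' = e'} γ-pos (ε-pos t) (ε-pos t') (ε-sum m) h h' (top-gap (boundary t s) (boundary t' s') lt)

      near-bot : ∀ {t t'} s s' e e' → t ≢ t' → e ℕ.≤ 15 → 1 ℕ.≤ e' →
        bot (bline t s) < bot (bline t' s') → bot (translate t (s , e)) < bot (translate t' (s' , e'))
      near-bot {t} {t'} s s' e e' m h h' lt =
        offsets-separate {x = bot (bline t s)} {y = bot (bline t' s')} {e = e} {e' = e'} γ-pos (ε-pos t) (ε-pos t') (ε-sum m) h h' (bot-gap (boundary t s) (boundary t' s') lt)

      near-≪ : ∀ {t t'} s s' e e' → t ≢ t' → InRange e → InRange e' →
        bline t s ≪ bline t' s' → translate t (s , e) ≪ translate t' (s' , e')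
      near-≪ {t} {t'} s s' e e' m (_ , h) (h' , _) (a , b) =
        near-top {t} {t'} s s' e e' m h h' a , near-bot {t} {t'} s s' e e' m h h' b

      near-crossed : ∀ {t t'} s s' e e' → t ≢ t' → InRange e → InRange e' →
        Crossed (bline t s) (bline t' s') → Crossed (translate t (s , e)) (translate t' (s' , e'))
      near-crossed {t} {t'} s s' e e' m (h , h') (g , g') (inj₁ (a , b)) =
        inj₁ (near-top {t} {t'} s s' e e' m h' g a , near-bot {t'} {t} s' s e' e (≢-sym m) g' h b)
      near-crossed {t} {t'} s s' e e' m (h , h') (g , g') (inj₂ (a , b)) =
        inj₂ (near-top {t'} {t} s' s e' e (≢-sym m) g' h a , near-bot {t} {t'} s s' e e' m h' g b)

      Contains : Trap → Line → Set
      Contains (p , q) m = WellFormed (p , m) × WellFormed (m , q)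

      crossed-intersect : ∀ {T T' m m'} → Contains T m → Contains T' m' → Crossed m m' → Intersect T T'
      crossed-intersect ((pt , pb) , (qt , qb)) ((pt' , pb') , (qt' , qb')) c (inj₁ (a , b)) =
        crossed⇒¬≪ c (≤-<-trans qt (<-≤-trans a pt') , ≤-<-trans qb (<-≤-trans b pb'))
      crossed-intersect ((pt , pb) , (qt , qb)) ((pt' , pb') , (qt' , qb')) c (inj₂ (a , b)) =
        crossed⇒¬≪ (crossed-sym c) (≤-<-trans qt' (<-≤-trans a pt) , ≤-<-trans qb' (<-≤-trans b pb))

      body-contains : ∀ t s → Contains (vertex t 0F) (translate t (s , 8))
      body-contains t left  = translate-mono t left 8 8 ℕₚ.≤-refl , vertex-wf t 0F
      body-contains t right = vertex-wf t 0F , translate-mono t right 8 8 ℕₚ.≤-refl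

      -- Selects a line inside the flag, its left edge, whose crossings witness the intersections of
      -- the flag.
      flagOffset : Side → ℕ
      flagOffset left  = 2
      flagOffset right = 10

      flag-contains : ∀ t s → Contains (vertex t (flagOf s)) (translate t (s , flagOffset s))
      flag-contains t left  = translate-mono t left 2 2 ℕₚ.≤-refl , vertex-wf t 2F
      flag-contains t right = translate-mono t right 10 10 ℕₚ.≤-refl , vertex-wf t 5F

      bodyRange : InRange 8
      bodyRange = from-yes (1 ℕ.≤? 8) , from-yes (8 ℕ.≤? 15)

      flagRange : ∀ s → InRange (flagOffset s)
      flagRange left  = from-yes (1 ℕ.≤? 2) , from-yes (2 ℕ.≤? 15)
      flagRange right = from-yes (1 ℕ.≤? 10) , from-yes (10 ℕ.≤? 15)

      flag-body : ∀ t s → Disjoint (vertex t (flagOf s)) (vertex t 0F)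
      flag-body t left  = inj₁ (shift-mono-≪ (bline t left) {ε t} {6} {8} (ε-pos t) (from-yes (6 ℕ.<? 8)))
      flag-body t right = inj₂ (shift-mono-≪ (bline t right) {ε t} {8} {10} (ε-pos t) (from-yes (8 ℕ.<? 10)))

      flag-flag : ∀ {t t' s s'} → t ≢ t' → bline t s ≪ bline t' s' →
        Disjoint (vertex t (flagOf s)) (vertex t' (flagOf s'))
      flag-flag {t} {t'} {left} {left} m h =
        inj₁ (near-≪ {t} {t'} left left 6 (flagOffset left) m (from-yes (1 ℕ.≤? 6) , from-yes (6 ℕ.≤? 15)) (flagRange left) h)
      flag-flag {t} {t'} {left} {right} m h =
        inj₁ (near-≪ {t} {t'} left right 6 (flagOffset right) m (from-yes (1 ℕ.≤? 6) , from-yes (6 ℕ.≤? 15)) (flagRange right) h)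
      flag-flag {t} {t'} {right} {left} m h =
        inj₁ (near-≪ {t} {t'} right left 14 (flagOffset left) m (from-yes (1 ℕ.≤? 14) , from-yes (14 ℕ.≤? 15)) (flagRange left) h)
      flag-flag {t} {t'} {right} {right} m h =
        inj₁ (near-≪ {t} {t'} right right 14 (flagOffset right) m (from-yes (1 ℕ.≤? 14) , from-yes (14 ℕ.≤? 15)) (flagRange right) h)

      vertices-intersect : ∀ {t t' s s' v v' e e'} → t ≢ t' →
        Contains (vertex t v) (translate t (s , e)) → Contains (vertex t' v') (translate t' (s' , e')) →
        InRange e → InRange e' → Crossed (bline t s) (bline t' s') → Intersect (vertex t v) (vertex t' v')
      vertices-intersect {t} {t'} {s} {s'} {v} {v'} {e} {e'} m c c' r r' x =
        crossed-intersect c c' (near-crossed {t} {t'} s s' e e' m r r' x)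

      own-≪ : ∀ t e e' → (e ℕ.≤ 11 × 4 ℕ.≤ e') ⊎ (e ℕ.≤ 12 × 5 ℕ.≤ e') → translate t (left , e) ≪ translate t (right , e')
      own-≪ t e e' h =
          offsets-separate-own {γ} {ε t} {top (bline t left)} {top (bline t right)} {e} {e'} (ε-pos t) (ε≤γ t) h
            (top-gap (boundary t left) (boundary t right) (proj₁ (boundary-≪ t givenModel)))
        , offsets-separate-own {γ} {ε t} {bot (bline t left)} {bot (bline t right)} {e} {e'} (ε-pos t) (ε≤γ t) h
            (bot-gap (boundary t left) (boundary t right) (proj₂ (boundary-≪ t givenModel)))

      own-¬≪ : ∀ t e e' → 8 ℕ.≤ e → e' ℕ.≤ 8 → ¬ (translate t (right , e) ≪ translate t (left , e'))
      own-¬≪ t e e' h h' (d , _) = <-irrefl refl (<-≤-trans d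
        (≤-trans (proj₁ (translate-mono t left e' 8 h')) (≤-trans (proj₁ (vertex-wf t 0F)) (proj₁ (translate-mono t right 8 e h)))))

      -- T_{u,1} and T_{u,4} touch.  This happens when the two lines of the pair are at distance exactly ε,
      -- which is possible only for the pair that is processed first.
      Tied : TrapId → Set
      Tied t = ¬ (translate t (left , 12) ≪ translate t (right , 4))

      tied? : ∀ t → Dec (Tied t)
      tied? t = ¬? (translate t (left , 12) ≪? translate t (right , 4))

      ¬tied : ∀ t → ¬ Tied t → translate t (left , 12) ≪ translate t (right , 4)
      ¬tied t n = decidable-stable (translate t (left , 12) ≪? translate t (right , 4)) n

      tied-adjacent : ∀ {t} → Tied t → ∀ w → ¬ (bline t left ≪ lineOf w × lineOf w ≪ bline t right)
      tied-adjacent {t} tied w ((a , b) , (c , d)) = tied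
        ( offsets-separate-far {γ} {ε t} {top (bline t left)} {top (bline t right)} {top (lineOf w)} (ε-pos t) (ε≤γ t)
            (top-gap (boundary t left) w a) (top-gap w (boundary t right) c)
        , offsets-separate-far {γ} {ε t} {bot (bline t left)} {bot (bline t right)} {bot (lineOf w)} (ε-pos t) (ε≤γ t)
            (bot-gap (boundary t left) w b) (bot-gap w (boundary t right) d) )

      tied-ε : ∀ {t} → Tied t → γ ≤ ε t
      tied-ε {t} tied = ≮⇒≥ λ h → tied
        ( offsets-separate-< {γ} {ε t} {top (bline t left)} {top (bline t right)} h
            (top-gap (boundary t left) (boundary t right) (proj₁ (boundary-≪ t givenModel)))
        , offsets-separate-< {γ} {ε t} {bot (bline t left)} {bot (bline t right)} h
            (bot-gap (boundary t left) (boundary t right) (proj₂ (boundary-≪ t givenModel))) )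

      tied-unique : ∀ {t t'} → t ≢ t' → Tied t → ¬ Tied t'
      tied-unique m a b = 1/8-excess γ-pos (tied-ε a) (tied-ε b) (ε-sum m)

    -- From a bounded tolerance representation to an assignment

    module FromTolerance {H : List Trap} (G : Gaps H) (bt : IsBoundedTolerance (length H) (TrapAdj H)) where

      open WithGaps G

      private
        N = length H
        l r τ : Fin N → ℚ
        l = proj₁ bt
        r = proj₁ (proj₂ bt)
        τ = proj₁ (proj₂ (proj₂ bt))
        0<τ : ∀ i → 0ℚ < τ i
        0<τ = proj₁ (proj₂ (proj₂ (proj₂ (proj₂ bt))))
        τ≤ : ∀ i → τ i ≤ r i - l i
        τ≤ = proj₁ (proj₂ (proj₂ (proj₂ (proj₂ (proj₂ bt)))))
        adj : ∀ i j → i ≢ j →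
          (TrapAdj H i j → (τ i ⊓ τ j) ≤ overlapLen (l i) (r i) (l j) (r j)) ×
          ((τ i ⊓ τ j) ≤ overlapLen (l i) (r i) (l j) (r j) → TrapAdj H i j)
        adj = proj₂ (proj₂ (proj₂ (proj₂ (proj₂ (proj₂ bt)))))

      pgram : Fin N → Trap
      pgram i = parallelogram (l i) (r i) (τ i)

      pgram-par : ∀ i → Parallelogram (pgram i)
      pgram-par i = par
        ( ≤-by (solve 3 (λ l r t → (r :- l) :- t := (r :- t) :- l) refl (l i) (r i) (τ i)) (τ≤ i)
        , ≤-by (solve 3 (λ l r t → (r :- l) :- t := r :- (l :+ t)) refl (l i) (r i) (τ i)) (τ≤ i))
        (solve 3 (λ l r t → (r :- t) :- r := l :- (l :+ t)) refl (l i) (r i) (τ i))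

      wf-intersect : ∀ {T} → WellFormed T → Intersect T T
      wf-intersect (w , _) (inj₁ (a , _)) = <-irrefl refl (<-≤-trans a w)
      wf-intersect (w , _) (inj₂ (a , _)) = <-irrefl refl (<-≤-trans a w)

      -- Indices found for different vertices are not known to differ, hence the case `i ≡ j` here
      -- and in `disjoint⁺`.
      intersect⁺ : ∀ i j → Intersect (lookup H i) (lookup H j) → Intersect (pgram i) (pgram j)
      intersect⁺ i j int with i Finₚ.≟ j
      ... | yes refl = wf-intersect (Parallelogram.wellFormed (pgram-par i))
      ... | no m = tolerant⇒intersect (l i) (r i) (τ i) (l j) (r j) (τ j) (0<τ i) (0<τ j) (proj₁ (adj i j m) (m , int))

      disjoint⁺ : ∀ i j → WellFormed (lookup H i) → Disjoint (lookup H i) (lookup H j) → Disjoint (pgram i) (pgram j)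
      disjoint⁺ i j w d with i Finₚ.≟ j
      ... | yes refl = ⊥-elim (wf-intersect w d)
      ... | no m with disjoint? (pgram i) (pgram j)
      ...   | yes d' = d'
      ...   | no ¬d' = ⊥-elim (proj₂ (proj₂ (adj i j m)
                (intersect⇒tolerant (l i) (r i) (τ i) (l j) (r j) (τ j) (τ≤ i) (τ≤ j) ¬d')) d)

      ix : TrapId → Fin 7 → Fin N
      ix t v = Any.index (vertex∈ t v)

      lookup-ix : ∀ t v → lookup H (ix t v) ≡ vertex t v
      lookup-ix t v = sym (Anyₚ.lookup-index (vertex∈ t v))

      image : TrapId → Fin 7 → Trap
      image t v = pgram (ix t v)

      image-intersect : ∀ {t v t' v'} → Intersect (vertex t v) (vertex t' v') → Intersect (image t v) (image t' v')
      image-intersect {t} {v} {t'} {v'} int = intersect⁺ (ix t v) (ix t' v')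
        (subst₂ Intersect (sym (lookup-ix t v)) (sym (lookup-ix t' v')) int)

      image-disjoint : ∀ {t v t' v'} → Disjoint (vertex t v) (vertex t' v') → Disjoint (image t v) (image t' v')
      image-disjoint {t} {v} {t'} {v'} d = disjoint⁺ (ix t v) (ix t' v')
        (subst WellFormed (sym (lookup-ix t v)) (vertex-wf t v))
        (subst₂ Disjoint (sym (lookup-ix t v)) (sym (lookup-ix t' v')) d)

      flaggedLine : TrapId × Side → Flagged
      flaggedLine (t , s) = flagged {image t 0F} {image t (flagOf s)} (pgram-par (ix t 0F))
        (Parallelogram.wellFormed (pgram-par (ix t (flagOf s)))) (image-disjoint {t} {flagOf s} {t} {0F} (flag-body t s))

      traps-crossing : ∀ {t t'} s s' → t ≢ t' → Crossed (bline t s) (bline t' s') →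
        Crossing (flaggedLine (t , s)) (flaggedLine (t' , s'))
      traps-crossing {t} {t'} s s' m c = crossing
        (image-intersect {t} {0F} {t'} {0F}
          (vertices-intersect {t} {t'} {s} {s'} {0F} {0F} {8} {8} m (body-contains t s) (body-contains t' s') bodyRange bodyRange c))
        (image-intersect {t} {0F} {t'} {flagOf s'}
          (vertices-intersect {t} {t'} {s} {s'} {0F} {flagOf s'} {8} {flagOffset s'} m (body-contains t s) (flag-contains t' s') bodyRange (flagRange s') c))
        (image-intersect {t} {flagOf s} {t'} {0F}
          (vertices-intersect {t} {t'} {s} {s'} {flagOf s} {0F} {flagOffset s} {8} m (flag-contains t s) (body-contains t' s') (flagRange s) bodyRange c))
        (image-intersect {t} {flagOf s} {t'} {flagOf s'}
          (vertices-intersect {t} {t'} {s} {s'} {flagOf s} {flagOf s'} {flagOffset s} {flagOffset s'} m (flag-contains t s) (flag-contains t' s') (flagRange s) (flagRange s') c))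

      lineFlag : Ln → Flagged
      lineFlag p = flaggedLine (home p)

      at-home : ∀ p → lineOf p ≡ bline (proj₁ (home p)) (proj₂ (home p))
      at-home p = cong lineOf (sym (boundary-home p))

      lines-crossing : ∀ p q → proj₁ (home p) ≢ proj₁ (home q) → Crossed (lineOf p) (lineOf q) →
        Crossing (lineFlag p) (lineFlag q)
      lines-crossing p q m c = traps-crossing (proj₂ (home p)) (proj₂ (home q)) m (subst₂ Crossed (at-home p) (at-home q) c)

      lines-disjoint : ∀ p q → proj₁ (home p) ≢ proj₁ (home q) → lineOf p ≪ lineOf q →
        Disjoint (Flagged.flag (lineFlag p)) (Flagged.flag (lineFlag q))
      lines-disjoint p q m c = image-disjoint
        {proj₁ (home p)} {flagOf (proj₂ (home p))} {proj₁ (home q)} {flagOf (proj₂ (home q))}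
        (flag-flag {proj₁ (home p)} {proj₁ (home q)} {proj₂ (home p)} {proj₂ (home q)} m (subst₂ _≪_ (at-home p) (at-home q) c))

      trapSlope : TrapId → ℚ
      trapSlope t = slope (proj₁ (image t 0F))

      lineSlope : Ln → ℚ
      lineSlope p = trapSlope (proj₁ (home p))

      module SameSide {f g w : Flagged} (d : Disjoint (Flagged.flag f) (Flagged.flag g))
        (cf : Crossing f w) (cg : Crossing g w) where

        -- Equal slopes are excluded by the crossing of `g` and `w`, the opposite order by
        -- `crossing-same-side`.
        below : Flagged.slopeOf w < Flagged.slopeOf f → Flagged.slopeOf w < Flagged.slopeOf g
        below h with <-cmp (Flagged.slopeOf w) (Flagged.slopeOf g)
        ... | tri< a _ _ = a
        ... | tri≈ _ e _ = ⊥-elim (crossing-slope-≢ cg (sym e))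
        ... | tri> _ _ a = ⊥-elim (crossing-same-side (disjoint-sym {Flagged.flag f} d) cg cf a h)

        above : Flagged.slopeOf f < Flagged.slopeOf w → Flagged.slopeOf g < Flagged.slopeOf w
        above h with <-cmp (Flagged.slopeOf w) (Flagged.slopeOf g)
        ... | tri> _ _ a = a
        ... | tri≈ _ e _ = ⊥-elim (crossing-slope-≢ cg (sym e))
        ... | tri< a _ _ = ⊥-elim (crossing-same-side d cf cg h a)

      x y : Occ k → Ln
      x o = occL o 0F
      y o = occL o 1F

      x≢y : ∀ o → proj₁ (home (x o)) ≢ proj₁ (home (y o))
      x≢y (i , 0F) ()
      x≢y (i , 1F) ()
      x≢y (i , 2F) ()

      x≢x : ∀ {o o'} → o ≢ o' → proj₁ (home (x o)) ≢ proj₁ (home (x o'))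
      x≢x {i , 0F} {i' , 0F} m refl = m refl
      x≢x {i , 1F} {i' , 1F} m refl = m refl
      x≢x {i , 2F} {i' , 2F} m refl = m refl
      x≢x {i , 0F} {i' , 1F} m ()
      x≢x {i , 0F} {i' , 2F} m ()
      x≢x {i , 1F} {i' , 0F} m ()
      x≢x {i , 1F} {i' , 2F} m ()
      x≢x {i , 2F} {i' , 0F} m ()
      x≢x {i , 2F} {i' , 1F} m ()

      occ≢con : ∀ o a {o'} (c : Connector o') s → proj₁ (home (occL o a)) ≢ proj₁ (home (conL o' c s))
      occ≢con (i , 0F) 0F c s ()
      occ≢con (i , 0F) 1F c s ()
      occ≢con (i , 1F) 0F c s ()
      occ≢con (i , 1F) 1F c s ()
      occ≢con (i , 2F) 0F c s ()
      occ≢con (i , 2F) 1F c s ()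

      Low : Occ k → Set
      Low o = lineSlope (x o) < lineSlope (y o)

      x-crosses-y : ∀ o → Crossing (lineFlag (x o)) (lineFlag (y o))
      x-crosses-y o = lines-crossing (x o) (y o) (x≢y o) (x×y givenModel o)

      module _ {o} (c : Connector o) where
        private
          u = conL o c left
          o' = next c
          crossing-swap : ∀ {f g} → Crossing f g → Crossing g f
          crossing-swap (crossing a b c d) = crossing (sw a) (sw c) (sw b) (sw d)
            where
            sw : ∀ {T T'} → Intersect T T' → Intersect T' T
            sw i e = i (disjoint-sym e)
          y×x : ∀ o → Crossing (lineFlag (y o)) (lineFlag (x o))
          y×x o = crossing-swap (x-crosses-y o)
          x×u = lines-crossing (x o) (u) (occ≢con o 0F c left) (x×con givenModel c left)
          x'×u = lines-crossing (x o') (u) (occ≢con o' 0F c left) (x'×con givenModel c left)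
          dyu = lines-disjoint (y o) (u) (occ≢con o 1F c left) (y≪con givenModel c left)
          duy' = lines-disjoint (u) (y o') (≢-sym (occ≢con o' 1F c left)) (con≪y givenModel c left)
          dxx' = lines-disjoint (x o) (x o') (x≢x λ e → ≺-irrefl (subst (o ≺_) (sym e) (≺-next c))) (≺-next c 0F 0F)

        -- Three same-side steps: `y o` and `u` both cross `x o`; then `x o` and `x o'` both cross
        -- `u`; then `u` and `y o'` both cross `x o'`.
        Low-up : Low o → Low (next c)
        Low-up h = SameSide.below duy' (crossing-swap x'×u) (y×x o')
          (SameSide.above dxx' x×u x'×u
            (SameSide.below dyu (y×x o) (crossing-swap x×u) h))

        Low-down : Low (next c) → Low o
        Low-down h = SameSide.below (disjoint-sym dyu) (crossing-swap x×u) (y×x o)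
          (SameSide.above (disjoint-sym dxx') x'×u x×u
            (SameSide.below (disjoint-sym duy') (y×x o') (crossing-swap x'×u) h))

      low-same : ∀ {o o'} → var φ o ≡ var φ o' → Low o → Low o'
      low-same = Chain.same-variable {Q = Low} Low-up Low-down

      -- The first, third and second occurrence compare the slopes of AB with CD, CD with EF and EF
      -- with AB, so equal answers close a cycle.
      low-cycle : ∀ i → ¬ ((∀ j → Low (i , j)) ⊎ (∀ j → ¬ Low (i , j)))
      low-cycle i (inj₁ f) = <-cycle (sl AB) (sl CD) (sl EF) (f 0F) (f 2F) (f 1F)
        where
        sl : Kind → ℚ
        sl κ = trapSlope (clauseT i κ)
      low-cycle i (inj₂ f) = <-cycle (sl CD) (sl AB) (sl EF) (high 0F) (high 1F) (high 2F)
        where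
        sl : Kind → ℚ
        sl κ = trapSlope (clauseT i κ)
        high : ∀ j → lineSlope (y (i , j)) < lineSlope (x (i , j))
        high j = ≮∧≢⇒> (lineSlope (x (i , j))) (lineSlope (y (i , j))) (f j) (crossing-slope-≢ (x-crosses-y (i , j)))

      naeSat : NAESat φ
      naeSat = assignment φ Low (λ o → lineSlope (x o) <? lineSlope (y o)) low-same low-cycle

  -- Parallelograms with natural endpoints

  fromℕ : ℕ → ℚ
  fromℕ zero    = 0ℚ
  fromℕ (suc n) = 1ℚ + fromℕ n

  fromℕ-+ : ∀ m n → fromℕ (m ℕ.+ n) ≡ fromℕ m + fromℕ n
  fromℕ-+ zero    n = sym (+-identityˡ (fromℕ n))
  fromℕ-+ (suc m) n = trans (cong (λ z → 1ℚ + z) (fromℕ-+ m n)) (sym (+-assoc 1ℚ (fromℕ m) (fromℕ n)))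

  fromℕ-nonneg : ∀ n → 0ℚ ≤ fromℕ n
  fromℕ-nonneg zero    = ≤-refl
  fromℕ-nonneg (suc n) = +-mono-≤ (nonNegative⁻¹ 1ℚ) (fromℕ-nonneg n)

  fromℕ-pos : ∀ n → 0ℚ < fromℕ (suc n)
  fromℕ-pos n = +-mono-<-≤ (positive⁻¹ 1ℚ) (fromℕ-nonneg n)

  fromℕ-mono-≤ : ∀ {m n} → m ℕ.≤ n → fromℕ m ≤ fromℕ n
  fromℕ-mono-≤ {n = n} z≤n = fromℕ-nonneg n
  fromℕ-mono-≤ (s≤s h) = +-monoʳ-≤ 1ℚ (fromℕ-mono-≤ h)

  fromℕ-mono-< : ∀ {m n} → m ℕ.< n → fromℕ m < fromℕ n
  fromℕ-mono-< {n = suc n} (s≤s z≤n) = fromℕ-pos n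
  fromℕ-mono-< (s≤s h@(s≤s _)) = +-monoʳ-< 1ℚ (fromℕ-mono-< h)

  fromℕ-cancel-< : ∀ {m n} → fromℕ m < fromℕ n → m ℕ.< n
  fromℕ-cancel-< {m} {n} h with m ℕ.<? n
  ... | yes p = p
  ... | no ¬p = ⊥-elim (<-irrefl refl (<-≤-trans h (fromℕ-mono-≤ (ℕₚ.≮⇒≥ ¬p))))

  bounded : ∀ {N} (f : Fin N → ℕ) → ∃ λ K → ∀ i → f i ℕ.≤ K
  bounded {zero} f = 0 , λ ()
  bounded {suc N} f with bounded (f ∘ suc)
  ... | K , h = f zero ℕ.⊔ K , λ { zero → ℕₚ.m≤m⊔n _ K ; (suc i) → ℕₚ.≤-trans (h i) (ℕₚ.m≤n⊔m (f zero) K) }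

  -- A line with natural endpoints (on L1, on L2).
  NLine : Set
  NLine = ℕ × ℕ

  infix 4 _≪ⁿ_
  _≪ⁿ_ : NLine → NLine → Set
  (a , b) ≪ⁿ (c , d) = (a ℕ.< c) × (b ℕ.< d)

  record NParallelogram (p q : NLine) : Set where
    constructor npar
    field
      top-≤    : proj₁ p ℕ.≤ proj₁ q
      parallelⁿ : proj₁ p ℕ.+ proj₂ q ≡ proj₁ q ℕ.+ proj₂ p

  -- Translating the points of L2 far to the right makes all tolerances t = bot − top positive.
  module _ {N : ℕ} {E : Fin N → Fin N → Set} (p q : Fin N → NLine)
    (pq : ∀ i → NParallelogram (p i) (q i))
    (E⇒ : ∀ i j → i ≢ j → E i j → ¬ ((q i ≪ⁿ p j) ⊎ (q j ≪ⁿ p i)))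
    (⇒E : ∀ i j → i ≢ j → ¬ ((q i ≪ⁿ p j) ⊎ (q j ≪ⁿ p i)) → E i j) where

    private
      K : ℕ
      K = suc (proj₁ (bounded (λ i → proj₁ (p i))))
      top<K : ∀ i → proj₁ (p i) ℕ.< K
      top<K i = s≤s (proj₂ (bounded (λ i → proj₁ (p i))) i)

      low : Fin N → ℕ
      low i = proj₂ (p i) ℕ.+ K
      high : Fin N → ℕ
      high i = proj₂ (q i) ℕ.+ K
      tol : Fin N → ℕ
      tol i = low i ℕ.∸ proj₁ (p i)

      top<low : ∀ i → proj₁ (p i) ℕ.< low i
      top<low i = ℕₚ.<-≤-trans (top<K i) (ℕₚ.m≤n+m K (proj₂ (p i)))

      left-eq : ∀ i → proj₁ (p i) ℕ.+ tol i ≡ low i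
      left-eq i = ℕₚ.m+[n∸m]≡n (ℕₚ.<⇒≤ (top<low i))

      -- By parallelism, the tolerance computed at the left line is also the one of the right line.
      right-eq : ∀ i → proj₁ (q i) ℕ.+ tol i ≡ high i
      right-eq i = ℕₚ.+-cancelˡ-≡ (proj₁ (p i)) _ _ (begin
        a ℕ.+ (c ℕ.+ tol i)   ≡⟨ ℕₚ.+-comm a (c ℕ.+ tol i) ⟩
        (c ℕ.+ tol i) ℕ.+ a   ≡⟨ ℕₚ.+-assoc c (tol i) a ⟩
        c ℕ.+ (tol i ℕ.+ a)   ≡⟨ cong (c ℕ.+_) (trans (ℕₚ.+-comm (tol i) a) (left-eq i)) ⟩
        c ℕ.+ (b ℕ.+ K)       ≡⟨ ℕₚ.+-assoc c b K ⟨
        (c ℕ.+ b) ℕ.+ K       ≡⟨ cong (ℕ._+ K) (NParallelogram.parallelⁿ (pq i)) ⟨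
        (a ℕ.+ d) ℕ.+ K       ≡⟨ ℕₚ.+-assoc a d K ⟩
        a ℕ.+ (d ℕ.+ K)       ∎)
        where
        open ≡-Reasoning
        a = proj₁ (p i)
        b = proj₂ (p i)
        c = proj₁ (q i)
        d = proj₂ (q i)

      0<tol : ∀ i → 0 ℕ.< tol i
      0<tol i = ℕₚ.m<n⇒0<n∸m (top<low i)

      low≤high : ∀ i → low i ℕ.≤ high i
      low≤high i = subst₂ ℕ._≤_ (left-eq i) (right-eq i) (ℕₚ.+-monoˡ-≤ (tol i) (NParallelogram.top-≤ (pq i)))

      l r t : Fin N → ℚ
      l i = fromℕ (proj₁ (p i))
      r i = fromℕ (high i)
      t i = fromℕ (tol i)

      leftLine : ∀ i → proj₁ (parallelogram (l i) (r i) (t i)) ≡ line (fromℕ (proj₁ (p i))) (fromℕ (low i))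
      leftLine i = cong (line (l i)) (trans (sym (fromℕ-+ (proj₁ (p i)) (tol i))) (cong fromℕ (left-eq i)))

      rightLine : ∀ i → proj₂ (parallelogram (l i) (r i) (t i)) ≡ line (fromℕ (proj₁ (q i))) (fromℕ (high i))
      rightLine i = cong (λ z → line z (r i)) (begin
        fromℕ (high i) - t i                    ≡⟨ cong (λ z → fromℕ z - t i) (sym (right-eq i)) ⟩
        fromℕ (proj₁ (q i) ℕ.+ tol i) - t i     ≡⟨ cong (_- t i) (fromℕ-+ (proj₁ (q i)) (tol i)) ⟩
        (fromℕ (proj₁ (q i)) + t i) - t i       ≡⟨ solve 2 (λ x y → (x :+ y) :- y := x) refl (fromℕ (proj₁ (q i))) (t i) ⟩
        fromℕ (proj₁ (q i))                     ∎)
        where open ≡-Reasoning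

      T : Fin N → Trap
      T i = parallelogram (l i) (r i) (t i)

      from-≪ : ∀ i j → T i ◁ T j → q i ≪ⁿ p j
      from-≪ i j h = fromℕ-cancel-< (proj₁ h') , ℕₚ.+-cancelʳ-< K (proj₂ (q i)) (proj₂ (p j)) (fromℕ-cancel-< (proj₂ h'))
        where
        h' : line (fromℕ (proj₁ (q i))) (fromℕ (high i)) ≪ line (fromℕ (proj₁ (p j))) (fromℕ (low j))
        h' = subst₂ _≪_ (rightLine i) (leftLine j) h

      to-≪ : ∀ i j → q i ≪ⁿ p j → T i ◁ T j
      to-≪ i j (a , b) = subst₂ _≪_ (sym (rightLine i)) (sym (leftLine j))
        (fromℕ-mono-< a , fromℕ-mono-< (ℕₚ.+-monoˡ-< K b))

      t≤r-l : ∀ i → t i ≤ r i - l i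
      t≤r-l i = ≤-by (solve 3 (λ l r t → r :- (l :+ t) := (r :- l) :- t) refl (l i) (r i) (t i))
        (subst (_≤ r i) (sym (cong bot (leftLine i))) (fromℕ-mono-≤ (low≤high i)))

      0<t : ∀ i → 0ℚ < t i
      0<t i = fromℕ-mono-< (0<tol i)

    parallelograms⇒boundedTolerance : IsBoundedTolerance N E
    parallelograms⇒boundedTolerance = l , r , t
      , (λ i → ≤-by (solve 2 (λ l r → (r :- l) :- constant 0ℚ := r :- l) refl (l i) (r i)) (≤-trans (<⇒≤ (0<t i)) (t≤r-l i)))
      , 0<t , t≤r-l
      , λ i j i≢j →
          (λ e → intersect⇒tolerant (l i) (r i) (t i) (l j) (r j) (t j) (t≤r-l i) (t≤r-l j)
            (E⇒ i j i≢j e ∘ Sum.map (from-≪ i j) (from-≪ j i)))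
        , (λ h → ⇒E i j i≢j (tolerant⇒intersect (l i) (r i) (t i) (l j) (r j) (t j) (0<t i) (0<t j) h
            ∘ Sum.map (to-≪ i j) (to-≪ j i)))

open RationalGeometry

module NaturalRepresentation where

  open import Data.Nat using (_+_; _*_; _<_; _≤_; _≤?_; _<?_)
  open import Data.Nat.Properties
  open import Data.Nat.Solver using (module +-*-Solver)
  open +-*-Solver using (solve; _:+_; _:*_; _:=_) renaming (con to constant)

  -- Slopes of the three pairs of a clause

  -- The place of a pair's slope among the three of its clause. For mixed truth values, AB is below
  -- CD, EF below AB and CD below EF exactly when the first, second and third value, respectively,
  -- is true.
  levelOf : Bool → Bool → Bool → Kind → Fin 3
  levelOf true  true  _     EF = 0F
  levelOf true  true  _     AB = 1F
  levelOf true  true  _     CD = 2F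
  levelOf true  false true  AB = 0F
  levelOf true  false true  CD = 1F
  levelOf true  false true  EF = 2F
  levelOf false true  true  CD = 0F
  levelOf false true  true  EF = 1F
  levelOf false true  true  AB = 2F
  levelOf true  false false AB = 0F
  levelOf true  false false EF = 1F
  levelOf true  false false CD = 2F
  levelOf false true  false EF = 0F
  levelOf false true  false CD = 1F
  levelOf false true  false AB = 2F
  levelOf false false _     CD = 0F
  levelOf false false _     AB = 1F
  levelOf false false _     EF = 2F

  Ordered : Bool → Fin 3 → Fin 3 → Set
  Ordered true  a b = a <ᶠ b
  Ordered false a b = b <ᶠ a

  -- The cyclic constraints of a clause are solvable unless its three truth values agree.
  levelOf-ordered : ∀ b₀ b₁ b₂ → ¬ (b₀ ≡ b₁ × b₁ ≡ b₂) → let l = levelOf b₀ b₁ b₂ in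
    Ordered b₀ (l AB) (l CD) × Ordered b₁ (l EF) (l AB) × Ordered b₂ (l CD) (l EF)
  levelOf-ordered true  true  true  n = ⊥-elim (n (refl , refl))
  levelOf-ordered false false false n = ⊥-elim (n (refl , refl))
  levelOf-ordered true  true  false _ = from-yes (1 <? 2) , from-yes (0 <? 1) , from-yes (0 <? 2)
  levelOf-ordered true  false true  _ = from-yes (0 <? 1) , from-yes (0 <? 2) , from-yes (1 <? 2)
  levelOf-ordered false true  true  _ = from-yes (0 <? 2) , from-yes (1 <? 2) , from-yes (0 <? 1)
  levelOf-ordered true  false false _ = from-yes (0 <? 2) , from-yes (0 <? 1) , from-yes (1 <? 2)
  levelOf-ordered false true  false _ = from-yes (1 <? 2) , from-yes (0 <? 2) , from-yes (0 <? 1)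
  levelOf-ordered false false true  _ = from-yes (0 <? 1) , from-yes (1 <? 2) , from-yes (0 <? 2)

  kindOf : Fin 3 → Fin 2 → Kind
  kindOf 0F 0F = AB
  kindOf 0F 1F = CD
  kindOf 1F 0F = EF
  kindOf 1F 1F = AB
  kindOf 2F 0F = CD
  kindOf 2F 1F = EF

  -- Positions of the endpoints within the block of an occurrence: tops and bottoms of the occurrence lines
  -- of a given level, and tops and bottoms of connecting lines just above the given level.
  topDigit botDigit conTopDigit conBotDigit : Fin 3 → ℕ
  topDigit 0F = 10
  topDigit 1F = 14
  topDigit 2F = 18
  botDigit 0F = 18
  botDigit 1F = 14
  botDigit 2F = 10
  conTopDigit 0F = 11
  conTopDigit 1F = 15
  conTopDigit 2F = 19
  conBotDigit 0F = 15
  conBotDigit 1F = 11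
  conBotDigit 2F = 7

  sideDigit : Side → ℕ
  sideDigit left  = 0
  sideDigit right = 2

  -- Tops grow and bottoms shrink with the level, so the two lines of an occurrence cross. Digits of
  -- consecutive levels are 4 apart, which leaves room for both connecting lines, at distances 1 and
  -- 3.
  record Digits (i j : Fin 3) (s : Side) : Set where
    constructor mkDigits
    field
      td<ct : topDigit i < conTopDigit i + sideDigit s
      ct<td : conTopDigit i + sideDigit s < topDigit j
      bd<cb : botDigit j < conBotDigit i + sideDigit s
      cb<bd : conBotDigit i + sideDigit s < botDigit i

  digits? : ∀ i j s → Dec (Digits i j s)
  digits? i j s = map′ (λ { (a , b , c , d) → mkDigits a b c d }) (λ { (mkDigits a b c d) → a , b , c , d })
    ((_ <? _) ×-dec (_ <? _) ×-dec (_ <? _) ×-dec (_ <? _))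

  digits : ∀ i j → i <ᶠ j → ∀ s → Digits i j s
  digits 0F 1F _ left  = from-yes (digits? 0F 1F left)
  digits 0F 1F _ right = from-yes (digits? 0F 1F right)
  digits 0F 2F _ left  = from-yes (digits? 0F 2F left)
  digits 0F 2F _ right = from-yes (digits? 0F 2F right)
  digits 1F 2F _ left  = from-yes (digits? 1F 2F left)
  digits 1F 2F _ right = from-yes (digits? 1F 2F right)
  digits 1F 1F (s≤s ()) _
  digits 2F 1F (s≤s ()) _
  digits 2F 2F (s≤s (s≤s ())) _

  -- 32 is half the block width 64: doubled digits, which occur in sums for halfway lines, still fit
  -- into a block.
  record DigitBound (i : Fin 3) (s : Side) : Set where
    constructor mkBound
    field
      top<32    : topDigit i < 32
      bot<32    : botDigit i < 32
      conTop<32 : conTopDigit i + sideDigit s < 32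
      conBot<32 : conBotDigit i + sideDigit s < 32

  digitBound? : ∀ i s → Dec (DigitBound i s)
  digitBound? i s = map′ (λ { (a , b , c , d) → mkBound a b c d }) (λ { (mkBound a b c d) → a , b , c , d })
    ((_ <? _) ×-dec (_ <? _) ×-dec (_ <? _) ×-dec (_ <? _))

  digitBound : ∀ i s → DigitBound i s
  digitBound 0F left  = from-yes (digitBound? 0F left)
  digitBound 0F right = from-yes (digitBound? 0F right)
  digitBound 1F left  = from-yes (digitBound? 1F left)
  digitBound 1F right = from-yes (digitBound? 1F right)
  digitBound 2F left  = from-yes (digitBound? 2F left)
  digitBound 2F right = from-yes (digitBound? 2F right)

  -- Arithmetic of blocks and halfway points

  lex-< : ∀ {a a' d d'} B → a < a' → d < B → a * B + d < a' * B + d'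
  lex-< {a} {a'} {d} {d'} B h k = begin-strict
    a * B + d    <⟨ +-monoʳ-< (a * B) k ⟩
    a * B + B    ≡⟨ +-comm (a * B) B ⟩
    suc a * B    ≤⟨ *-monoˡ-≤ B h ⟩
    a' * B       ≤⟨ m≤m+n (a' * B) d' ⟩
    a' * B + d'  ∎
    where open ≤-Reasoning

  double-< : ∀ {d} → d < 32 → d + d < 64
  double-< {d} h = +-mono-< h h

  -- The point halfway between equal digits of blocks `r < r'` comes before the start of block `r'`,
  -- because `d + d < 64`.
  midblock-before : ∀ {r r' m d d'} → r < r' → r' ≤ m → d < 32 →
    (r * 64 + d) + (r' * 64 + d) < (m * 64 + d') + (m * 64 + d')
  midblock-before {r} {r'} {m} {d} {d'} h h' k = begin-strict
    (r * 64 + d) + (r' * 64 + d)   ≡⟨ solve 3 (λ x y d → (x :+ d) :+ (y :+ d) := (x :+ (d :+ d)) :+ y) refl (r * 64) (r' * 64) d ⟩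
    (r * 64 + (d + d)) + r' * 64   <⟨ +-monoˡ-< (r' * 64) (lex-< {r} {r'} {d + d} {0} 64 h (double-< k)) ⟩
    (r' * 64 + 0) + r' * 64        ≤⟨ +-mono-≤ (+-mono-≤ r'≤m z≤n) (≤-trans r'≤m (m≤m+n (m * 64) d')) ⟩
    (m * 64 + d') + (m * 64 + d')  ∎
    where
    open ≤-Reasoning
    r'≤m : r' * 64 ≤ m * 64
    r'≤m = *-monoˡ-≤ 64 h'

  midblock-after : ∀ {r r' m d d'} → r < r' → m ≤ r → d' < 32 →
    (m * 64 + d') + (m * 64 + d') < (r * 64 + d) + (r' * 64 + d)
  midblock-after {r} {r'} {m} {d} {d'} h h' k = begin-strict
    (m * 64 + d') + (m * 64 + d')  ≡⟨ solve 2 (λ x d → (x :+ d) :+ (x :+ d) := x :+ (x :+ (d :+ d))) refl (m * 64) d' ⟩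
    m * 64 + (m * 64 + (d' + d'))  <⟨ +-mono-≤-< (≤-trans (*-monoˡ-≤ 64 h') (m≤m+n (r * 64) d)) (lex-< {m} {r'} {d' + d'} {d} 64 (≤-<-trans h' h) (double-< k)) ⟩
    (r * 64 + d) + (r' * 64 + d)   ∎
    where open ≤-Reasoning

  -- Coordinates are refined by 16 to make room for offsets, an unshifted line being at offset 8;
  -- `(a + b) * 8 + 8` is halfway between the lines at `a` and `b`.
  mid-before : ∀ {a b w e} → a + b < w + w → 1 ≤ e → (a + b) * 8 + 8 < w * 16 + e
  mid-before {a} {b} {w} {e} h k = begin-strict
    (a + b) * 8 + 8     ≡⟨ +-comm ((a + b) * 8) 8 ⟩
    suc (a + b) * 8     ≤⟨ *-monoˡ-≤ 8 h ⟩
    (w + w) * 8         ≡⟨ solve 1 (λ w → (w :+ w) :* constant 8 := w :* constant 16) refl w ⟩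
    w * 16              <⟨ m<m+n (w * 16) k ⟩
    w * 16 + e          ∎
    where open ≤-Reasoning

  mid-after : ∀ {a b w e} → w + w < a + b → e ≤ 15 → w * 16 + e < (a + b) * 8 + 8
  mid-after {a} {b} {w} {e} h k = begin-strict
    w * 16 + e          <⟨ +-monoʳ-< (w * 16) (s≤s k) ⟩
    w * 16 + 16         ≡⟨ solve 1 (λ w → w :* constant 16 :+ constant 16 := (constant 1 :+ (w :+ w)) :* constant 8 :+ constant 8) refl w ⟩
    suc (w + w) * 8 + 8 ≤⟨ +-monoˡ-≤ 8 (*-monoˡ-≤ 8 h) ⟩
    (a + b) * 8 + 8     ∎
    where open ≤-Reasoning

  -- The model of R_P belonging to an assignment

  module Realisation {n k : ℕ} (φ : Formula n k) (inc : Increasing φ) (R : RP k) (V : ValidRP φ R)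
    (sat : NAESat φ) where

    open ValidRP V
    open Geometry φ R V
    open Model
    open Construction φ inc R V
    open Relations φ inc R V

    value : Occ k → Bool
    value o = proj₁ sat (var φ o)

    clauseLevel : Fin k → Kind → Fin 3
    clauseLevel i = levelOf (value (i , 0F)) (value (i , 1F)) (value (i , 2F))

    -- The level belongs to the pair containing the line, so both lines of a pair get the same
    -- digits and become parallel.
    level : Occ k → Fin 2 → Fin 3
    level (i , j) a = clauseLevel i (kindOf j a)

    private
      not-all-equal : ∀ i → ¬ (value (i , 0F) ≡ value (i , 1F) × value (i , 1F) ≡ value (i , 2F))
      not-all-equal i (e , e') with proj₂ sat i
      ... | (j , t) , (j' , f) = true≢false (trans (sym t) (trans (at j) (trans (sym (at j')) f)))
        where
        true≢false : true ≢ false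
        true≢false ()
        at : ∀ j → value (i , j) ≡ value (i , 0F)
        at 0F = refl
        at 1F = sym e
        at 2F = sym (trans e e')

    level-ordered : ∀ o → Ordered (value o) (level o 0F) (level o 1F)
    level-ordered (i , 0F) = proj₁ (levelOf-ordered _ _ _ (not-all-equal i))
    level-ordered (i , 1F) = proj₁ (proj₂ (levelOf-ordered _ _ _ (not-all-equal i)))
    level-ordered (i , 2F) = proj₂ (proj₂ (levelOf-ordered _ _ _ (not-all-equal i)))

    level-ordered-next : ∀ {o} (c : Connector o) → Ordered (value o) (level (next c) 0F) (level (next c) 1F)
    level-ordered-next {o} c = subst (λ b → Ordered b (level (next c) 0F) (level (next c) 1F))
      (cong (proj₁ sat) (sym (proj₁ (next-succ c)))) (level-ordered (next c))

    at : Occ k → ℕ → ℕ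
    at o d = rank o * 64 + d

    -- For the value true, ℓ¹ has a lower level than ℓ² at both occurrences. The endpoint on L2 is
    -- then put into block `o`, between those of ℓ² and ℓ¹, and the endpoint on L1 into block `o'`,
    -- between those of ℓ¹ and ℓ². For false, L1 and L2 exchange roles.
    conTop conBot : Bool → Occ k → Occ k → Side → ℕ
    conTop true  o o' s = at o' (conTopDigit (level o' 0F) + sideDigit s)
    conTop false o o' s = at o  (conTopDigit (level o 1F) + sideDigit s)
    conBot true  o o' s = at o  (conBotDigit (level o 0F) + sideDigit s)
    conBot false o o' s = at o' (conBotDigit (level o' 1F) + sideDigit s)

    newTop newBot : Ln → ℕ
    newTop (occL o a)   = at o (topDigit (level o a))
    newTop (conL o c s) = conTop (value o) o (next c) s
    newBot (occL o a)   = at o (botDigit (level o a))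
    newBot (conL o c s) = conBot (value o) o (next c) s

    topB : ∀ l → topDigit l < 32
    topB l = DigitBound.top<32 (digitBound l left)
    botB : ∀ l → botDigit l < 32
    botB l = DigitBound.bot<32 (digitBound l left)
    conTopB : ∀ l s → conTopDigit l + sideDigit s < 32
    conTopB l s = DigitBound.conTop<32 (digitBound l s)
    conBotB : ∀ l s → conBotDigit l + sideDigit s < 32
    conBotB l s = DigitBound.conBot<32 (digitBound l s)

    private
      small : ∀ {d} → d < 32 → d < 64
      small h = <-trans h (from-yes (32 <? 64))

      blocks : ∀ {o o' d d'} → o ≺ o' → d < 32 → at o d < at o' d'
      blocks {o} {o'} {d} {d'} h k = lex-< {rank o} {rank o'} {d} {d'} 64 (rank-mono h) (small k)

      within : ∀ o {d d'} → d < d' → at o d < at o d'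
      within o = +-monoʳ-< (rank o * 64)

      NewCrossed : ℕ → ℕ → ℕ → ℕ → Set
      NewCrossed t b t' b' = (t < t' × b' < b) ⊎ (t' < t × b < b')

      module Conn (o o' : Occ k) (h : o ≺ o') where
        open Digits
        T B : Occ k → Fin 2 → ℕ
        T o a = at o (topDigit (level o a))
        B o a = at o (botDigit (level o a))

        y≪c : ∀ b → Ordered b (level o 0F) (level o 1F) → ∀ s → T o 1F < conTop b o o' s × B o 1F < conBot b o o' s
        y≪c true  w s = blocks h (topB _) , within o (bd<cb (digits _ _ w s))
        y≪c false w s = within o (td<ct (digits _ _ w s)) , blocks h (botB _)

        c≪y : ∀ b → Ordered b (level o' 0F) (level o' 1F) → ∀ s → conTop b o o' s < T o' 1F × conBot b o o' s < B o' 1F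
        c≪y true  w s = within o' (ct<td (digits _ _ w s)) , blocks h (conBotB _ s)
        c≪y false w s = blocks h (conTopB _ s) , within o' (cb<bd (digits _ _ w s))

        x×c : ∀ b → Ordered b (level o 0F) (level o 1F) → ∀ s → NewCrossed (T o 0F) (B o 0F) (conTop b o o' s) (conBot b o o' s)
        x×c true  w s = inj₁ (blocks h (topB _) , within o (cb<bd (digits _ _ w s)))
        x×c false w s = inj₂ (within o (ct<td (digits _ _ w s)) , blocks h (botB _))

        x'×c : ∀ b → Ordered b (level o' 0F) (level o' 1F) → ∀ s → NewCrossed (T o' 0F) (B o' 0F) (conTop b o o' s) (conBot b o o' s)
        x'×c true  w s = inj₁ (within o' (td<ct (digits _ _ w s)) , blocks h (conBotB _ s))
        x'×c false w s = inj₂ (blocks h (conTopB _ s) , within o' (bd<cb (digits _ _ w s)))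

        c≪c : ∀ b → conTop b o o' left < conTop b o o' right × conBot b o o' left < conBot b o o' right
        c≪c true  = within o' (+-monoʳ-< _ (from-yes (0 <? 2))) , within o (+-monoʳ-< _ (from-yes (0 <? 2)))
        c≪c false = within o (+-monoʳ-< _ (from-yes (0 <? 2))) , within o' (+-monoʳ-< _ (from-yes (0 <? 2)))

        c∥c : ∀ b → conTop b o o' left + conBot b o o' right ≡ conTop b o o' right + conBot b o o' left
        c∥c true  = solve 4 (λ r r' x y → (r' :+ (x :+ constant 0)) :+ (r :+ (y :+ constant 2)) := (r' :+ (x :+ constant 2)) :+ (r :+ (y :+ constant 0)))
          refl (rank o * 64) (rank o' * 64) (conTopDigit (level o' 0F)) (conBotDigit (level o 0F))
        c∥c false = solve 4 (λ r r' x y → (r :+ (x :+ constant 0)) :+ (r' :+ (y :+ constant 2)) := (r :+ (x :+ constant 2)) :+ (r' :+ (y :+ constant 0)))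
          refl (rank o * 64) (rank o' * 64) (conTopDigit (level o 1F)) (conBotDigit (level o' 1F))

      occ-crossed : ∀ o b → Ordered b (level o 0F) (level o 1F) →
        NewCrossed (newTop (occL o 0F)) (newBot (occL o 0F)) (newTop (occL o 1F)) (newBot (occL o 1F))
      occ-crossed o true  w = inj₁ (within o (<-trans (td<ct D) (ct<td D)) , within o (<-trans (bd<cb D) (cb<bd D)))
        where
        open Digits
        D = digits _ _ w left
      occ-crossed o false w = inj₂ (within o (<-trans (td<ct D) (ct<td D)) , within o (<-trans (bd<cb D) (cb<bd D)))
        where
        open Digits
        D = digits _ _ w left

    newModel : Model
    newModel = record
      { Coord = ℕ ; _<ᵐ_ = _<_ ; transᵐ = <-trans ; topᵐ = newTop ; botᵐ = newBot
      ; occ≪occ = λ h a b → blocks h (topB _) , blocks h (botB _)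
      ; y≪con = λ {o} c → Conn.y≪c o (next c) (≺-next c) (value o) (level-ordered o)
      ; con≪y = λ {o} c → Conn.c≪y o (next c) (≺-next c) (value o) (level-ordered-next c)
      ; con≪con = λ {o} c → Conn.c≪c o (next c) (≺-next c) (value o)
      ; x×y = λ o → occ-crossed o (value o) (level-ordered o)
      ; x×con = λ {o} c → Conn.x×c o (next c) (≺-next c) (value o) (level-ordered o)
      ; x'×con = λ {o} c → Conn.x'×c o (next c) (≺-next c) (value o) (level-ordered-next c)
      }

    -- Which endpoint of a connecting line lies in which of its two blocks depends on the truth
    -- value; the halfway estimates only need that each lies in one of them.
    data InBlock (o o' : Occ k) : ℕ → Set where
      inBlock : ∀ {m d} → m ≡ o ⊎ m ≡ o' → d < 32 → InBlock o o' (at m d)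

    conTop-block : ∀ b o o' s → InBlock o o' (conTop b o o' s)
    conTop-block true  o o' s = inBlock (inj₂ refl) (conTopB _ s)
    conTop-block false o o' s = inBlock (inj₁ refl) (conTopB _ s)

    conBot-block : ∀ b o o' s → InBlock o o' (conBot b o o' s)
    conBot-block true  o o' s = inBlock (inj₁ refl) (conBotB _ s)
    conBot-block false o o' s = inBlock (inj₂ refl) (conBotB _ s)

    occTop-block : ∀ o a → InBlock o o (newTop (occL o a))
    occTop-block o a = inBlock (inj₁ refl) (topB _)

    occBot-block : ∀ o a → InBlock o o (newBot (occL o a))
    occBot-block o a = inBlock (inj₁ refl) (botB _)

    infix 4 _⊏_
    _⊏_ : Ln → Ln → Set
    _⊏_ = LeftOfᵐ newModel

    private
      occ-parallel : ∀ o o' l → at o (topDigit l) + at o' (botDigit l) ≡ at o' (topDigit l) + at o (botDigit l)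
      occ-parallel o o' l = solve 4 (λ r r' x y → (r :+ x) :+ (r' :+ y) := (r' :+ x) :+ (r :+ y))
        refl (rank o * 64) (rank o' * 64) (topDigit l) (botDigit l)

    new-parallel : ∀ t → newTop (boundary t left) + newBot (boundary t right)
                       ≡ newTop (boundary t right) + newBot (boundary t left)
    new-parallel (clauseT i AB) = occ-parallel (i , 0F) (i , 1F) (clauseLevel i AB)
    new-parallel (clauseT i CD) = occ-parallel (i , 0F) (i , 2F) (clauseLevel i CD)
    new-parallel (clauseT i EF) = occ-parallel (i , 1F) (i , 2F) (clauseLevel i EF)
    new-parallel (conT o c) = Conn.c∥c o (next c) (≺-next c) (value o)

  data Agree (A B : Set) : Set where
    both    : A → B → Agree A B
    neither : ¬ A → ¬ B → Agree A B

  -- `halfR` isolates the right edge of T_{u,1}, the only right edge that may have to be moved; the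
  -- other constructors keep just the bounds used in comparisons. `halfL` does the same for T_{u,4}
  -- among the left edges.
  data RightEdge : Side → ℕ → Set where
    halfR  : RightEdge left 12
    outerR : ∀ {e} → 1 ≤ e → e ≤ 6 → RightEdge left e
    farR   : ∀ {e} → 8 ≤ e → e ≤ 15 → RightEdge right e

  data LeftEdge : Side → ℕ → Set where
    halfL  : LeftEdge right 4
    outerL : ∀ {e} → 10 ≤ e → e ≤ 15 → LeftEdge right e
    farL   : ∀ {e} → 1 ≤ e → e ≤ 8 → LeftEdge left e

  rightEdge-view : ∀ v → RightEdge (proj₁ (rightEdge v)) (proj₂ (rightEdge v))
  rightEdge-view 0F = farR (from-yes (8 ≤? 8)) (from-yes (8 ≤? 15))
  rightEdge-view 1F = halfR
  rightEdge-view 2F = outerR (from-yes (1 ≤? 6)) (from-yes (6 ≤? 6))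
  rightEdge-view 3F = outerR (from-yes (1 ≤? 5)) (from-yes (5 ≤? 6))
  rightEdge-view 4F = farR (from-yes (8 ≤? 12)) (from-yes (12 ≤? 15))
  rightEdge-view 5F = farR (from-yes (8 ≤? 14)) (from-yes (14 ≤? 15))
  rightEdge-view 6F = farR (from-yes (8 ≤? 15)) (from-yes (15 ≤? 15))

  leftEdge-view : ∀ v → LeftEdge (proj₁ (leftEdge v)) (proj₂ (leftEdge v))
  leftEdge-view 0F = farL (from-yes (1 ≤? 8)) (from-yes (8 ≤? 8))
  leftEdge-view 1F = farL (from-yes (1 ≤? 4)) (from-yes (4 ≤? 8))
  leftEdge-view 2F = farL (from-yes (1 ≤? 2)) (from-yes (2 ≤? 8))
  leftEdge-view 3F = farL (from-yes (1 ≤? 1)) (from-yes (1 ≤? 8))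
  leftEdge-view 4F = halfL
  leftEdge-view 5F = outerL (from-yes (10 ≤? 10)) (from-yes (10 ≤? 15))
  leftEdge-view 6F = outerL (from-yes (10 ≤? 11)) (from-yes (11 ≤? 15))

  rightRange : ∀ {s e} → RightEdge s e → InRange e
  rightRange halfR        = from-yes (1 ≤? 12) , from-yes (12 ≤? 15)
  rightRange (outerR h k) = h , ≤-trans k (from-yes (6 ≤? 15))
  rightRange (farR h k)   = ≤-trans (from-yes (1 ≤? 8)) h , k

  leftRange : ∀ {s e} → LeftEdge s e → InRange e
  leftRange halfL        = from-yes (1 ≤? 4) , from-yes (4 ≤? 15)
  leftRange (outerL h k) = ≤-trans (from-yes (1 ≤? 10)) h , k
  leftRange (farL h k)   = h , ≤-trans k (from-yes (8 ≤? 15))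

  -- Lines around a pair with nothing in between

  module Agreement {n k : ℕ} (φ : Formula n k) (inc : Increasing φ) (R : RP k) (V : ValidRP φ R)
    (sat : NAESat φ) where

    open ValidRP V
    open Geometry φ R V
    open Model
    open Construction φ inc R V
    open Relations φ inc R V
    open Realisation φ inc R V sat

    ⊏-asym : ∀ {p q} → p ⊏ q → ¬ (q ⊏ p)
    ⊏-asym (a , _) (b , _) = <-asym a b

    ⊏-trans : ∀ {p q r} → p ⊏ q → q ⊏ r → p ⊏ r
    ⊏-trans {p} {q} {r} = ≪ᵐ-trans newModel {p} {q} {r}

    crossed-¬⊏ : ∀ {p q} → Crossedᵐ newModel p q → ¬ (p ⊏ q)
    crossed-¬⊏ (inj₁ (_ , b)) (_ , d) = <-asym b d
    crossed-¬⊏ (inj₂ (a , _)) (c , _) = <-asym a c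

    occ-¬⊏ : ∀ o a b → ¬ (occL o a ⊏ occL o b)
    occ-¬⊏ o 0F 0F (h , _) = <-irrefl refl h
    occ-¬⊏ o 1F 1F (h , _) = <-irrefl refl h
    occ-¬⊏ o 0F 1F h = crossed-¬⊏ {occL o 0F} {occL o 1F} (x×y newModel o) h
    occ-¬⊏ o 1F 0F h = crossed-¬⊏ {occL o 1F} {occL o 0F} (Crossedᵐ-sym newModel {occL o 0F} {occL o 1F} (x×y newModel o)) h

    infix 4 _≼_
    _≼_ : Occ k → Occ k → Set
    o ≼ o' = o ≡ o' ⊎ o ≺ o'

    ≼-or-≻ : ∀ o o' → (o ≼ o') ⊎ (o' ≺ o)
    ≼-or-≻ o o' with o ≟ᵒ o'
    ... | yes e = inj₁ (inj₁ e)
    ... | no m with ≺-total m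
    ...   | inj₁ h = inj₁ (inj₂ h)
    ...   | inj₂ h = inj₂ h

    rank-≤ : ∀ {o o'} → o ≼ o' → rank o ≤ rank o'
    rank-≤ (inj₁ refl) = ≤-refl
    rank-≤ (inj₂ h)    = <⇒≤ (rank-mono h)

    ≼-≺ : ∀ {o o' o''} → o ≼ o' → o' ≺ o'' → o ≺ o''
    ≼-≺ (inj₁ refl) h = h
    ≼-≺ (inj₂ g)    h = ≺-trans g h

    ≺-≼ : ∀ {o o' o''} → o ≺ o' → o' ≼ o'' → o ≺ o''
    ≺-≼ h (inj₁ refl) = h
    ≺-≼ h (inj₂ g)    = ≺-trans h g

    -- w lies beyond (before) the line halfway between p and q, doubled to avoid fractions.
    Beyond Before : Ln → Ln → Ln → Set
    Beyond p q w = (newTop p + newTop q < newTop w + newTop w) × (newBot p + newBot q < newBot w + newBot w)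
    Before p q w = (newTop w + newTop w < newTop p + newTop q) × (newBot w + newBot w < newBot p + newBot q)

    private
      block-beyond : ∀ {oL oR o o' d x} → oL ≺ oR → oR ≼ o → oR ≼ o' → d < 32 → InBlock o o' x →
        at oL d + at oR d < x + x
      block-beyond {oL} {oR} {d = d} h g g' k (inBlock {m} {d'} (inj₁ refl) _) =
        midblock-before {rank oL} {rank oR} {rank m} {d} {d'} (rank-mono h) (rank-≤ g) k
      block-beyond {oL} {oR} {d = d} h g g' k (inBlock {m} {d'} (inj₂ refl) _) =
        midblock-before {rank oL} {rank oR} {rank m} {d} {d'} (rank-mono h) (rank-≤ g') k

      block-before : ∀ {oL oR o o' d x} → oL ≺ oR → o ≼ oL → o' ≼ oL → InBlock o o' x →
        x + x < at oL d + at oR d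
      block-before {oL} {oR} {d = d} h g g' (inBlock {m} {d'} (inj₁ refl) b) =
        midblock-after {rank oL} {rank oR} {rank m} {d} {d'} (rank-mono h) (rank-≤ g) b
      block-before {oL} {oR} {d = d} h g g' (inBlock {m} {d'} (inj₂ refl) b) =
        midblock-after {rank oL} {rank oR} {rank m} {d} {d'} (rank-mono h) (rank-≤ g') b

    module Neighbours {oL oR : Occ k} {aL aR : Fin 2} (vars : var φ oL <ᶠ var φ oR)
      (levels : level oL aL ≡ level oR aR) (none : ∀ {m} → oL ≺ m → ¬ (m ≺ oR)) where

      private
        lr : oL ≺ oR
        lr = varOrder oL oR vars
        p = occL oL aL
        q = occL oR aR

        beyond : ∀ {w o o'} → oR ≼ o → oR ≼ o' → InBlock o o' (newTop w) → InBlock o o' (newBot w) → Beyond p q w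
        beyond g g' bt bb rewrite sym levels =
          block-beyond lr g g' (topB (level oL aL)) bt , block-beyond lr g g' (botB (level oL aL)) bb

        before′ : ∀ {w o o'} → o ≼ oL → o' ≼ oL → InBlock o o' (newTop w) → InBlock o o' (newBot w) → Before p q w
        before′ g g' bt bb rewrite sym levels = block-before lr g g' bt , block-before lr g g' bb

        after-L : ∀ {m} → oL ≺ m → oR ≼ m
        after-L {m} h with ≼-or-≻ oR m
        ... | inj₁ g = g
        ... | inj₂ g = ⊥-elim (none h g)

        before-R : ∀ {m} → m ≺ oR → m ≼ oL
        before-R {m} h with ≼-or-≻ m oL
        ... | inj₁ g = g
        ... | inj₂ g = ⊥-elim (none g h)

      -- Such a line has both endpoints in blocks from `oR` on. A connector from `oL` itself is
      -- impossible: the next occurrence of that variable, which is smaller than the variable of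
      -- `oR`, would lie between `oL` and `oR`.
      ⊏-beyond : ∀ w → p ⊏ w → Beyond p q w
      ⊏-beyond (occL m a) h with ≼-or-≻ m oL
      ... | inj₂ g = beyond {occL m a} (after-L g) (after-L g) (occTop-block m a) (occBot-block m a)
      ... | inj₁ (inj₁ refl) = ⊥-elim (occ-¬⊏ m aL a h)
      ... | inj₁ (inj₂ g) = ⊥-elim (⊏-asym {p} {occL m a} h (occ≪occ newModel g a aL))
      ⊏-beyond w@(conL m c s) h with ≼-or-≻ m oL
      ... | inj₂ g = beyond {w} (after-L g) (inj₂ (≼-≺ (after-L g) (≺-next c)))
              (conTop-block (value m) m (next c) s) (conBot-block (value m) m (next c) s)
      ... | inj₁ g with ≼-or-≻ (next c) oL
      ...   | inj₁ (inj₁ refl) = ⊥-elim (occ-¬⊏ (next c) aL 1F (⊏-trans {p} {w} {occL (next c) 1F} h (con≪y newModel c s)))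
      ...   | inj₁ (inj₂ g') = ⊥-elim (⊏-asym {p} {w} h (⊏-trans {w} {occL (next c) 1F} {p} (con≪y newModel c s) (occ≪occ newModel g' 1F aL)))
      ...   | inj₂ g' with g
      ...     | inj₂ g″ = ⊥-elim (nothing-between c g″ g')
      ...     | inj₁ refl = ⊥-elim (none g' (varOrder (next c) oR (subst (_<ᶠ var φ oR) (proj₁ (next-succ c)) vars)))

      ⊏-before : ∀ w → w ⊏ q → Before p q w
      ⊏-before (occL m a) h with ≼-or-≻ oR m
      ... | inj₂ g = before′ {occL m a} (before-R g) (before-R g) (occTop-block m a) (occBot-block m a)
      ... | inj₁ (inj₁ refl) = ⊥-elim (occ-¬⊏ m a aR h)
      ... | inj₁ (inj₂ g) = ⊥-elim (⊏-asym {occL m a} {q} h (occ≪occ newModel g aR a))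
      ⊏-before w@(conL m c s) h with ≼-or-≻ (next c) oL
      ... | inj₁ g = before′ {w} (inj₂ (≺-≼ (≺-next c) g)) g
              (conTop-block (value m) m (next c) s) (conBot-block (value m) m (next c) s)
      ... | inj₂ g with ≼-or-≻ oR m
      ...   | inj₁ (inj₁ refl) = ⊥-elim (occ-¬⊏ m 1F aR (⊏-trans {occL m 1F} {w} {q} (y≪con newModel c s) h))
      ...   | inj₁ (inj₂ g') = ⊥-elim (⊏-asym {w} {q} h (⊏-trans {q} {occL m 1F} {w} (occ≪occ newModel g' aR 1F) (y≪con newModel c s)))
      ...   | inj₂ g' with after-L g
      ...     | inj₂ g″ = ⊥-elim (nothing-between c g' g″)
      ...     | inj₁ refl = ⊥-elim (none (varOrder oL m (subst (var φ oL <ᶠ_) (sym (proj₁ (next-succ c))) vars)) g')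

    module Connectors {o} (c : Connector o) where
      private
        p = conL o c left
        q = conL o c right
        p⊏q : p ⊏ q
        p⊏q = con≪con newModel c

        beyond : ∀ w → q ⊏ w → Beyond p q w
        beyond w (a , b) = +-mono-< (<-trans (proj₁ p⊏q) a) a , +-mono-< (<-trans (proj₂ p⊏q) b) b

        before′ : ∀ w → w ⊏ p → Before p q w
        before′ w (a , b) = +-mono-< a (<-trans a (proj₁ p⊏q)) , +-mono-< b (<-trans b (proj₂ p⊏q))

      conPosition : ∀ w → proj₁ (home w) ≢ conT o c → ConPosition w c
      conPosition (occL m a) _ = occ-con-position m a c
      conPosition (conL m c' s) n = con-con-position c' c (λ { refl → n (cong (conT m) (connector-unique c' c)) }) s

      -- A position relative to the connector does not depend on the side, so a line to the right of
      -- `p` is also to the right of `q`.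
      ⊏-beyond : ∀ w → ConPosition w c → p ⊏ w → Beyond p q w
      ⊏-beyond w (after f)  h = beyond w (f newModel right)
      ⊏-beyond w (before f) h = ⊥-elim (⊏-asym {p} {w} h (f newModel left))
      ⊏-beyond w (across f) h = ⊥-elim (crossed-¬⊏ {p} {w} (Crossedᵐ-sym newModel {w} {p} (f newModel left)) h)

      ⊏-before : ∀ w → ConPosition w c → w ⊏ q → Before p q w
      ⊏-before w (before f) h = before′ w (f newModel left)
      ⊏-before w (after f)  h = ⊥-elim (⊏-asym {w} {q} h (f newModel right))
      ⊏-before w (across f) h = ⊥-elim (crossed-¬⊏ {w} {q} (f newModel right) h)

    Adjacent : TrapId → Set
    Adjacent t = ∀ w → ¬ (bline t left ≪ lineOf w × lineOf w ≪ bline t right)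

    separates : ∀ t → Adjacent t → ∀ w → proj₁ (home w) ≢ t →
      (boundary t left ⊏ w → Beyond (boundary t left) (boundary t right) w) ×
      (w ⊏ boundary t right → Before (boundary t left) (boundary t right) w)
    separates (clauseT i AB) adj w _ = N.⊏-beyond w , N.⊏-before w
      where module N = Neighbours {i , 0F} {i , 1F} {0F} {1F} (proj₁ (inc i)) refl (λ {m} h g → adj (occL m 0F) (h 0F 0F , g 0F 1F))
    separates (clauseT i CD) adj w _ = N.⊏-beyond w , N.⊏-before w
      where module N = Neighbours {i , 0F} {i , 2F} {1F} {0F} (Finₚ.<-trans (proj₁ (inc i)) (proj₂ (inc i))) refl (λ {m} h g → adj (occL m 0F) (h 1F 0F , g 0F 0F))
    separates (clauseT i EF) adj w _ = N.⊏-beyond w , N.⊏-before w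
      where module N = Neighbours {i , 1F} {i , 2F} {0F} {1F} (proj₂ (inc i)) refl (λ {m} h g → adj (occL m 0F) (h 0F 0F , g 0F 1F))
    separates (conT o c) adj w n = C.⊏-beyond w (C.conPosition w n) , C.⊏-before w (C.conPosition w n)
      where module C = Connectors c

  -- From an assignment to a bounded tolerance representation

  module ToTolerance {n k : ℕ} (φ : Formula n k) (inc : Increasing φ) (R : RP k) (V : ValidRP φ R)
    (sat : NAESat φ) {H : List Trap} (G : Construction.Gaps φ inc R V H) where

    open ValidRP V
    open Geometry φ R V
    open Model
    open Construction φ inc R V
    open Relations φ inc R V
    open Realisation φ inc R V sat
    open Agreement φ inc R V sat
    open WithGaps G

    -- One coordinate of the new vertices.  For a tied pair the right edge of T_{u,1} and the left edge of
    -- T_{u,4} are both moved to the line halfway between the two lines of the pair.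
    module Coordinate (f : Ln → ℕ) (f-mono : ∀ t → f (boundary t left) < f (boundary t right)) where

      sumf : TrapId → ℕ
      sumf t = f (boundary t left) + f (boundary t right)

      plain : TrapId → Side → ℕ → ℕ
      plain t s e = f (boundary t s) * 16 + e

      middle : TrapId → ℕ
      middle t = sumf t * 8 + 8

      rightCoord : ∀ t → Dec (Tied t) → ∀ {s e} → RightEdge s e → ℕ
      rightCoord t (yes _) halfR = middle t
      rightCoord t _ {s} {e} _ = plain t s e

      leftCoord : ∀ t → Dec (Tied t) → ∀ {s e} → LeftEdge s e → ℕ
      leftCoord t (yes _) halfL = middle t
      leftCoord t _ {s} {e} _ = plain t s e

      data RightView t (d : Dec (Tied t)) {s e} (r : RightEdge s e) : Set where
        plainR  : rightCoord t d r ≡ plain t s e → RightView t d r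
        middleR : Tied t → s ≡ left → rightCoord t d r ≡ middle t → RightView t d r

      data LeftView t (d : Dec (Tied t)) {s e} (l : LeftEdge s e) : Set where
        plainL  : leftCoord t d l ≡ plain t s e → LeftView t d l
        middleL : Tied t → s ≡ right → leftCoord t d l ≡ middle t → LeftView t d l

      rightView : ∀ t d {s e} (r : RightEdge s e) → RightView t d r
      rightView t (yes h) halfR        = middleR h refl refl
      rightView t (yes h) (outerR _ _) = plainR refl
      rightView t (yes h) (farR _ _)   = plainR refl
      rightView t (no h) halfR         = plainR refl
      rightView t (no h) (outerR _ _)  = plainR refl
      rightView t (no h) (farR _ _)    = plainR refl

      leftView : ∀ t d {s e} (l : LeftEdge s e) → LeftView t d l
      leftView t (yes h) halfL        = middleL h refl refl
      leftView t (yes h) (outerL _ _) = plainL refl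
      leftView t (yes h) (farL _ _)   = plainL refl
      leftView t (no h) halfL         = plainL refl
      leftView t (no h) (outerL _ _)  = plainL refl
      leftView t (no h) (farL _ _)    = plainL refl

      plain-< : ∀ {t s e t' s' e'} → e ≤ 15 → f (boundary t s) < f (boundary t' s') → plain t s e < plain t' s' e'
      plain-< {t} {s} {e} {t'} {s'} {e'} k h = lex-< {f (boundary t s)} {f (boundary t' s')} {e} {e'} 16 h (s≤s k)

      plain-<-middle : ∀ {t s e t'} → e ≤ 15 → f (boundary t s) + f (boundary t s) < sumf t' → plain t s e < middle t'
      plain-<-middle {t} {s} {e} {t'} k h = mid-after {f (boundary t' left)} {f (boundary t' right)} {f (boundary t s)} {e} h k

      middle-<-plain : ∀ {t t' s' e'} → 1 ≤ e' → sumf t < f (boundary t' s') + f (boundary t' s') → middle t < plain t' s' e'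
      middle-<-plain {t} {t'} {s'} {e'} k h = mid-before {f (boundary t left)} {f (boundary t right)} {f (boundary t' s')} {e'} h k

      -- The premises on tied pairs serve the cases in which one edge has been moved to the middle;
      -- both cannot have been, since at most one pair is tied.
      coord-< : ∀ {t t' d d' s e s' e'} (r : RightEdge s e) (l : LeftEdge s' e') → t ≢ t' →
        f (boundary t s) < f (boundary t' s') →
        (Tied t → s ≡ left → sumf t < f (boundary t' s') + f (boundary t' s')) →
        (Tied t' → s' ≡ right → f (boundary t s) + f (boundary t s) < sumf t') →
        rightCoord t d r < leftCoord t' d' l
      coord-< {t} {t'} {d} {d'} {s} {e} {s'} {e'} r l m h b b' with rightView t d r | leftView t' d' l
      ... | plainR x        | plainL y         = subst₂ _<_ (sym x) (sym y) (plain-< {t} {s} {e} {t'} {s'} {e'} (proj₂ (rightRange r)) h)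
      ... | middleR tt eq x | plainL y         = subst₂ _<_ (sym x) (sym y) (middle-<-plain {t} {t'} {s'} {e'} (proj₁ (leftRange l)) (b tt eq))
      ... | plainR x        | middleL tt' eq y = subst₂ _<_ (sym x) (sym y) (plain-<-middle {t} {s} {e} {t'} (proj₂ (rightRange r)) (b' tt' eq))
      ... | middleR tt _ _  | middleL tt' _ _  = ⊥-elim (tied-unique m tt tt')

      -- No premise on tied pairs: moving to the middle pushes a right edge right and a left edge
      -- left, which only helps here.
      coord-> : ∀ {t t' d d' s e s' e'} (r : RightEdge s e) (l : LeftEdge s' e') → t ≢ t' →
        f (boundary t' s') < f (boundary t s) → leftCoord t' d' l < rightCoord t d r
      coord-> {t} {t'} {d} {d'} {s} {e} {s'} {e'} r l m h with rightView t d r | leftView t' d' l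
      ... | plainR x        | plainL y         = subst₂ _<_ (sym y) (sym x) (plain-< {t'} {s'} {e'} {t} {s} {e} (proj₂ (leftRange l)) h)
      ... | middleR tt refl x | plainL y       = subst₂ _<_ (sym y) (sym x)
              (plain-<-middle {t'} {s'} {e'} {t} (proj₂ (leftRange l)) (+-mono-< h (<-trans h (f-mono t))))
      ... | plainR x        | middleL tt' refl y = subst₂ _<_ (sym y) (sym x)
              (middle-<-plain {t'} {t} {s} {e} (proj₁ (rightRange r)) (+-mono-< (<-trans (f-mono t') h) h))
      ... | middleR tt _ _  | middleL tt' _ _  = ⊥-elim (tied-unique m tt tt')

      plain-own : ∀ t s {e e'} → e < e' → plain t s e < plain t s e'
      plain-own t s h = +-monoʳ-< (f (boundary t s) * 16) h

      left-<-middle : ∀ t {e} → e ≤ 15 → plain t left e < middle t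
      left-<-middle t {e} k = plain-<-middle {t} {left} {e} {t} k (+-monoʳ-< (f (boundary t left)) (f-mono t))

      middle-<-right : ∀ t {e} → 1 ≤ e → middle t < plain t right e
      middle-<-right t {e} k = middle-<-plain {t} {t} {right} {e} k (+-monoˡ-< (f (boundary t right)) (f-mono t))

      left-<-right : ∀ t {e e'} → e ≤ 15 → plain t left e < plain t right e'
      left-<-right t {e} {e'} k = plain-< {t} {left} {e} {t} {right} {e'} k (f-mono t)

    module Top = Coordinate newTop (λ t → proj₁ (boundary-≪ t newModel))
    module Bot = Coordinate newBot (λ t → proj₂ (boundary-≪ t newModel))

    newRight : ∀ t → Dec (Tied t) → ∀ {s e} → RightEdge s e → NLine
    newRight t d r = Top.rightCoord t d r , Bot.rightCoord t d r

    newLeft : ∀ t → Dec (Tied t) → ∀ {s e} → LeftEdge s e → NLine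
    newLeft t d l = Top.leftCoord t d l , Bot.leftCoord t d l

    Agrees : ∀ t t' → Dec (Tied t) → Dec (Tied t') → ∀ {s e s' e'} → RightEdge s e → LeftEdge s' e' → Set
    Agrees t t' d d' {s} {e} {s'} {e'} r l =
      Agree (translate t (s , e) ≪ translate t' (s' , e')) (newRight t d r ≪ⁿ newLeft t' d' l)

    home-≢ : ∀ {t t'} s' → t ≢ t' → proj₁ (home (boundary t' s')) ≢ t
    home-≢ {t} {t'} s' m e = m (trans (sym e) (cong proj₁ (home-boundary t' s')))

    -- `position` gives one answer for R_P and the new model; it survives the shifts on both sides,
    -- and `separates` supplies what moved edges require.
    agree-apart : ∀ {t t'} d d' {s e s' e'} (r : RightEdge s e) (l : LeftEdge s' e') → t ≢ t' → Agrees t t' d d' r l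
    agree-apart {t} {t'} d d' {s} {e} {s'} {e'} r l m
      with position (boundary t s) (boundary t' s') (boundary-≢ m s s')
    ... | before h = both (near-≪ {t} {t'} s s' e e' m (rightRange r) (leftRange l) (h givenModel))
          ( Top.coord-< {d = d} {d'} r l m (proj₁ (h newModel)) (λ tt eq → proj₁ (beyond tt eq)) (λ tt eq → proj₁ (before′ tt eq))
          , Bot.coord-< {d = d} {d'} r l m (proj₂ (h newModel)) (λ tt eq → proj₂ (beyond tt eq)) (λ tt eq → proj₂ (before′ tt eq)))
      where
      beyond : Tied t → s ≡ left → Beyond (boundary t left) (boundary t right) (boundary t' s')
      beyond tt refl = proj₁ (separates t (tied-adjacent {t} tt) (boundary t' s') (home-≢ s' m)) (h newModel)
      before′ : Tied t' → s' ≡ right → Before (boundary t' left) (boundary t' right) (boundary t s)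
      before′ tt refl = proj₂ (separates t' (tied-adjacent {t'} tt) (boundary t s) (home-≢ s (≢-sym m))) (h newModel)
    ... | after h = neither
          (λ g → ≪-irrefl (≪-trans g (near-≪ {t'} {t} s' s e' e (≢-sym m) (leftRange l) (rightRange r) (h givenModel))))
          (λ g → <-asym (proj₁ g) (Top.coord-> {d = d} {d'} r l m (proj₁ (h newModel))))
    ... | across h = neither
          (crossed⇒¬≪ (near-crossed {t} {t'} s s' e e' m (rightRange r) (leftRange l) (h givenModel)))
          (not (h newModel))
      where
      not : Crossedᵐ newModel (boundary t s) (boundary t' s') → ¬ (newRight t d r ≪ⁿ newLeft t' d' l)
      not (inj₁ (_ , b)) g = <-asym (proj₂ g) (Bot.coord-> {d = d} {d'} r l m b)
      not (inj₂ (a , _)) g = <-asym (proj₁ g) (Top.coord-> {d = d} {d'} r l m a)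

    agree-own : ∀ t d {s e s' e'} (r : RightEdge s e) (l : LeftEdge s' e') → Agrees t t d d r l
    -- Both edges become the same halfway line: T_{u,1} and T_{u,4} touch, which counts as
    -- intersecting.
    agree-own t (yes tied) halfR halfL = neither tied (λ g → <-irrefl refl (proj₁ g))
    agree-own t (no ¬tt) halfR halfL = both (¬tied t ¬tt)
      (Top.left-<-right t (from-yes (12 ≤? 15)) , Bot.left-<-right t (from-yes (12 ≤? 15)))
    agree-own t (yes tied) {e' = e'} halfR (outerL h k) = both
      (own-≪ t 12 e' (inj₂ (≤-refl , ≤-trans (from-yes (5 ≤? 10)) h)))
      (Top.middle-<-right t 1≤e' , Bot.middle-<-right t 1≤e')
      where 1≤e' = ≤-trans (from-yes (1 ≤? 10)) h
    agree-own t (no _) {e' = e'} halfR (outerL h k) = both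
      (own-≪ t 12 e' (inj₂ (≤-refl , ≤-trans (from-yes (5 ≤? 10)) h)))
      (Top.left-<-right t (from-yes (12 ≤? 15)) , Bot.left-<-right t (from-yes (12 ≤? 15)))
    agree-own t (yes tied) {e' = e'} halfR (farL h k) = neither
      (shift-¬≪ (bline t left) {ε t} {12} {e'} (ε-pos t) (≤-trans k (from-yes (8 ≤? 12))))
      (λ g → <-asym (proj₁ g) (Top.left-<-middle t (≤-trans k (from-yes (8 ≤? 15)))))
    agree-own t (no _) {e' = e'} halfR (farL h k) = neither
      (shift-¬≪ (bline t left) {ε t} {12} {e'} (ε-pos t) (≤-trans k (from-yes (8 ≤? 12))))
      (λ g → <-asym (proj₁ g) (Top.plain-own t left (≤-<-trans k (from-yes (8 <? 12)))))
    agree-own t (yes tied) {e = e} (outerR h k) halfL = both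
      (own-≪ t e 4 (inj₁ (≤-trans k (from-yes (6 ≤? 11)) , ≤-refl)))
      (Top.left-<-middle t (≤-trans k (from-yes (6 ≤? 15))) , Bot.left-<-middle t (≤-trans k (from-yes (6 ≤? 15))))
    agree-own t (no _) {e = e} (outerR h k) halfL = both
      (own-≪ t e 4 (inj₁ (≤-trans k (from-yes (6 ≤? 11)) , ≤-refl)))
      (Top.left-<-right t (≤-trans k (from-yes (6 ≤? 15))) , Bot.left-<-right t (≤-trans k (from-yes (6 ≤? 15))))
    agree-own t d {e = e} {e' = e'} (outerR h k) (outerL h' k') = both
      (own-≪ t e e' (inj₁ (≤-trans k (from-yes (6 ≤? 11)) , ≤-trans (from-yes (4 ≤? 10)) h')))
      (plains d)
      where
      plains : ∀ d → newRight t d (outerR h k) ≪ⁿ newLeft t d (outerL h' k')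
      plains (yes _) = Top.left-<-right t (≤-trans k (from-yes (6 ≤? 15))) , Bot.left-<-right t (≤-trans k (from-yes (6 ≤? 15)))
      plains (no _)  = Top.left-<-right t (≤-trans k (from-yes (6 ≤? 15))) , Bot.left-<-right t (≤-trans k (from-yes (6 ≤? 15)))
    agree-own t d {e = e} {e' = e'} (outerR h k) (farL h' k') with e <? e'
    ... | yes lt = both (shift-mono-≪ (bline t left) {ε t} {e} {e'} (ε-pos t) lt) (plains d)
      where
      plains : ∀ d → newRight t d (outerR h k) ≪ⁿ newLeft t d (farL h' k')
      plains (yes _) = Top.plain-own t left lt , Bot.plain-own t left lt
      plains (no _)  = Top.plain-own t left lt , Bot.plain-own t left lt
    ... | no ge = neither (shift-¬≪ (bline t left) {ε t} {e} {e'} (ε-pos t) (≮⇒≥ ge)) (plains d)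
      where
      plains : ∀ d → ¬ (newRight t d (outerR h k) ≪ⁿ newLeft t d (farL h' k'))
      plains (yes _) g = ge (+-cancelˡ-< (newTop (boundary t left) * 16) e e' (proj₁ g))
      plains (no _) g  = ge (+-cancelˡ-< (newTop (boundary t left) * 16) e e' (proj₁ g))
    agree-own t (yes tied) {e = e} (farR h k) halfL = neither
      (shift-¬≪ (bline t right) {ε t} {e} {4} (ε-pos t) (≤-trans (from-yes (4 ≤? 8)) h))
      (λ g → <-asym (proj₁ g) (Top.middle-<-right t (≤-trans (from-yes (1 ≤? 8)) h)))
    agree-own t (no _) {e = e} (farR h k) halfL = neither
      (shift-¬≪ (bline t right) {ε t} {e} {4} (ε-pos t) (≤-trans (from-yes (4 ≤? 8)) h))
      (λ g → <-asym (proj₁ g) (Top.plain-own t right (<-≤-trans (from-yes (4 <? 8)) h)))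
    agree-own t d {e = e} {e' = e'} (farR h k) (outerL h' k') with e <? e'
    ... | yes lt = both (shift-mono-≪ (bline t right) {ε t} {e} {e'} (ε-pos t) lt) (plains d)
      where
      plains : ∀ d → newRight t d (farR h k) ≪ⁿ newLeft t d (outerL h' k')
      plains (yes _) = Top.plain-own t right lt , Bot.plain-own t right lt
      plains (no _)  = Top.plain-own t right lt , Bot.plain-own t right lt
    ... | no ge = neither (shift-¬≪ (bline t right) {ε t} {e} {e'} (ε-pos t) (≮⇒≥ ge)) (plains d)
      where
      plains : ∀ d → ¬ (newRight t d (farR h k) ≪ⁿ newLeft t d (outerL h' k'))
      plains (yes _) g = ge (+-cancelˡ-< (newTop (boundary t right) * 16) e e' (proj₁ g))
      plains (no _) g  = ge (+-cancelˡ-< (newTop (boundary t right) * 16) e e' (proj₁ g))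
    agree-own t d {e = e} {e' = e'} (farR h k) (farL h' k') = neither (own-¬≪ t e e' h k') (plains d)
      where
      plains : ∀ d → ¬ (newRight t d (farR h k) ≪ⁿ newLeft t d (farL h' k'))
      plains (yes _) g = <-asym (proj₁ g) (Top.left-<-right t (≤-trans k' (from-yes (8 ≤? 15))))
      plains (no _) g  = <-asym (proj₁ g) (Top.left-<-right t (≤-trans k' (from-yes (8 ≤? 15))))

    vertexRight vertexLeft : TrapId → Fin 7 → NLine
    vertexRight t v = newRight t (tied? t) (rightEdge-view v)
    vertexLeft t v = newLeft t (tied? t) (leftEdge-view v)

    agree : ∀ t v t' v' → Agree (vertex t v ◁ vertex t' v') (vertexRight t v ≪ⁿ vertexLeft t' v')
    agree t v t' v' with t ≟ᵗ t'
    ... | yes refl = agree-own t (tied? t) (rightEdge-view v) (leftEdge-view v')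
    ... | no m     = agree-apart (tied? t) (tied? t') (rightEdge-view v) (leftEdge-view v') m

    private
      same-side : ∀ a b e e' → e ≤ e' → NParallelogram (a * 16 + e , b * 16 + e) (a * 16 + e' , b * 16 + e')
      same-side a b e e' h = npar (+-monoʳ-≤ (a * 16) h)
        (solve 4 (λ a b e e' → (a :+ e) :+ (b :+ e') := (a :+ e') :+ (b :+ e)) refl (a * 16) (b * 16) e e')

      scaled : ∀ a b c d → a + d ≡ c + b → a * 8 + d * 8 ≡ c * 8 + b * 8
      scaled a b c d eq = trans (sym (*-distribʳ-+ 8 a d)) (trans (cong (_* 8) eq) (*-distribʳ-+ 8 c b))

      whole : ∀ a b c d → a < c → a + d ≡ c + b → NParallelogram (a * 16 + 8 , b * 16 + 8) (c * 16 + 8 , d * 16 + 8)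
      whole a b c d h eq = npar (+-monoˡ-≤ 8 (*-monoˡ-≤ 16 (<⇒≤ h))) (begin
        (a * 16 + 8) + (d * 16 + 8)    ≡⟨ solve 2 (λ a d → (a :* constant 16 :+ constant 8) :+ (d :* constant 16 :+ constant 8) := (a :* constant 8 :+ d :* constant 8) :+ (a :* constant 8 :+ d :* constant 8) :+ constant 16) refl a d ⟩
        (a * 8 + d * 8) + (a * 8 + d * 8) + 16 ≡⟨ cong (λ z → z + z + 16) (scaled a b c d eq) ⟩
        (c * 8 + b * 8) + (c * 8 + b * 8) + 16 ≡⟨ solve 2 (λ a d → (a :* constant 16 :+ constant 8) :+ (d :* constant 16 :+ constant 8) := (a :* constant 8 :+ d :* constant 8) :+ (a :* constant 8 :+ d :* constant 8) :+ constant 16) refl c b ⟨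
        (c * 16 + 8) + (b * 16 + 8)    ∎)
        where open ≡-Reasoning

      to-middle : ∀ a b c d e → a * 16 + e < (a + c) * 8 + 8 → a + d ≡ c + b →
        NParallelogram (a * 16 + e , b * 16 + e) ((a + c) * 8 + 8 , (b + d) * 8 + 8)
      to-middle a b c d e h eq = npar (<⇒≤ h) (begin
        (a * 16 + e) + ((b + d) * 8 + 8)   ≡⟨ solve 4 (λ a b d e → (a :* constant 16 :+ e) :+ ((b :+ d) :* constant 8 :+ constant 8) := (a :* constant 8 :+ d :* constant 8) :+ (a :* constant 8 :+ b :* constant 8 :+ e :+ constant 8)) refl a b d e ⟩
        (a * 8 + d * 8) + (a * 8 + b * 8 + e + 8) ≡⟨ cong (_+ (a * 8 + b * 8 + e + 8)) (scaled a b c d eq) ⟩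
        (c * 8 + b * 8) + (a * 8 + b * 8 + e + 8) ≡⟨ solve 4 (λ a b c e → (c :* constant 8 :+ b :* constant 8) :+ (a :* constant 8 :+ b :* constant 8 :+ e :+ constant 8) := ((a :+ c) :* constant 8 :+ constant 8) :+ (b :* constant 16 :+ e)) refl a b c e ⟩
        ((a + c) * 8 + 8) + (b * 16 + e)   ∎)
        where open ≡-Reasoning

      from-middle : ∀ a b c d e → (a + c) * 8 + 8 < c * 16 + e → a + d ≡ c + b →
        NParallelogram ((a + c) * 8 + 8 , (b + d) * 8 + 8) (c * 16 + e , d * 16 + e)
      from-middle a b c d e h eq = npar (<⇒≤ h) (begin
        ((a + c) * 8 + 8) + (d * 16 + e)   ≡⟨ solve 4 (λ a c d e → ((a :+ c) :* constant 8 :+ constant 8) :+ (d :* constant 16 :+ e) := (a :* constant 8 :+ d :* constant 8) :+ (c :* constant 8 :+ d :* constant 8 :+ e :+ constant 8)) refl a c d e ⟩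
        (a * 8 + d * 8) + (c * 8 + d * 8 + e + 8) ≡⟨ cong (_+ (c * 8 + d * 8 + e + 8)) (scaled a b c d eq) ⟩
        (c * 8 + b * 8) + (c * 8 + d * 8 + e + 8) ≡⟨ solve 4 (λ b c d e → (c :* constant 8 :+ b :* constant 8) :+ (c :* constant 8 :+ d :* constant 8 :+ e :+ constant 8) := (c :* constant 16 :+ e) :+ ((b :+ d) :* constant 8 :+ constant 8)) refl b c d e ⟩
        (c * 16 + e) + ((b + d) * 8 + 8)   ∎)
        where open ≡-Reasoning

    -- For a tied pair, the halfway line is parallel to both lines of the pair because these are
    -- parallel to each other.
    vertex-parallelogram : ∀ t v d → NParallelogram (newLeft t d (leftEdge-view v)) (newRight t d (rightEdge-view v))
    vertex-parallelogram t 0F (yes _) = whole (newTop (boundary t left)) (newBot (boundary t left)) (newTop (boundary t right)) (newBot (boundary t right)) (proj₁ (boundary-≪ t newModel)) (new-parallel t)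
    vertex-parallelogram t 0F (no _)  = whole (newTop (boundary t left)) (newBot (boundary t left)) (newTop (boundary t right)) (newBot (boundary t right)) (proj₁ (boundary-≪ t newModel)) (new-parallel t)
    vertex-parallelogram t 1F (yes _) = to-middle (newTop (boundary t left)) (newBot (boundary t left)) (newTop (boundary t right)) (newBot (boundary t right)) 4 (Top.left-<-middle t (from-yes (4 ≤? 15))) (new-parallel t)
    vertex-parallelogram t 1F (no _)  = same-side (newTop (boundary t left)) (newBot (boundary t left)) 4 12 (from-yes (4 ≤? 12))
    vertex-parallelogram t 2F (yes _) = same-side (newTop (boundary t left)) (newBot (boundary t left)) 2 6 (from-yes (2 ≤? 6))
    vertex-parallelogram t 2F (no _)  = same-side (newTop (boundary t left)) (newBot (boundary t left)) 2 6 (from-yes (2 ≤? 6))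
    vertex-parallelogram t 3F (yes _) = same-side (newTop (boundary t left)) (newBot (boundary t left)) 1 5 (from-yes (1 ≤? 5))
    vertex-parallelogram t 3F (no _)  = same-side (newTop (boundary t left)) (newBot (boundary t left)) 1 5 (from-yes (1 ≤? 5))
    vertex-parallelogram t 4F (yes _) = from-middle (newTop (boundary t left)) (newBot (boundary t left)) (newTop (boundary t right)) (newBot (boundary t right)) 12 (Top.middle-<-right t (from-yes (1 ≤? 12))) (new-parallel t)
    vertex-parallelogram t 4F (no _)  = same-side (newTop (boundary t right)) (newBot (boundary t right)) 4 12 (from-yes (4 ≤? 12))
    vertex-parallelogram t 5F (yes _) = same-side (newTop (boundary t right)) (newBot (boundary t right)) 10 14 (from-yes (10 ≤? 14))
    vertex-parallelogram t 5F (no _)  = same-side (newTop (boundary t right)) (newBot (boundary t right)) 10 14 (from-yes (10 ≤? 14))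
    vertex-parallelogram t 6F (yes _) = same-side (newTop (boundary t right)) (newBot (boundary t right)) 11 15 (from-yes (11 ≤? 15))
    vertex-parallelogram t 6F (no _)  = same-side (newTop (boundary t right)) (newBot (boundary t right)) 11 15 (from-yes (11 ≤? 15))

    private
      idOf : Fin (length H) → TrapId
      idOf i = proj₁ (∈-vertex (∈-lookup {xs = H} i))
      vxOf : Fin (length H) → Fin 7
      vxOf i = proj₁ (proj₂ (∈-vertex (∈-lookup {xs = H} i)))
      lookup-vertex : ∀ i → lookup H i ≡ vertex (idOf i) (vxOf i)
      lookup-vertex i = proj₂ (proj₂ (∈-vertex (∈-lookup {xs = H} i)))

      nl nr : Fin (length H) → NLine
      nl i = vertexLeft (idOf i) (vxOf i)
      nr i = vertexRight (idOf i) (vxOf i)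

      agreeᵢ : ∀ i j → Agree (lookup H i ◁ lookup H j) (nr i ≪ⁿ nl j)
      agreeᵢ i j = subst₂ (λ T T' → Agree (T ◁ T') (nr i ≪ⁿ nl j)) (sym (lookup-vertex i)) (sym (lookup-vertex j))
        (agree (idOf i) (vxOf i) (idOf j) (vxOf j))

      agree-to : ∀ {A B} → Agree A B → A → B
      agree-to (both _ b) _ = b
      agree-to (neither n _) a = ⊥-elim (n a)

      agree-from : ∀ {A B} → Agree A B → B → A
      agree-from (both a _) _ = a
      agree-from (neither _ n) b = ⊥-elim (n b)

    boundedTolerance : IsBoundedTolerance (length H) (TrapAdj H)
    boundedTolerance = parallelograms⇒boundedTolerance nl nr
      (λ i → vertex-parallelogram (idOf i) (vxOf i) (tied? (idOf i)))
      (λ { i j _ (_ , int) (inj₁ h) → int (inj₁ (agree-from (agreeᵢ i j) h))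
         ; i j _ (_ , int) (inj₂ h) → int (inj₂ (agree-from (agreeᵢ j i) h)) })
      (λ i j i≢j n → i≢j , λ { (inj₁ h) → n (inj₁ (agree-to (agreeᵢ i j) h)) ; (inj₂ h) → n (inj₂ (agree-to (agreeᵢ j i) h)) })

open NaturalRepresentation

theorem3p2 : (n k : ℕ) (φ : Formula n k) → Increasing φ →
    (R : RP k) → ValidRP φ R →
    (ord : List Trap) → ord ↭ pairsOf R →
    (NAESat φ → IsBoundedTolerance (length (buildH R ord)) (TrapAdj (buildH R ord))) ×
    (IsBoundedTolerance (length (buildH R ord)) (TrapAdj (buildH R ord)) → NAESat φ)
theorem3p2 n k φ inc R V ord ord↭ =
    (λ sat → ToTolerance.boundedTolerance φ inc R V sat G)
  , (λ bt → Relations.FromTolerance.naeSat φ inc R V G bt)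
  where
  G = Construction.gapsOf φ inc R V ord↭
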